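{- Let $a>1$ and $0\le b<\min(1,1/(a-1))$ be fixed parameters. Suppose there is an algorithm that, for every $n$-vertex directed (possibly weighted) graph, every $\epsilon\in(0,1)$ and every positive integer $\beta\le n^b$, computes a $(\beta,\epsilon)$-hopset with $\widetilde{O}_{\epsilon}(n^2/\beta^a)$ edges. Then for every $n$-vertex directed (possibly weighted) graph $G$, every $\epsilon\in(0,1)$ and every set $P\subseteq V\times V$ of $p$ demand pairs, one can compute a $(1+\epsilon')$-distance preserver $G^*\subseteq G$ for $P$, where $\epsilon'=O(\epsilon\log\log n)$ and $$|G^*|=\widetilde{O}_{\epsilon'}\left(n\cdot p^{1-1/k}+n^{2/a}\cdot p^{1-1/a}\right)\quad\text{for}\quad k=\frac{2-a\cdot b}{1-b}.$$
   Context: Edge weights are positive and polynomially bounded in $n$. $\widetilde{O}(\cdot)$ hides $\mathrm{poly}(\log n)$ factors; $\widetilde{O}_{\epsilon}(\cdot)$ additionally hides factors polynomial in $1/\epsilon$. $|G^*|$ denotes the number of edges of $G^*$. $\mathrm{dist}_G(u,v)$ is the weighted shortest-path distance from $u$ to $v$, and $\mathrm{dist}^{(\beta)}_{G}(u,v)$ is the minimum length of a $u$-$v$ path in $G$ with at most $\beta$ edges ($\infty$ if none). A $(\beta,\epsilon)$-hopset for $G=(V,E)$ is a set $H\subseteq V\times V$ of weighted edges (each weighted by the shortest-path distance in $G$ between its endpoints) such that $\mathrm{dist}_G(u,v)\le \mathrm{dist}^{(\beta)}_{G\cup H}(u,v)\le(1+\epsilon)\mathrm{dist}_G(u,v)$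 for all $u,v\in V$. A $(1+\epsilon)$-distance preserver for a pair set $P\subseteq V\times V$ is a subgraph $G^*\subseteq G$ with $\mathrm{dist}_{G^*}(u,v)\le(1+\epsilon)\,\mathrm{dist}_G(u,v)$ for every $(u,v)\in P$.
   Formalization: Edge weights are rational instead of real, both for the assumed hopset algorithm and for the graph G; "polynomially bounded" means each weight lies between 1/n^c and n^c for a constant c. -}

module Defs where

open import Data.Fin using (Fin)
open import Data.Fin.Subset using (Subset; _∈_; _⊆_; ∣_∣)
open import Data.Integer as ℤ using (ℤ; _⊖_)
open import Data.Nat as ℕ using (ℕ; zero; suc)
open import Data.Nat.Logarithm using (⌊log₂_⌋)
open import Data.Product using (∃; ∃₂; Σ; _×_; _,_)
open import Data.Rational as ℚ using (ℚ; 0ℚ; 1ℚ)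
open import Data.Sum using (_⊎_)
open import Data.Vec using (sum; tabulate)
open import Algebra.Definitions.RawSemiring ℚ.+-*-rawSemiring using () renaming (_^_ to _^ℚ_)
open import Function.Bundles using (_⇔_)
open import Relation.Binary.PropositionalEquality using (_≡_)
open import Relation.Nullary using (¬_)
open import Relation.Nullary.Construct.Add.Supremum using (_⁺; [_]; ⊤⁺)
import Relation.Binary.Construct.Add.Supremum.NonStrict as AddSup

------------------------------------------------------------------------
-- Dedekind reals
--
-- `L q` stands for q < x and `U q` for x < q.  Operations are given on
-- bare pairs of predicates by the usual formulas for Dedekind cuts; a
-- real number is a cut satisfying `IsReal`.  `located` is a proof-relevant
-- disjunction, so a real carries a procedure approximating it.

record Cut : Set₁ where
  field
    L U : ℚ → Set

open Cut public

record IsReal (x : Cut) : Set where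
  field
    inhabitedˡ : ∃ λ q → L x q
    inhabitedᵘ : ∃ λ q → U x q
    roundedˡ   : ∀ q → L x q ⇔ (∃ λ r → q ℚ.< r × L x r)
    roundedᵘ   : ∀ q → U x q ⇔ (∃ λ r → r ℚ.< q × U x r)
    disjoint   : ∀ q → ¬ (L x q × U x q)
    located    : ∀ q r → q ℚ.< r → L x q ⊎ U x r

infix  4 _≤_ _<_
infixl 6 _+_ _-_
infixl 7 _*_ _/_ _⊓_
infixr 8 _^_ _^ℕ_
infix  9 _⁻¹

_≤_ : Cut → Cut → Set
x ≤ y = ∀ q → L x q → L y q

_<_ : Cut → Cut → Set
x < y = ∃ λ q → U x q × L y q

fromℚ : ℚ → Cut
fromℚ p .L q = q ℚ.< p
fromℚ p .U q = p ℚ.< q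

ℕtoℚ : ℕ → ℚ
ℕtoℚ n = (ℤ.+ n) ℚ./ 1

fromℕ : ℕ → Cut
fromℕ n = fromℚ (ℕtoℚ n)

_⊓_ : Cut → Cut → Cut
(x ⊓ y) .L q = L x q × L y q
(x ⊓ y) .U q = U x q ⊎ U y q

_+_ : Cut → Cut → Cut
(x + y) .L q = ∃₂ λ r s → L x r × L y s × q ℚ.< r ℚ.+ s
(x + y) .U q = ∃₂ λ r s → U x r × U y s × r ℚ.+ s ℚ.< q

_-_ : Cut → Cut → Cut
(x - y) .L q = ∃₂ λ r s → L x r × U y s × q ℚ.< r ℚ.- s
(x - y) .U q = ∃₂ λ r s → U x r × L y s × r ℚ.- s ℚ.< q

-- Interval arithmetic: the extrema of a product over a box are attained
-- at corners, whatever the signs.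

record Box (x y : Cut) : Set where
  field
    r r′ s s′ : ℚ
    r<x  : L x r
    x<r′ : U x r′
    s<y  : L y s
    y<s′ : U y s′

_*_ : Cut → Cut → Cut
(x * y) .L q = Σ (Box x y) λ B → let open Box B in
  q ℚ.< r ℚ.* s × q ℚ.< r ℚ.* s′ × q ℚ.< r′ ℚ.* s × q ℚ.< r′ ℚ.* s′
(x * y) .U q = Σ (Box x y) λ B → let open Box B in
  r ℚ.* s ℚ.< q × r ℚ.* s′ ℚ.< q × r′ ℚ.* s ℚ.< q × r′ ℚ.* s′ ℚ.< q

-- The reciprocal of a positive real; meaningless for x ≤ 0.

_⁻¹ : Cut → Cut
(x ⁻¹) .L q = ∃ λ r → 0ℚ ℚ.< r × U x r × q ℚ.* r ℚ.< 1ℚ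
(x ⁻¹) .U q = ∃ λ r → 0ℚ ℚ.< r × L x r × 1ℚ ℚ.< q ℚ.* r

_/_ : Cut → Cut → Cut
x / y = x * y ⁻¹

_^ℕ_ : Cut → ℕ → Cut
x ^ℕ zero  = fromℕ 1
x ^ℕ suc k = x * x ^ℕ k

-- Real powers of natural numbers.  For m ≥ 1, monotonicity in the exponent
-- gives q < m ^ y iff q < m ^ r for some rational r < y (and dually).  With
-- r = (i - j) / (t + 1) and q > 0, q < m ^ r means q^(t+1) · m^j < m^i.
-- For m = 0 only exponents y > 0 are meant.

_^_ : ℕ → Cut → Cut
zero      ^ y = fromℕ 0
m@(suc _) ^ y = λ where
  .L q → q ℚ.≤ 0ℚ ⊎
         (∃ λ i → ∃₂ λ j t → L y ((i ⊖ j) ℚ./ suc t) ×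
           (q ^ℚ suc t) ℚ.* ℕtoℚ (m ℕ.^ j) ℚ.< ℕtoℚ (m ℕ.^ i))
  .U q → 0ℚ ℚ.< q ×
         (∃ λ i → ∃₂ λ j t → U y ((i ⊖ j) ℚ./ suc t) ×
           ℕtoℚ (m ℕ.^ i) ℚ.< (q ^ℚ suc t) ℚ.* ℕtoℚ (m ℕ.^ j))

------------------------------------------------------------------------
-- Weighted directed graphs on the vertex set Fin n

-- A set of ordered pairs: v ∈ P u iff (u , v) belongs to the set.

PairSet : ℕ → Set
PairSet n = Fin n → Subset n

size : ∀ {n} → PairSet n → ℕ
size P = sum (tabulate λ u → ∣ P u ∣)

-- `weight` is irrelevant outside `edges`.

record Digraph (n : ℕ) : Set where
  field
    edges  : PairSet n
    weight : Fin n → Fin n → ℚ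

open Digraph public

-- Polynomially bounded positive weights.  As graphs can be rescaled, an upper
-- bound n^c alone would say nothing; the bound is on both w and 1/w.  Positive
-- integer weights at most n^c, and unit weights, are covered.

PolyBounded : ∀ {n} → ℕ → Digraph n → Set
PolyBounded {n} c G = ∀ u v → v ∈ edges G u →
  0ℚ ℚ.< weight G u v ×
  weight G u v ℚ.≤ ℕtoℚ (n ℕ.^ c) ×
  1ℚ ℚ.≤ ℕtoℚ (n ℕ.^ c) ℚ.* weight G u v

-- The spanning subgraph with edge set E (used for E contained in `edges G`).

_↾_ : ∀ {n} → Digraph n → PairSet n → Digraph n
G ↾ E = record { edges = E ; weight = weight G }

-- Weighted arcs, parallel arcs allowed: A u v w says that there is an arc
-- from u to v of weight w.

Arcs : ℕ → Set₁
Arcs n = Fin n → Fin n → ℚ → Set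

-- Walk A u v k ℓ : walks from u to v with k arcs and length ℓ.  For positive
-- weights, minimising over walks or over simple paths is the same.

data Walk {n} (A : Arcs n) : Fin n → Fin n → ℕ → ℚ → Set where
  nil  : ∀ {u} → Walk A u u 0 0ℚ
  cons : ∀ {u x v w k ℓ} → A u x w → Walk A x v k ℓ →
         Walk A u v (suc k) (w ℚ.+ ℓ)

-- Distances live in ℚ ⁺, with ⊤⁺ as ∞ (the minimum of the empty set).

IsMin : (ℚ → Set) → ℚ ⁺ → Set
IsMin S [ d ] = S d × (∀ ℓ → S ℓ → d ℚ.≤ ℓ)
IsMin S ⊤⁺    = ∀ ℓ → ¬ S ℓ

Dist : ∀ {n} → Arcs n → Fin n → Fin n → ℚ ⁺ → Set
Dist A u v = IsMin λ ℓ → ∃ λ k → Walk A u v k ℓ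

HopDist : ∀ {n} → ℕ → Arcs n → Fin n → Fin n → ℚ ⁺ → Set
HopDist β A u v = IsMin λ ℓ → ∃ λ k → k ℕ.≤ β × Walk A u v k ℓ

arcs : ∀ {n} → Digraph n → Arcs n
arcs G u v w = v ∈ edges G u × w ≡ weight G u v

-- G ∪ H, each pair of H being weighted by its distance in G (a pair at
-- infinite distance contributes no arc).

_∪ʰ_ : ∀ {n} → Digraph n → PairSet n → Arcs n
(G ∪ʰ H) u v w = arcs G u v w ⊎ (v ∈ H u × Dist (arcs G) u v [ w ])

open AddSup ℚ._≤_ public using (_≤⁺_)

-- d ≤ t · d′ in the extended sense.

_≤[_]·_ : ℚ ⁺ → Cut → ℚ ⁺ → Set
d ≤[ t ]· d′ = AddSup._≤⁺_ (λ x y → fromℚ x ≤ t * fromℚ y) d d′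

IsHopset : ∀ {n} → Digraph n → ℕ → Cut → PairSet n → Set
IsHopset G β ε H = ∀ u v → ∃₂ λ d d′ →
  Dist (arcs G) u v d × HopDist β (G ∪ʰ H) u v d′ ×
  d ≤⁺ d′ × d′ ≤[ fromℕ 1 + ε ]· d

IsPreserver : ∀ {n} → Digraph n → Cut → PairSet n → PairSet n → Set
IsPreserver G ε P E =
  (∀ u → E u ⊆ edges G u) ×
  (∀ u v → v ∈ P u → ∃₂ λ d d* →
    Dist (arcs G) u v d × Dist (arcs (G ↾ E)) u v d* ×
    d* ≤[ fromℕ 1 + ε ]· d)

------------------------------------------------------------------------
-- Asymptotics

-- log n and log log n up to constant factors, kept ≥ 1 for small n.

log loglog : ℕ → ℕ
log    n = 1 ℕ.+ ⌊log₂ n ⌋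
loglog n = 1 ℕ.+ ⌊log₂ ⌊log₂ n ⌋ ⌋

-- Any factor poly(log n) · poly(1/ε) is at most `Hidden C e n ε` for suitable
-- constants C and e, so a quantity is Õ_ε(f) iff it is bounded by
-- `Hidden C e n ε * f` for some C and e.

Hidden : (C e n : ℕ) → Cut → Cut
Hidden C e n ε = fromℕ C * (fromℕ (log n) * (fromℕ 1 + ε ⁻¹)) ^ℕ e

-- An algorithm is a (constructive, hence computable) function.  The constants
-- hidden by Õ may depend on the exponent c bounding the weights, and on
-- nothing else.

HopsetAlgorithm : Cut → Cut → Set₁
HopsetAlgorithm a b =
  ∀ (c : ℕ) → ∃₂ λ (C e : ℕ) →
  ∀ (n : ℕ) (G : Digraph n) → PolyBounded c G →
  ∀ (ε : Cut) → IsReal ε → fromℕ 0 < ε → ε < fromℕ 1 →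
  ∀ (β : ℕ) → 1 ℕ.≤ β → fromℕ β ≤ n ^ b →
  ∃ λ (H : PairSet n) →
    IsHopset G β ε H ×
    fromℕ (size H) ≤ Hidden C e n ε * (fromℕ (n ℕ.^ 2) / β ^ a)

-- A set P of demand pairs is reduced, level by level, to half as many.  Take a set S of s vertices
-- meeting every h consecutive vertices of the shortest paths between demand pairs; a greedy S has
-- h ≈ n/s up to logarithms.  Pairs of S at most 2h hops apart form a graph on S, and in a hopset for it
-- every demand is served by β hops.  A hop of the graph is a short path of G, whose at most 2h edges are
-- stored; a hop of the hopset becomes a new demand.  So a level stores about p β n/s edges and leaves
-- s²/β^a demands.  With β = s^b and s ≈ p^(1/(2-ab)) a level costs n p^(1-1/k); if that asks for s > n,
-- then s = n and β ≈ (n²/p)^(1/a) cost n^(2/a) p^(1-1/a).  As Õ hides logarithms, there may be log p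
-- levels, with hopsets of error ε/log n, and the outcome is even a (1+O(ε))-preserver.
--
-- Distances in G may span more than a polynomial in s, so the graph on S is treated separately for each
-- of the O(log n) dyadic distance scales, with very small weights rounded up.  Sizes are rounded to
-- powers of two and real exponents to fractions of denominator t > 2 log n, which costs constant factors.
module Submission where

open import Data.Nat as ℕ using (ℕ; zero; suc; NonZero; s≤s; z≤n; >-nonZero; >-nonZero⁻¹; ≢-nonZero)
import Data.Nat.Properties as ℕ
import Data.Nat.DivMod as ℕ
open import Data.Nat.Tactic.RingSolver using (solve-∀)
open import Data.Fin as Fin using (Fin)
open import Data.Fin.Subset as Subset using ()
open import Data.List using (List; []; _∷_; length; _++_)
open import Data.List.Membership.Propositional using (_∈_)
open import Data.List.Membership.Propositional.Properties using (∈-map⁺; ∈-++⁺ˡ; ∈-++⁺ʳ)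
open import Data.List.Properties using (length-++; length-map)
open import Data.List.Relation.Unary.All as All using (All; []; _∷_)
open import Data.List.Relation.Unary.AllPairs using ([]; _∷_)
open import Data.List.Relation.Unary.Any using (here; there)
open import Data.List.Relation.Unary.Unique.Propositional using (Unique)
open import Data.Product using (∃; ∃₂; Σ; _×_; _,_; proj₁; proj₂)
open import Data.Rational as ℚ using (ℚ; 0ℚ; 1ℚ)
import Data.Rational.Properties as ℚ
open import Data.Rational.Solver using (module +-*-Solver)
open import Data.Sum using (_⊎_; inj₁; inj₂)
open import Function using (_∘_)
open import Relation.Binary.PropositionalEquality
open import Relation.Nullary using (¬_; Dec; yes; no; does; contradiction)

-- The hypothesis b < 1/(a - 1) says that 2 - ab > 1 - b, or k > 1. Its strictness keeps the rounded
-- exponent 1 - 1/k from becoming negative once t is large.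
--
-- Order between Dedekind reals is undecidable, so the construction never branches on it. Cuts are
-- only enclosed in rational intervals. The target is needed from below, hence 2 - ab from below and
-- 1 - b from above; s and β come from searches over exponents of 2.
--
-- The hidden factors must not spoil the halving. A power 2^θ exceeding the number of scales times
-- the hidden factor is reserved: s²/β^a is kept below 2^π although 2^(π + θ) demands may remain. At
-- most 2^(3θ) demands are served by storing their shortest paths, which costs n times poly(log n,
-- 1/ε).
--
-- The edges of a level are chosen before the recursion has answered the new demands. So a level
-- promises its stretch for every larger edge list. The errors multiply, and with hopsets of error
-- 1/m, m proportional to (log n)/ε, the product stays below 1 + ε.

module Rationals where

  -- Rational inequalities, fractions and powers

  open import Data.Integer as ℤ using (ℤ; +_)
  import Data.Integer.Properties as ℤ
  open import Data.Rational hiding (_÷_)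
  open import Data.Rational.Properties
  open import Data.Rational.Unnormalised as ℚᵘ using (mkℚᵘ; *≤*; *≡*)
  import Data.Rational.Unnormalised.Properties as ℚᵘ
  open import Algebra.Definitions.RawSemiring +-*-rawSemiring using (_^_) public
  open import Algebra.Bundles using (CommutativeRing)
  open import Algebra.Properties.Semiring.Exp (CommutativeRing.semiring +-*-commutativeRing) using (^-assocʳ) public
  open import Defs using (ℕtoℚ)
  open +-*-Solver

  <⇒≱ : ∀ {p q} → p < q → ¬ (q ≤ p)
  <⇒≱ p<q q≤p = <-irrefl refl (<-≤-trans p<q q≤p)

  mulˡ-≤ : ∀ {r p q} → 0ℚ ≤ r → p ≤ q → r * p ≤ r * q
  mulˡ-≤ {r} 0≤r = *-monoˡ-≤-nonNeg r {{nonNegative 0≤r}}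

  mulʳ-≤ : ∀ {r p q} → 0ℚ ≤ r → p ≤ q → p * r ≤ q * r
  mulʳ-≤ {r} 0≤r = *-monoʳ-≤-nonNeg r {{nonNegative 0≤r}}

  mulˡ-< : ∀ {r p q} → 0ℚ < r → p < q → r * p < r * q
  mulˡ-< {r} 0<r = *-monoʳ-<-pos r {{positive 0<r}}

  mulʳ-< : ∀ {r p q} → 0ℚ < r → p < q → p * r < q * r
  mulʳ-< {r} 0<r = *-monoˡ-<-pos r {{positive 0<r}}

  mul-≤ : ∀ {p q r s} → 0ℚ ≤ p → 0ℚ ≤ r → p ≤ q → r ≤ s → p * r ≤ q * s
  mul-≤ 0≤p 0≤r p≤q r≤s = ≤-trans (mulˡ-≤ 0≤p r≤s) (mulʳ-≤ (≤-trans 0≤r r≤s) p≤q)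

  *-nonneg : ∀ {p q} → 0ℚ ≤ p → 0ℚ ≤ q → 0ℚ ≤ p * q
  *-nonneg {p} {q} 0≤p 0≤q = subst (_≤ p * q) (*-zeroʳ p) (mulˡ-≤ 0≤p 0≤q)

  *-pos : ∀ {p q} → 0ℚ < p → 0ℚ < q → 0ℚ < p * q
  *-pos {p} {q} 0<p 0<q = subst (_< p * q) (*-zeroʳ p) (mulˡ-< 0<p 0<q)

  +-nonneg : ∀ {p q} → 0ℚ ≤ p → 0ℚ ≤ q → 0ℚ ≤ p + q
  +-nonneg = +-mono-≤

  +-pos : ∀ {p q} → 0ℚ < p → 0ℚ ≤ q → 0ℚ < p + q
  +-pos = +-mono-<-≤

  ≤-by : ∀ {p q} d → 0ℚ ≤ d → p + d ≡ q → p ≤ q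
  ≤-by {p} d 0≤d eq = subst₂ _≤_ (+-identityʳ p) eq (+-monoʳ-≤ p 0≤d)

  <-by : ∀ {p q} d → 0ℚ < d → p + d ≡ q → p < q
  <-by {p} d 0<d eq = subst₂ _<_ (+-identityʳ p) eq (+-monoʳ-< p 0<d)

  0<-diff : ∀ {p q} → p < q → 0ℚ < q - p
  0<-diff {p} {q} p<q = subst (_< q - p) (+-inverseʳ p) (+-monoˡ-< (- p) p<q)

  0≤-diff : ∀ {p q} → p ≤ q → 0ℚ ≤ q - p
  0≤-diff {p} {q} p≤q = subst (_≤ q - p) (+-inverseʳ p) (+-monoˡ-≤ (- p) p≤q)

  0<1 : 0ℚ < 1ℚ
  0<1 = toWitness {a? = 0ℚ <? 1ℚ} _
    where open import Relation.Nullary.Decidable using (toWitness)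

  0≤1 : 0ℚ ≤ 1ℚ
  0≤1 = <⇒≤ 0<1

  ≤-dense : ∀ {p q} → (∀ r → r < p → r ≤ q) → p ≤ q
  ≤-dense {p} {q} f with p ≤? q
  ... | yes p≤q = p≤q
  ... | no p≰q with <-dense (≰⇒> p≰q)
  ...   | r , q<r , r<p = contradiction (f r r<p) (<⇒≱ q<r)

  recip : ∀ {p} → 0ℚ < p → ∃ λ i → 0ℚ < i × i * p ≡ 1ℚ
  recip {p} 0<p = 1/ p , positive⁻¹ _ {{1/pos⇒pos p}} , *-inverseˡ p
    where instance
      _ = positive 0<p
      _ = pos⇒nonZero p

  -- For K ≥ 0 the witness is g/(g + K + 1), which is at most 1 and below g/K. It is the margin by
  -- which closed intervals are widened to the open ones that cuts speak of.
  smallStep : ∀ {g} K → 0ℚ < g → ∃ λ δ → 0ℚ < δ × δ ≤ 1ℚ × δ * K < g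
  smallStep {g} K 0<g with 0ℚ ≤? K
  ... | no K≱0 = 1ℚ , 0<1 , ≤-refl , subst (_< g) (sym (*-identityˡ K)) (<-trans (≰⇒> K≱0) 0<g)
  ... | yes 0≤K = δ , *-pos 0<i 0<g ,
      subst (δ ≤_) iS≡1 (mulˡ-≤ (<⇒≤ 0<i) g≤S) ,
      subst (δ * K <_) δS≡g (mulˡ-< (*-pos 0<i 0<g) K<S)
    where
      S = g + K + 1ℚ
      0<S : 0ℚ < S
      0<S = +-pos (+-pos 0<g 0≤K) 0≤1
      i = proj₁ (recip 0<S)
      0<i = proj₁ (proj₂ (recip 0<S))
      iS≡1 = proj₂ (proj₂ (recip 0<S))
      δ = i * g
      g≤S : g ≤ S
      g≤S = ≤-by (K + 1ℚ) (+-nonneg 0≤K 0≤1) (sym (+-assoc g K 1ℚ))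
      K<S : K < S
      K<S = <-by (g + 1ℚ) (+-pos 0<g 0≤1)
        (solve 2 (λ g k → k :+ (g :+ con 1ℚ) := g :+ k :+ con 1ℚ) refl g K)
      δS≡g : δ * S ≡ g
      δS≡g = trans (solve 3 (λ i g s → i :* g :* s := g :* (i :* s)) refl i g S)
                   (trans (cong (g *_) iS≡1) (*-identityʳ g))

  infixl 7 _÷_

  _÷_ : (i d : ℕ) .{{_ : ℕ.NonZero d}} → ℚ
  i ÷ d = + i / d

  /-≤ : ∀ {i j d e} .{{_ : ℕ.NonZero d}} .{{_ : ℕ.NonZero e}} →
        i ℤ.* + e ℤ.≤ j ℤ.* + d → i / d ≤ j / e
  /-≤ {i} {j} {suc d} {suc e} le = toℚᵘ-cancel-≤ (ℚᵘ.≤-trans (ℚᵘ.≤-reflexive (toℚᵘ-fromℚᵘ (mkℚᵘ i d)))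
    (ℚᵘ.≤-trans (*≤* le) (ℚᵘ.≤-reflexive (ℚᵘ.≃-sym (toℚᵘ-fromℚᵘ (mkℚᵘ j e))))))

  /-≤⁻¹ : ∀ {i j d e} .{{_ : ℕ.NonZero d}} .{{_ : ℕ.NonZero e}} →
          i / d ≤ j / e → i ℤ.* + e ℤ.≤ j ℤ.* + d
  /-≤⁻¹ {i} {j} {suc d} {suc e} le with ℚᵘ.≤-trans (ℚᵘ.≤-reflexive (ℚᵘ.≃-sym (toℚᵘ-fromℚᵘ (mkℚᵘ i d))))
    (ℚᵘ.≤-trans (toℚᵘ-mono-≤ le) (ℚᵘ.≤-reflexive (toℚᵘ-fromℚᵘ (mkℚᵘ j e))))
  ... | *≤* h = h

  /-< : ∀ {i j d e} .{{_ : ℕ.NonZero d}} .{{_ : ℕ.NonZero e}} →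
        i ℤ.* + e ℤ.< j ℤ.* + d → i / d < j / e
  /-< {i} {j} {d} {e} lt = ≰⇒> λ le → ℤ.<⇒≱ lt (/-≤⁻¹ {j} {i} {e} {d} le)

  ÷-≤ : ∀ {i j d e} .{{_ : ℕ.NonZero d}} .{{_ : ℕ.NonZero e}} → i ℕ.* e ℕ.≤ j ℕ.* d → i ÷ d ≤ j ÷ e
  ÷-≤ {i} {j} {d} {e} le = /-≤ {+ i} {+ j} {d} {e} (subst₂ ℤ._≤_ (ℤ.pos-* i e) (ℤ.pos-* j d) (ℤ.+≤+ le))

  ÷-≤⁻¹ : ∀ {i j d e} .{{_ : ℕ.NonZero d}} .{{_ : ℕ.NonZero e}} → i ÷ d ≤ j ÷ e → i ℕ.* e ℕ.≤ j ℕ.* d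
  ÷-≤⁻¹ {i} {j} {d} {e} le =
    ℤ.drop‿+≤+ (subst₂ ℤ._≤_ (sym (ℤ.pos-* i e)) (sym (ℤ.pos-* j d)) (/-≤⁻¹ {+ i} {+ j} {d} {e} le))

  ÷-< : ∀ {i j d e} .{{_ : ℕ.NonZero d}} .{{_ : ℕ.NonZero e}} → i ℕ.* e ℕ.< j ℕ.* d → i ÷ d < j ÷ e
  ÷-< {i} {j} {d} {e} lt = ≰⇒> λ le → ℕ.<⇒≱ lt (÷-≤⁻¹ {j} {i} {e} {d} le)

  ÷-<⁻¹ : ∀ {i j d e} .{{_ : ℕ.NonZero d}} .{{_ : ℕ.NonZero e}} → i ÷ d < j ÷ e → i ℕ.* e ℕ.< j ℕ.* d
  ÷-<⁻¹ {i} {j} {d} {e} lt = ℕ.≰⇒> λ le → <⇒≱ lt (÷-≤ {j} {i} {e} {d} le)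

  ÷-≡ : ∀ {i j d e} .{{_ : ℕ.NonZero d}} .{{_ : ℕ.NonZero e}} → i ℕ.* e ≡ j ℕ.* d → i ÷ d ≡ j ÷ e
  ÷-≡ {i} {j} {d} {e} eq = ≤-antisym (÷-≤ {i} {j} (ℕ.≤-reflexive eq)) (÷-≤ {j} {i} (ℕ.≤-reflexive (sym eq)))

  private
    ↑ : ∀ i d .{{_ : ℕ.NonZero d}} → toℚᵘ (i / d) ℚᵘ.≃ i ℚᵘ./ d
    ↑ i (suc d) = toℚᵘ-fromℚᵘ (mkℚᵘ i d)

  ÷-+ : ∀ i j d .{{_ : ℕ.NonZero d}} → i ÷ d + j ÷ d ≡ (i ℕ.+ j) ÷ d
  ÷-+ i j d@(suc _) = toℚᵘ-injective (ℚᵘ.≃-trans (toℚᵘ-homo-+ (i ÷ d) (j ÷ d))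
    (ℚᵘ.≃-trans (ℚᵘ.+-cong (↑ (+ i) d) (↑ (+ j) d))
    (ℚᵘ.≃-trans (*≡* (begin
        (+ i ℤ.* + d ℤ.+ + j ℤ.* + d) ℤ.* + d ≡⟨ cong (ℤ._* + d) (ℤ.*-distribʳ-+ (+ d) (+ i) (+ j)) ⟨
        (+ i ℤ.+ + j) ℤ.* + d ℤ.* + d         ≡⟨ ℤ.*-assoc (+ i ℤ.+ + j) (+ d) (+ d) ⟩
        (+ i ℤ.+ + j) ℤ.* (+ d ℤ.* + d) ∎))
    (ℚᵘ.≃-sym (↑ (+ (i ℕ.+ j)) d)))))
    where open ≡-Reasoning

  ÷-* : ∀ i j d e .{{_ : ℕ.NonZero d}} .{{_ : ℕ.NonZero e}} →
        let instance _ = ℕ.m*n≢0 d e in i ÷ d * (j ÷ e) ≡ (i ℕ.* j) ÷ (d ℕ.* e)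
  ÷-* i j d@(suc _) e@(suc _) = toℚᵘ-injective (ℚᵘ.≃-trans (toℚᵘ-homo-* (i ÷ d) (j ÷ e))
    (ℚᵘ.≃-trans (ℚᵘ.*-cong (↑ (+ i) d) (↑ (+ j) e))
    (ℚᵘ.≃-trans (*≡* (cong (ℤ._* + (d ℕ.* e)) (sym (ℤ.pos-* i j))))
    (ℚᵘ.≃-sym (↑ (+ (i ℕ.* j)) (d ℕ.* e))))))

  ℕtoℚ-≤ : ∀ {m n} → m ℕ.≤ n → ℕtoℚ m ≤ ℕtoℚ n
  ℕtoℚ-≤ {m} {n} m≤n = ÷-≤ {m} {n} {1} {1} (ℕ.*-monoˡ-≤ 1 m≤n)

  ℕtoℚ-< : ∀ {m n} → m ℕ.< n → ℕtoℚ m < ℕtoℚ n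
  ℕtoℚ-< {m} {n} m<n = ÷-< {m} {n} {1} {1} (ℕ.*-monoˡ-< 1 m<n)

  ℕtoℚ-≤⁻¹ : ∀ {m n} → ℕtoℚ m ≤ ℕtoℚ n → m ℕ.≤ n
  ℕtoℚ-≤⁻¹ {m} {n} le = ℕ.*-cancelʳ-≤ m n 1 (÷-≤⁻¹ {m} {n} {1} {1} le)

  ℕtoℚ-<⁻¹ : ∀ {m n} → ℕtoℚ m < ℕtoℚ n → m ℕ.< n
  ℕtoℚ-<⁻¹ {m} {n} lt = ℕ.*-cancelʳ-< 1 m n (÷-<⁻¹ {m} {n} {1} {1} lt)

  ℕtoℚ-+ : ∀ m n → ℕtoℚ (m ℕ.+ n) ≡ ℕtoℚ m + ℕtoℚ n
  ℕtoℚ-+ m n = sym (÷-+ m n 1)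

  ℕtoℚ-* : ∀ m n → ℕtoℚ (m ℕ.* n) ≡ ℕtoℚ m * ℕtoℚ n
  ℕtoℚ-* m n = sym (÷-* m n 1 1)

  ℕtoℚ-^ : ∀ m k → ℕtoℚ (m ℕ.^ k) ≡ ℕtoℚ m ^ k
  ℕtoℚ-^ m zero    = refl
  ℕtoℚ-^ m (suc k) = trans (ℕtoℚ-* m (m ℕ.^ k)) (cong (ℕtoℚ m *_) (ℕtoℚ-^ m k))

  ℕtoℚ-nonneg : ∀ n → 0ℚ ≤ ℕtoℚ n
  ℕtoℚ-nonneg n = ℕtoℚ-≤ {0} {n} ℕ.z≤n

  ℕtoℚ-pos : ∀ {n} → 1 ℕ.≤ n → 0ℚ < ℕtoℚ n
  ℕtoℚ-pos = ℕtoℚ-<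

  ÷-nonneg : ∀ i d .{{_ : ℕ.NonZero d}} → 0ℚ ≤ i ÷ d
  ÷-nonneg i d = ÷-≤ {0} {i} {1} {d} ℕ.z≤n

  ÷-pos : ∀ i d .{{_ : ℕ.NonZero d}} .{{_ : ℕ.NonZero i}} → 0ℚ < i ÷ d
  ÷-pos (suc i) d = ÷-< {0} {suc i} {1} {d} (ℕ.s≤s ℕ.z≤n)

  ÷-cancel : ∀ i d .{{_ : ℕ.NonZero d}} → ℕtoℚ d * (i ÷ d) ≡ ℕtoℚ i
  ÷-cancel i d@(suc _) = trans (÷-* d i 1 d)
    (÷-≡ {d ℕ.* i} {i} {1 ℕ.* d} {1} (trans (ℕ.*-identityʳ (d ℕ.* i))
      (trans (ℕ.*-comm d i) (cong (i ℕ.*_) (sym (ℕ.*-identityˡ d))))))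

  archimedean : ∀ q → ∃ λ n → q ≤ ℕtoℚ n
  archimedean q = ℤ.∣ ↥ q ∣ , subst (_≤ ℕtoℚ ℤ.∣ ↥ q ∣) (↥p/↧p≡p q)
    (/-≤ {↥ q} {+ ℤ.∣ ↥ q ∣} {↧ₙ q} {1} (ℤ.≤-trans (ℤ.≤-reflexive (ℤ.*-identityʳ (↥ q)))
      (ℤ.≤-trans (i≤∣i∣ (↥ q)) (ℤ.≤-trans (ℤ.≤-reflexive (sym (ℤ.*-identityʳ (+ ℤ.∣ ↥ q ∣))))
         (ℤ.*-monoˡ-≤-nonNeg (+ ℤ.∣ ↥ q ∣) (ℤ.+≤+ (ℕ.>-nonZero⁻¹ (↧ₙ q))))))))
    where
      i≤∣i∣ : ∀ i → i ℤ.≤ + ℤ.∣ i ∣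
      i≤∣i∣ (+ n)      = ℤ.≤-refl
      i≤∣i∣ (ℤ.-[1+ n ]) = ℤ.-≤+

  ^-nonneg : ∀ {q} k → 0ℚ ≤ q → 0ℚ ≤ q ^ k
  ^-nonneg zero    0≤q = 0≤1
  ^-nonneg (suc k) 0≤q = *-nonneg 0≤q (^-nonneg k 0≤q)

  ^-pos : ∀ {q} k → 0ℚ < q → 0ℚ < q ^ k
  ^-pos zero    0<q = 0<1
  ^-pos (suc k) 0<q = *-pos 0<q (^-pos k 0<q)

  ^-mono-≤ : ∀ {p q} k → 0ℚ ≤ p → p ≤ q → p ^ k ≤ q ^ k
  ^-mono-≤ zero    0≤p p≤q = ≤-refl
  ^-mono-≤ (suc k) 0≤p p≤q = mul-≤ 0≤p (^-nonneg k 0≤p) p≤q (^-mono-≤ k 0≤p p≤q)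

  ^-mono-< : ∀ {p q} k .{{_ : ℕ.NonZero k}} → 0ℚ ≤ p → p < q → p ^ k < q ^ k
  ^-mono-< {p} {q} (suc k) 0≤p p<q =
    ≤-<-trans (mulˡ-≤ 0≤p (^-mono-≤ k 0≤p (<⇒≤ p<q))) (mulʳ-< (^-pos k (≤-<-trans 0≤p p<q)) p<q)

  *-^ : ∀ p q k → (p * q) ^ k ≡ p ^ k * q ^ k
  *-^ p q zero    = refl
  *-^ p q (suc k) = trans (cong (p * q *_) (*-^ p q k))
    (solve 4 (λ p q a b → p :* q :* (a :* b) := p :* a :* (q :* b)) refl p q (p ^ k) (q ^ k))

  -- Bernoulli's inequality cleared of denominators, so that q may be 0. The inductive step has q^T
  -- · T · d² to spare.
  bernoulli : ∀ {q d} T → 0ℚ ≤ q → 0ℚ ≤ d → q ^ T * (q + ℕtoℚ T * d) ≤ (q + d) ^ suc T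
  bernoulli {q} {d} zero 0≤q 0≤d = ≤-by d 0≤d
    (solve 2 (λ q d → con 1ℚ :* (q :+ con 0ℚ :* d) :+ d := (q :+ d) :* con 1ℚ) refl q d)
  bernoulli {q} {d} (suc T) 0≤q 0≤d = ≤-trans
    (≤-by (q ^ T * (ℕtoℚ T * d * d)) (*-nonneg (^-nonneg T 0≤q) (*-nonneg (*-nonneg (ℕtoℚ-nonneg T) 0≤d) 0≤d))
      (trans (cong (λ t → q * q ^ T * (q + t * d) + q ^ T * (ℕtoℚ T * d * d)) (ℕtoℚ-+ 1 T))
       (solve 4 (λ q d x t → q :* x :* (q :+ (con 1ℚ :+ t) :* d) :+ x :* (t :* d :* d)
                  := (q :+ d) :* (x :* (q :+ t :* d))) refl q d (q ^ T) (ℕtoℚ T))))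
    (mulˡ-≤ (+-nonneg 0≤q 0≤d) (bernoulli T 0≤q 0≤d))

  -- With the base of a real power as M, this absorbs an error of order 1/T in the exponent. By
  -- `bernoulli` it suffices that T (q - p) ≥ p M.
  ^-archimedean : ∀ {p q} → 0ℚ < p → p < q → ∀ M → ∃ λ T → p ^ suc T * ℕtoℚ M < q ^ suc T
  ^-archimedean {p} {q} 0<p p<q M =
    T , <-≤-trans (subst (_< p ^ T * (p + ℕtoℚ T * d))
          (solve 3 (λ x p m → x :* (p :* m) := p :* x :* m) refl (p ^ T) p (ℕtoℚ M))
          (mulˡ-< (^-pos T 0<p) pM<))
        (subst (λ z → p ^ T * (p + ℕtoℚ T * d) ≤ z ^ suc T)
          (solve 2 (λ p q → p :+ (q :- p) := q) refl p q) (bernoulli T (<⇒≤ 0<p) (<⇒≤ 0<d)))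
    where
      d = q - p
      0<d : 0ℚ < d
      0<d = 0<-diff p<q
      i = proj₁ (recip 0<d)
      T = proj₁ (archimedean (p * ℕtoℚ M * i))
      pM≤ : p * ℕtoℚ M ≤ ℕtoℚ T * d
      pM≤ = subst (_≤ ℕtoℚ T * d)
        (trans (*-assoc (p * ℕtoℚ M) i d) (trans (cong (p * ℕtoℚ M *_) (proj₂ (proj₂ (recip 0<d))))
            (*-identityʳ (p * ℕtoℚ M))))
        (mulʳ-≤ (<⇒≤ 0<d) (proj₂ (archimedean (p * ℕtoℚ M * i))))
      pM< : p * ℕtoℚ M < p + ℕtoℚ T * d
      pM< = ≤-<-trans pM≤ (<-by p 0<p (+-comm (ℕtoℚ T * d) p))

-- Interval arithmetic for cuts

module Enclosures where

  open import Data.Rational using (_+_; _-_; -_; _*_; _≤_; _<_)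
  open import Data.Rational.Properties
  open import Function.Bundles using (module Equivalence)
  open import Defs hiding (_≤_; _<_; _+_; _-_; _*_; _/_; _⊓_; _^_; _⁻¹)
  import Defs as ℝ
  open Rationals using
    ( <⇒≱; mulˡ-≤; mulʳ-≤; mulʳ-<; mul-≤; *-nonneg; +-nonneg; +-pos; ≤-by; <-by; 0<-diff; 0≤-diff; 0<1;
      0≤1; ≤-dense; smallStep; ^-nonneg )
    renaming (_^_ to _^ℚ_)
  open +-*-Solver

  -- The cut x, not assumed to be a real, behaves as an element of [p , q].

  infix 4 _∈[_,_]

  record _∈[_,_] (x : Cut) (p q : ℚ) : Set where
    field
      lower : ∀ r → r < p → L x r
      upper : ∀ r → q < r → U x r
      below : ∀ r → L x r → r ≤ q
      above : ∀ r → U x r → p ≤ r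

    p≤q : p ≤ q
    p≤q = ≤-dense λ r r<p → below r (lower r r<p)

  open _∈[_,_] public

  ∈-widen : ∀ {x p q p′ q′} → x ∈[ p , q ] → p′ ≤ p → q ≤ q′ → x ∈[ p′ , q′ ]
  ∈-widen I p′≤p q≤q′ = record
    { lower = λ r r<p′ → lower I r (<-≤-trans r<p′ p′≤p)
    ; upper = λ r q′<r → upper I r (≤-<-trans q≤q′ q′<r)
    ; below = λ r Lr → ≤-trans (below I r Lr) q≤q′
    ; above = λ r Ur → ≤-trans p′≤p (above I r Ur)
    }

  -- This is how the bounds assumed of the hopset algorithm become rational inequalities; `fromℚ-≤`
  -- is the way back to cuts.
  ∈-≤⁻¹ : ∀ {x y p q p′ q′} → x ∈[ p , q ] → y ∈[ p′ , q′ ] → x ℝ.≤ y → p ≤ q′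
  ∈-≤⁻¹ I J x≤y = ≤-dense λ r r<p → below J r (x≤y r (lower I r r<p))

  fromℚ-≤ : ∀ {y p p′ q′} → y ∈[ p′ , q′ ] → p ≤ p′ → fromℚ p ℝ.≤ y
  fromℚ-≤ J p≤p′ r r<p = lower J r (<-≤-trans r<p p≤p′)

  -- Disjointness of the cut turns `lower` and `upper` into `below` and `above`. Only a, b and ε
  -- need it: all other cuts are built from these and from rationals by operations that preserve
  -- enclosures.
  real∈ : ∀ {x p q} → IsReal x → (∀ r → r < p → L x r) → U x q → x ∈[ p , q ]
  real∈ {x} {p} {q} R Lx Uq = record
    { lower = Lx
    ; upper = upper′
    ; below = λ r Lr → ≮⇒≥ λ q<r → IsReal.disjoint R r (Lr , upper′ r q<r)
    ; above = λ r Ur → ≮⇒≥ λ r<p → IsReal.disjoint R r (Lx r r<p , Ur)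
    }
    where
      upper′ : ∀ r → q < r → U x r
      upper′ r q<r = Equivalence.from (IsReal.roundedᵘ R r) (q , q<r , Uq)

  L-below : ∀ {x p} → IsReal x → L x p → ∀ r → r < p → L x r
  L-below {p = p} R Lp r r<p = Equivalence.from (IsReal.roundedˡ R r) (p , r<p , Lp)

  ∈-fromℚ : ∀ p → fromℚ p ∈[ p , p ]
  ∈-fromℚ p = record
    { lower = λ _ r<p → r<p ; upper = λ _ p<r → p<r
    ; below = λ _ → <⇒≤     ; above = λ _ → <⇒≤ }

  private
    negneg : ∀ p → - (- p) ≡ p
    negneg = solve 1 (λ p → :- (:- p) := p) refl

    cancel : ∀ p q → p + q - q ≡ p
    cancel = solve 2 (λ p q → p :+ q :- q := p) refl
    shift : ∀ r q s → r - q + (q - s) ≡ r - s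
    shift = solve 3 (λ r q s → r :- q :+ (q :- s) := r :- s) refl
    comm : ∀ s q → s + (q - s) ≡ q
    comm = solve 2 (λ s q → s :+ (q :- s) := q) refl
    comm′ : ∀ r s → r - s + s ≡ r
    comm′ = solve 2 (λ r s → r :- s :+ s := r) refl

    splitˡ : ∀ {p q r} → r < p + q → ∃₂ λ s t → s < p × t < q × r < s + t
    splitˡ {p} {q} {r} r<p+q =
      let s , r-q<s , s<p = <-dense (subst (r - q <_) (cancel p q) (+-monoˡ-< (- q) r<p+q))
          t , r-s<t , t<q = <-dense (subst₂ _<_ (shift r q s) (comm s q) (+-monoˡ-< (q - s) r-q<s))
      in s , t , s<p , t<q , subst₂ _<_ (comm′ r s) (+-comm t s) (+-monoˡ-< s r-s<t)

    splitʳ : ∀ {p q r} → p + q < r → ∃₂ λ s t → p < s × q < t × s + t < r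
    splitʳ {p} {q} {r} lt =
      let s , t , s<-p , t<-q , -r<s+t = splitˡ { - p} { - q} { - r}
            (subst (- r <_) (neg-distrib-+ p q) (neg-antimono-< lt))
      in - s , - t ,
         subst (_< - s) (negneg p) (neg-antimono-< s<-p) ,
         subst (_< - t) (negneg q) (neg-antimono-< t<-q) ,
         subst₂ _<_ (neg-distrib-+ s t) (negneg r) (neg-antimono-< -r<s+t)

  ∈-+ : ∀ {x y p p′ q q′} → x ∈[ p , p′ ] → y ∈[ q , q′ ] → x ℝ.+ y ∈[ p + q , p′ + q′ ]
  ∈-+ I J = record
    { lower = λ r lt → let s , t , s< , t< , r< = splitˡ lt in s , t , lower I s s< , lower J t t< , r<
    ; upper = λ r lt → let s , t , s< , t< , r< = splitʳ lt in s , t , upper I s s< , upper J t t< , r<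
    ; below = λ { r (s , t , Ls , Lt , r<) → ≤-trans (<⇒≤ r<) (+-mono-≤ (below I s Ls) (below J t Lt)) }
    ; above = λ { r (s , t , Us , Ut , r<) → ≤-trans (+-mono-≤ (above I s Us) (above J t Ut)) (<⇒≤ r<) }
    }

  ∈-minus : ∀ {x y p p′ q q′} → x ∈[ p , p′ ] → y ∈[ q , q′ ] → x ℝ.- y ∈[ p - q′ , p′ - q ]
  ∈-minus {q = q} {q′} I J = record
    { lower = λ r lt → let s , t , s< , t< , r< = splitˡ lt in
        s , - t , lower I s s< , upper J _ (subst (_< - t) (negneg q′) (neg-antimono-< t<)) ,
        subst (λ z → r < s + z) (sym (negneg t)) r<
    ; upper = λ r lt → let s , t , s< , t< , r< = splitʳ lt in
        s , - t , upper I s s< , lower J _ (subst (- t <_) (negneg q) (neg-antimono-< t<)) ,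
        subst (λ z → s + z < r) (sym (negneg t)) r<
    ; below = λ { r (s , t , Ls , Ut , r<) → ≤-trans (<⇒≤ r<)
        (+-mono-≤ (below I s Ls) (neg-antimono-≤ (above J t Ut))) }
    ; above = λ { r (s , t , Us , Lt , r<) → ≤-trans (+-mono-≤ (above I s Us) (neg-antimono-≤ (below J t Lt)))
        (<⇒≤ r<) }
    }

  -- The box widens both intervals by δ ≤ 1, and the corners then leave [p q , p′ q′] by at most δ
  -- K. Boxes met in `below` may have negative lower ends; such a box has a corner that is at most
  -- 0, hence at most p′ q′.
  ∈-* : ∀ {x y p p′ q q′} → 0ℚ ≤ p → 0ℚ ≤ q →
        x ∈[ p , p′ ] → y ∈[ q , q′ ] → x ℝ.* y ∈[ p * q , p′ * q′ ]
  ∈-* {x} {y} {p} {p′} {q} {q′} 0≤p 0≤q I J = record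
    { lower = λ t lt → let δ , 0<δ , δ≤1 , δK<g = smallStep K (0<-diff lt) in box δ 0<δ , lowerCorners t δ 0<δ δ≤1 δK<g
    ; upper = λ t lt → let δ , 0<δ , δ≤1 , δK<g = smallStep K (0<-diff lt) in box δ 0<δ , upperCorners t δ 0<δ δ≤1 δK<g
    ; below = λ { t (B , a , b , c , _) → below′ t B a b c }
    ; above = λ { t (B , _ , _ , _ , d) → let open Box B in
        ≤-trans (mul-≤ 0≤p 0≤q (above I r′ x<r′) (above J s′ y<s′)) (<⇒≤ d) }
    }
    where
      p≤p′ = p≤q I
      q≤q′ = p≤q J
      0≤p′ = ≤-trans 0≤p p≤p′
      0≤q′ = ≤-trans 0≤q q≤q′
      u = p′ - p
      v = q′ - q
      0≤u : 0ℚ ≤ u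
      0≤u = 0≤-diff p≤p′
      0≤v : 0ℚ ≤ v
      0≤v = 0≤-diff q≤q′
      K = p′ + q′ + 1ℚ

      box : ∀ δ → 0ℚ < δ → Box x y
      box δ 0<δ = record
        { r = p - δ ; r′ = p′ + δ ; s = q - δ ; s′ = q′ + δ
        ; r<x  = lower I _ (<-by δ 0<δ (solve 2 (λ p d → p :- d :+ d := p) refl p δ))
        ; x<r′ = upper I _ (<-by δ 0<δ refl)
        ; s<y  = lower J _ (<-by δ 0<δ (solve 2 (λ p d → p :- d :+ d := p) refl q δ))
        ; y<s′ = upper J _ (<-by δ 0<δ refl)
        }

      lowerCorners : ∀ t δ → 0ℚ < δ → δ ≤ 1ℚ → δ * K < p * q - t →
        t < (p - δ) * (q - δ) × t < (p - δ) * (q′ + δ) ×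
        t < (p′ + δ) * (q - δ) × t < (p′ + δ) * (q′ + δ)
      lowerCorners t δ 0<δ δ≤1 δK<g =
          corner (δ * u + δ * v + δ + δ * δ)
            (+-nonneg (+-nonneg (+-nonneg (*-nonneg 0≤δ 0≤u) (*-nonneg 0≤δ 0≤v)) 0≤δ) (*-nonneg 0≤δ 0≤δ))
            (solve 5 (λ p q p′ q′ d → p :* q :- d :* (p′ :+ q′ :+ con 1ℚ) :+
                (d :* (p′ :- p) :+ d :* (q′ :- q) :+ d :+ d :* d)
               := (p :- d) :* (q :- d)) refl p q p′ q′ δ)
        , corner (p * v + δ * (p + p′) + δ * (1ℚ - δ))
            (+-nonneg (+-nonneg (*-nonneg 0≤p 0≤v) (*-nonneg 0≤δ (+-nonneg 0≤p 0≤p′)))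
                (*-nonneg 0≤δ (0≤-diff δ≤1)))
            (solve 5 (λ p q p′ q′ d → p :* q :- d :* (p′ :+ q′ :+ con 1ℚ) :+
                (p :* (q′ :- q) :+ d :* (p :+ p′) :+ d :* (con 1ℚ :- d))
               := (p :- d) :* (q′ :+ d)) refl p q p′ q′ δ)
        , corner (q * u + δ * (q + q′) + δ * (1ℚ - δ))
            (+-nonneg (+-nonneg (*-nonneg 0≤q 0≤u) (*-nonneg 0≤δ (+-nonneg 0≤q 0≤q′)))
                (*-nonneg 0≤δ (0≤-diff δ≤1)))
            (solve 5 (λ p q p′ q′ d → p :* q :- d :* (p′ :+ q′ :+ con 1ℚ) :+
                (q :* (p′ :- p) :+ d :* (q :+ q′) :+ d :* (con 1ℚ :- d))
               := (p′ :+ d) :* (q :- d)) refl p q p′ q′ δ)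
        , corner (δ * K + (p′ * q′ - p * q) + δ * (p′ + q′ + δ))
            (+-nonneg (+-nonneg (*-nonneg 0≤δ (+-nonneg (+-nonneg 0≤p′ 0≤q′) 0≤1))
                (0≤-diff (mul-≤ 0≤p 0≤q p≤p′ q≤q′)))
               (*-nonneg 0≤δ (+-nonneg (+-nonneg 0≤p′ 0≤q′) 0≤δ)))
            (solve 5 (λ p q p′ q′ d → p :* q :- d :* (p′ :+ q′ :+ con 1ℚ) :+
                 (d :* (p′ :+ q′ :+ con 1ℚ) :+ (p′ :* q′ :- p :* q) :+ d :* (p′ :+ q′ :+ d))
               := (p′ :+ d) :* (q′ :+ d)) refl p q p′ q′ δ)
        where
          0≤δ = <⇒≤ 0<δ
          corner : ∀ {z} w → 0ℚ ≤ w → p * q - δ * K + w ≡ z → t < z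
          corner w 0≤w eq = <-≤-trans
            (<-by (p * q - t - δ * K) (0<-diff δK<g)
              (solve 3 (λ pq t k → t :+ (pq :- t :- k) := pq :- k) refl (p * q) t (δ * K)))
            (≤-by w 0≤w eq)

      upperCorners : ∀ t δ → 0ℚ < δ → δ ≤ 1ℚ → δ * K < t - p′ * q′ →
        (p - δ) * (q - δ) < t × (p - δ) * (q′ + δ) < t ×
        (p′ + δ) * (q - δ) < t × (p′ + δ) * (q′ + δ) < t
      upperCorners t δ 0<δ δ≤1 δK<g =
          corner (u * q′ + p * v + δ * (p + q + p′ + q′))
            (+-nonneg (+-nonneg (*-nonneg 0≤u 0≤q′) (*-nonneg 0≤p 0≤v))
               (*-nonneg 0≤δ (+-nonneg (+-nonneg (+-nonneg 0≤p 0≤q) 0≤p′) 0≤q′)))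
            (solve 5 (λ p q p′ q′ d → (p :- d) :* (q :- d) :+
                ((p′ :- p) :* q′ :+ p :* (q′ :- q) :+ d :* (p :+ q :+ p′ :+ q′))
               := (p′ :+ d) :* (q′ :+ d)) refl p q p′ q′ δ)
        , corner ((u + δ + δ) * (q′ + δ))
            (*-nonneg (+-nonneg (+-nonneg 0≤u 0≤δ) 0≤δ) (+-nonneg 0≤q′ 0≤δ))
            (solve 5 (λ p q p′ q′ d → (p :- d) :* (q′ :+ d) :+ (p′ :- p :+ d :+ d) :* (q′ :+ d)
               := (p′ :+ d) :* (q′ :+ d)) refl p q p′ q′ δ)
        , corner ((v + δ + δ) * (p′ + δ))
            (*-nonneg (+-nonneg (+-nonneg 0≤v 0≤δ) 0≤δ) (+-nonneg 0≤p′ 0≤δ))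
            (solve 5 (λ p q p′ q′ d → (p′ :+ d) :* (q :- d) :+ (q′ :- q :+ d :+ d) :* (p′ :+ d)
               := (p′ :+ d) :* (q′ :+ d)) refl p q p′ q′ δ)
        , main
        where
          0≤δ = <⇒≤ 0<δ
          main : (p′ + δ) * (q′ + δ) < t
          main = ≤-<-trans (≤-by (δ * (1ℚ - δ)) (*-nonneg 0≤δ (0≤-diff δ≤1))
              (solve 3 (λ p′ q′ d → (p′ :+ d) :* (q′ :+ d) :+ d :* (con 1ℚ :- d) := p′ :* q′ :+ d :*
                  (p′ :+ q′ :+ con 1ℚ))
                 refl p′ q′ δ))
            (<-by (t - p′ * q′ - δ * K) (0<-diff δK<g)
              (solve 3 (λ a k t → a :+ k :+ (t :- a :- k) := t) refl (p′ * q′) (δ * K) t))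
          corner : ∀ {z} w → 0ℚ ≤ w → z + w ≡ (p′ + δ) * (q′ + δ) → z < t
          corner w 0≤w eq = ≤-<-trans (≤-by w 0≤w eq) main

      below′ : ∀ t (B : Box x y) → t < Box.r B * Box.s B → t < Box.r B * Box.s′ B →
               t < Box.r′ B * Box.s B → t ≤ p′ * q′
      below′ t B t<rs t<rs′ t<r′s = cases (≤-total 0ℚ r) (≤-total 0ℚ s)
        where
          open Box B
          t≤0 : ∀ {z} → t < z → z ≤ 0ℚ → t ≤ p′ * q′
          t≤0 t<z z≤0 = ≤-trans (<⇒≤ t<z) (≤-trans z≤0 (*-nonneg 0≤p′ 0≤q′))
          cases : 0ℚ ≤ r ⊎ r ≤ 0ℚ → 0ℚ ≤ s ⊎ s ≤ 0ℚ → t ≤ p′ * q′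
          cases (inj₁ 0≤r) (inj₁ 0≤s) = ≤-trans (<⇒≤ t<rs) (mul-≤ 0≤r 0≤s (below I r r<x) (below J s s<y))
          cases (inj₂ r≤0) _ = t≤0 t<rs′ (subst (r * s′ ≤_) (*-zeroˡ s′)
              (mulʳ-≤ (≤-trans 0≤q (above J s′ y<s′)) r≤0))
          cases _ (inj₂ s≤0) = t≤0 t<r′s (subst (r′ * s ≤_) (*-zeroʳ r′)
              (mulˡ-≤ (≤-trans 0≤p (above I r′ x<r′)) s≤0))

  -- The ends are characterised by products, which avoids division and allows the trivial lower end
  -- i = 0 when only an upper estimate of the reciprocal is wanted.
  ∈-⁻¹ : ∀ {x p p′ i i′} → 0ℚ < p → i * p′ ≤ 1ℚ → 1ℚ ≤ i′ * p →
         x ∈[ p , p′ ] → x ℝ.⁻¹ ∈[ i , i′ ]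
  ∈-⁻¹ {x} {p} {p′} {i} {i′} 0<p ip′≤1 1≤i′p I = record
    { lower = lower′
    ; upper = upper′
    ; below = λ { t (r , 0<r , Ur , tr<1) → ≮⇒≥ λ i′<t → <⇒≱ tr<1
        (≤-trans 1≤i′p (≤-trans (<⇒≤ (mulʳ-< 0<p i′<t)) (mulˡ-≤ (<⇒≤ (<-trans 0<i′ i′<t)) (above I r Ur)))) }
    ; above = λ { t (r , 0<r , Lr , 1<tr) → ≮⇒≥ λ t<i → <⇒≱ 1<tr
        (≤-trans (mulˡ-≤ (<⇒≤ (0<t t r 0<r 1<tr)) (below I r Lr)) (≤-trans (<⇒≤ (mulʳ-< 0<p′ t<i)) ip′≤1)) }
    }
    where
      0<p′ = <-≤-trans 0<p (p≤q I)
      pos-by : ∀ {a b} → 0ℚ < b → 0ℚ < a * b → 0ℚ < a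
      pos-by {a} {b} 0<b 0<ab = ≰⇒> λ a≤0 → <⇒≱ 0<ab (subst (a * b ≤_) (*-zeroˡ b) (mulʳ-≤ (<⇒≤ 0<b) a≤0))
      0<i′ : 0ℚ < i′
      0<i′ = pos-by 0<p (<-≤-trans 0<1 1≤i′p)
      0<t : ∀ t r → 0ℚ < r → 1ℚ < t * r → 0ℚ < t
      0<t t r 0<r 1<tr = pos-by 0<r (<-trans 0<1 1<tr)
      lower′ : ∀ t → t < i → L (x ℝ.⁻¹) t
      lower′ t t<i = let δ , 0<δ , _ , δt<g = smallStep t (0<-diff (<-≤-trans (mulʳ-< 0<p′ t<i) ip′≤1)) in
        p′ + δ , +-pos 0<p′ (<⇒≤ 0<δ) , upper I _ (<-by δ 0<δ refl) ,
        <-by (1ℚ - t * p′ - δ * t) (0<-diff δt<g)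
          (solve 3 (λ t p d → t :* (p :+ d) :+ (con 1ℚ :- t :* p :- d :* t) := con 1ℚ) refl t p′ δ)
      upper′ : ∀ t → i′ < t → U (x ℝ.⁻¹) t
      upper′ t i′<t = p - δ , pos-by 0<t′ (subst (0ℚ <_) (*-comm t (p - δ)) (<-trans 0<1 1<tr)) ,
          lower I _ (<-by δ 0<δ (solve 2 (λ p d → p :- d :+ d := p) refl p δ)) , 1<tr
        where
          step = smallStep t (0<-diff (≤-<-trans 1≤i′p (mulʳ-< 0<p i′<t)))
          δ = proj₁ step
          0<δ = proj₁ (proj₂ step)
          δt<g = proj₂ (proj₂ (proj₂ step))
          0<t′ = <-trans 0<i′ i′<t
          1<tr : 1ℚ < t * (p - δ)
          1<tr = <-by (t * p - 1ℚ - δ * t) (0<-diff δt<g)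
            (solve 3 (λ t p d → con 1ℚ :+ (t :* p :- con 1ℚ :- d :* t) := t :* (p :- d)) refl t p δ)

  ∈-^ℕ : ∀ {x p p′} e → 0ℚ ≤ p → x ∈[ p , p′ ] → x ^ℕ e ∈[ p ^ℚ e , p′ ^ℚ e ]
  ∈-^ℕ zero    0≤p I = ∈-fromℚ 1ℚ
  ∈-^ℕ (suc e) 0≤p I = ∈-* 0≤p (^-nonneg e 0≤p) I (∈-^ℕ e 0≤p I)

-- Real powers of natural numbers

module Powers where

  open import Data.Nat using (_+_; _*_; _^_; _∸_; _≤_; _<_; _/_)
  open import Data.Integer as ℤ using (ℤ; +_; _⊖_)
  import Data.Integer.Properties as ℤ
  open import Data.Rational.Properties
  open import Defs hiding (_≤_; _<_; _+_; _-_; _*_; _/_; _⊓_; _^_; _⁻¹)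
  import Defs as ℝ
  open Rationals using
    ( <⇒≱; mulˡ-≤; mulʳ-≤; _÷_; /-<; ℕtoℚ-≤; ℕtoℚ-<⁻¹; ℕtoℚ-*; ℕtoℚ-^; ℕtoℚ-nonneg; ℕtoℚ-pos; ^-nonneg;
      ^-mono-≤; ^-mono-<; *-^; ^-archimedean; ^-assocʳ )
    renaming (_^_ to _^ℚ_)
  open Enclosures

  ⊖-*ʳ : ∀ a b e → (a ⊖ b) ℤ.* + e ≡ a * e ⊖ b * e
  ⊖-*ʳ a b e = begin
    (a ⊖ b) ℤ.* + e                       ≡⟨ cong (ℤ._* + e) (ℤ.m-n≡m⊖n a b) ⟨
    (+ a ℤ.- + b) ℤ.* + e                 ≡⟨ ℤ.*-distribʳ-+ (+ e) (+ a) (ℤ.- + b) ⟩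
    + a ℤ.* + e ℤ.+ (ℤ.- + b) ℤ.* + e     ≡⟨ cong (λ z → + a ℤ.* + e ℤ.+ z) (ℤ.neg-distribˡ-* (+ b) (+ e)) ⟨
    + a ℤ.* + e ℤ.- + b ℤ.* + e           ≡⟨ cong₂ ℤ._-_ (ℤ.pos-* a e) (ℤ.pos-* b e) ⟨
    + (a * e) ℤ.- + (b * e)           ≡⟨ ℤ.m-n≡m⊖n (a * e) (b * e) ⟩
    a * e ⊖ b * e ∎
    where open ≡-Reasoning

  ℕ*-^ : ∀ k m n → (m * n) ^ k ≡ m ^ k * n ^ k
  ℕ*-^ zero    m n = refl
  ℕ*-^ (suc k) m n = trans (cong (m * n *_) (ℕ*-^ k m n)) (ℕ.[m*n]*[o*p]≡[m*o]*[n*p] m n (m ^ k) (n ^ k))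

  ⊖/-< : ∀ {a b c} d e .{{_ : NonZero d}} .{{_ : NonZero e}} →
         a * e < c * d + b * e → (a ⊖ b) ℚ./ d ℚ.< c ÷ e
  ⊖/-< {a} {b} {c} d e lt = /-< {a ⊖ b} {+ c} {d} {e} (begin-strict
    (a ⊖ b) ℤ.* + e                   ≡⟨ ⊖-*ʳ a b e ⟩
    a * e ⊖ b * e                 <⟨ ℤ.⊖-monoˡ-< (b * e) lt ⟩
    (c * d + b * e) ⊖ b * e   ≡⟨ ℤ.⊖-≥ (ℕ.m≤n+m (b * e) (c * d)) ⟩
    + (c * d + b * e ∸ b * e) ≡⟨ cong +_ (ℕ.m+n∸n≡m (c * d) (b * e)) ⟩
    + (c * d)                       ≡⟨ ℤ.pos-* c d ⟩
    + c ℤ.* + d ∎)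
    where open ℤ.≤-Reasoning

  <-⊖/ : ∀ {a b c} d e .{{_ : NonZero d}} .{{_ : NonZero e}} →
         c * d + b * e < a * e → c ÷ e ℚ.< (a ⊖ b) ℚ./ d
  <-⊖/ {a} {b} {c} d e lt = /-< {+ c} {a ⊖ b} {e} {d} (begin-strict
    + c ℤ.* + d                       ≡⟨ ℤ.pos-* c d ⟨
    + (c * d)                       ≡⟨ cong +_ (ℕ.m+n∸n≡m (c * d) (b * e)) ⟨
    + (c * d + b * e ∸ b * e) ≡⟨ ℤ.⊖-≥ (ℕ.m≤n+m (b * e) (c * d)) ⟨
    (c * d + b * e) ⊖ b * e   <⟨ ℤ.⊖-monoˡ-< (b * e) lt ⟩
    a * e ⊖ b * e                 ≡⟨ ⊖-*ʳ a b e ⟨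
    (a ⊖ b) ℤ.* + e ∎)
    where open ℤ.≤-Reasoning

  private
    ^-lemma : ∀ A m τ i j i₀ t .{{_ : NonZero m}} → A ^ τ ≤ m ^ i →
              i * t + j * τ ≤ i₀ * τ → (A ^ t * m ^ j) ^ τ ≤ (m ^ i₀) ^ τ
    ^-lemma A m τ i j i₀ t A^τ≤m^i le = begin
      (A ^ t * m ^ j) ^ τ            ≡⟨ ℕ*-^ τ (A ^ t) (m ^ j) ⟩
      (A ^ t) ^ τ * (m ^ j) ^ τ    ≡⟨ cong₂ _*_ (trans (ℕ.^-*-assoc A t τ)
            (trans (cong (A ^_) (ℕ.*-comm t τ)) (sym (ℕ.^-*-assoc A τ t)))) (ℕ.^-*-assoc m j τ) ⟩
      (A ^ τ) ^ t * m ^ (j * τ)    ≤⟨ ℕ.*-monoˡ-≤ (m ^ (j * τ)) (ℕ.^-monoˡ-≤ t A^τ≤m^i) ⟩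
      (m ^ i) ^ t * m ^ (j * τ)    ≡⟨ cong (_* m ^ (j * τ)) (ℕ.^-*-assoc m i t) ⟩
      m ^ (i * t) * m ^ (j * τ)    ≡⟨ ℕ.^-distribˡ-+-* m (i * t) (j * τ) ⟨
      m ^ (i * t + j * τ)            ≤⟨ ℕ.^-monoʳ-≤ m le ⟩
      m ^ (i₀ * τ)                       ≡⟨ ℕ.^-*-assoc m i₀ τ ⟨
      (m ^ i₀) ^ τ ∎
      where open ℕ.≤-Reasoning

    ^-cancel-< : ∀ {a b} k → (b ^ k ≤ a ^ k) → .{{_ : NonZero k}} → ¬ (a < b)
    ^-cancel-< k le a<b = ℕ.<⇒≱ (ℕ.^-monoˡ-< k a<b) le

  -- The ends are asymmetric on purpose. Lower ends enter the estimates, so A may be any integer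
  -- below m^(i/τ). An upper end only has to exist for products and reciprocals to be enclosed, so
  -- an integral exponent is enough.
  ∈-^ : ∀ {y} m .{{_ : NonZero m}} i τ .{{_ : NonZero τ}} i′ A →
        y ∈[ i ÷ τ , ℕtoℚ i′ ] → A ^ τ ≤ m ^ i → m ℝ.^ y ∈[ ℕtoℚ A , ℕtoℚ (m ^ i′) ]
  ∈-^ {y} m@(suc m-1) i τ@(suc τ-1) i′ A I A^τ≤m^i = record
    { lower = λ q q<A → lower′ q q<A (≤-<-connex q 0ℚ)
    ; upper = upper′
    ; below = below′
    ; above = above′
    }
    where
      B = m ^ i′
      1≤B : 1 ≤ B
      1≤B = ℕ.^-monoʳ-≤ m {0} {i′} z≤n

      ≤-<-connex : ∀ p q → p ℚ.≤ q ⊎ q ℚ.< p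
      ≤-<-connex p q with p ℚ.≤? q
      ... | yes p≤q = inj₁ p≤q
      ... | no p≰q = inj₂ (≰⇒> p≰q)

      lower′ : ∀ q → q ℚ.< ℕtoℚ A → q ℚ.≤ 0ℚ ⊎ 0ℚ ℚ.< q → L (m ℝ.^ y) q
      lower′ q q<A (inj₁ q≤0) = inj₁ q≤0
      -- The exponent (i T - 1)/(T τ) lies strictly below i/τ. The factor m^(1/(T τ)) lost in this
      -- way is made up for by choosing T with q^T · m < A^T.
      lower′ q q<A (inj₂ 0<q) = inj₂ (i * T , 1 , τ-1 + T-1 * τ ,
          lower I _ (⊖/-< {i * T} {1} {i} (T * τ) τ exponent) , power)
        where
          T-1 = proj₁ (^-archimedean 0<q q<A m)
          T = suc T-1
          arch : q ^ℚ T ℚ.* ℕtoℚ m ℚ.< ℕtoℚ A ^ℚ T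
          arch = proj₂ (^-archimedean 0<q q<A m)
          exponent : i * T * τ < i * (T * τ) + 1 * τ
          exponent = subst (_< i * (T * τ) + 1 * τ) (sym (ℕ.*-assoc i T τ)) (ℕ.m<m+n (i * (T * τ)) (s≤s z≤n))
          naturals : (A ^ T) ^ τ ≤ m ^ (i * T)
          naturals = begin
            (A ^ T) ^ τ   ≡⟨ trans (ℕ.^-*-assoc A T τ) (trans (cong (A ^_) (ℕ.*-comm T τ))
                  (sym (ℕ.^-*-assoc A τ T))) ⟩
            (A ^ τ) ^ T   ≤⟨ ℕ.^-monoˡ-≤ T A^τ≤m^i ⟩
            (m ^ i) ^ T   ≡⟨ ℕ.^-*-assoc m i T ⟩
            m ^ (i * T) ∎
            where open ℕ.≤-Reasoning
          m^1≤m^τ : ℕtoℚ (m ^ 1) ℚ.≤ ℕtoℚ m ^ℚ τ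
          m^1≤m^τ = subst (ℕtoℚ (m ^ 1) ℚ.≤_) (ℕtoℚ-^ m τ) (ℕtoℚ-≤ (ℕ.^-monoʳ-≤ m {1} {τ} (s≤s z≤n)))
          power : q ^ℚ (T * τ) ℚ.* ℕtoℚ (m ^ 1) ℚ.< ℕtoℚ (m ^ (i * T))
          power = begin-strict
            q ^ℚ (T * τ) ℚ.* ℕtoℚ (m ^ 1)   ≤⟨ mulˡ-≤ (^-nonneg (T * τ) (<⇒≤ 0<q)) m^1≤m^τ ⟩
            q ^ℚ (T * τ) ℚ.* ℕtoℚ m ^ℚ τ      ≡⟨ cong (ℚ._* ℕtoℚ m ^ℚ τ) (^-assocʳ q T τ) ⟨
            (q ^ℚ T) ^ℚ τ ℚ.* ℕtoℚ m ^ℚ τ       ≡⟨ *-^ (q ^ℚ T) (ℕtoℚ m) τ ⟨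
            (q ^ℚ T ℚ.* ℕtoℚ m) ^ℚ τ            <⟨ ^-mono-< τ
                  (Rationals.*-nonneg (^-nonneg T (<⇒≤ 0<q)) (ℕtoℚ-nonneg m)) arch ⟩
            (ℕtoℚ A ^ℚ T) ^ℚ τ                  ≡⟨ trans (ℕtoℚ-^ (A ^ T) τ) (cong (_^ℚ τ) (ℕtoℚ-^ A T)) ⟨
            ℕtoℚ ((A ^ T) ^ τ)              ≤⟨ ℕtoℚ-≤ naturals ⟩
            ℕtoℚ (m ^ (i * T)) ∎
            where open ≤-Reasoning

      upper′ : ∀ q → ℕtoℚ B ℚ.< q → U (m ℝ.^ y) q
      -- The exponent i′ + 1/T lies strictly above i′, and T is so large that B^T · m < q^T.
      upper′ q B<q = ≤-<-trans (ℕtoℚ-nonneg B) B<q , suc (i′ * T) , 0 , T-1 ,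
          upper I _ (<-⊖/ {suc (i′ * T)} {0} {i′} T 1 exponent) , power
        where
          arch′ = ^-archimedean (ℕtoℚ-pos 1≤B) B<q m
          T-1 = proj₁ arch′
          T = suc T-1
          exponent : i′ * T + 0 < suc (i′ * T) * 1
          exponent = subst₂ _<_ (sym (ℕ.+-identityʳ _)) (sym (ℕ.*-identityʳ _)) ℕ.≤-refl
          power : ℕtoℚ (m ^ suc (i′ * T)) ℚ.< q ^ℚ T ℚ.* ℕtoℚ 1
          power = begin-strict
            ℕtoℚ (m * m ^ (i′ * T))       ≡⟨ cong ℕtoℚ (trans (ℕ.*-comm m (m ^ (i′ * T)))
                  (cong (_* m) (sym (ℕ.^-*-assoc m i′ T)))) ⟩
            ℕtoℚ (B ^ T * m)                ≡⟨ trans (ℕtoℚ-* (B ^ T) m) (cong (ℚ._* ℕtoℚ m) (ℕtoℚ-^ B T)) ⟩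
            ℕtoℚ B ^ℚ T ℚ.* ℕtoℚ m              <⟨ proj₂ arch′ ⟩
            q ^ℚ T                              ≡⟨ *-identityʳ (q ^ℚ T) ⟨
            q ^ℚ T ℚ.* ℕtoℚ 1 ∎
            where open ≤-Reasoning

      below′ : ∀ q → L (m ℝ.^ y) q → q ℚ.≤ ℕtoℚ B
      below′ q (inj₁ q≤0) = ≤-trans q≤0 (ℕtoℚ-nonneg B)
      below′ q (inj₂ (i₀ , j , t-1 , Lr , power)) = ≮⇒≥ λ B<q → ℕ.<⇒≱
          (ℕtoℚ-<⁻¹ (≤-<-trans (B^t≤ B<q) power))
          (subst (m ^ i₀ ≤_) (trans (ℕ.^-distribˡ-+-* m (i′ * t) j)
              (cong (_* m ^ j) (sym (ℕ.^-*-assoc m i′ t))))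
            (ℕ.^-monoʳ-≤ m i₀≤))
        where
          t = suc t-1
          i₀≤ : i₀ ≤ i′ * t + j
          i₀≤ = subst₂ _≤_ (ℕ.*-identityʳ i₀) (cong (λ z → i′ * t + z) (ℕ.*-identityʳ j))
            (ℕ.≮⇒≥ λ lt → <⇒≱ (<-⊖/ {i₀} {j} {i′} t 1 lt) (below I _ Lr))
          B^t≤ : ℕtoℚ B ℚ.< q → ℕtoℚ (B ^ t * m ^ j) ℚ.≤ q ^ℚ t ℚ.* ℕtoℚ (m ^ j)
          B^t≤ B<q = subst (ℚ._≤ q ^ℚ t ℚ.* ℕtoℚ (m ^ j))
            (sym (trans (ℕtoℚ-* (B ^ t) (m ^ j)) (cong (ℚ._* ℕtoℚ (m ^ j)) (ℕtoℚ-^ B t))))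
            (mulʳ-≤ (ℕtoℚ-nonneg (m ^ j)) (^-mono-≤ t (ℕtoℚ-nonneg B) (<⇒≤ B<q)))

      above′ : ∀ q → U (m ℝ.^ y) q → ℕtoℚ A ℚ.≤ q
      above′ q (0<q , i₀ , j , t-1 , Ur , power) = ≮⇒≥ λ q<A →
          ^-cancel-< {m ^ i₀} {A ^ t * m ^ j} τ (^-lemma A m τ i j i₀ t A^τ≤m^i i≤)
              (ℕtoℚ-<⁻¹ {m ^ i₀} {A ^ t * m ^ j} (<-≤-trans power (A^t≥ q<A)))
        where
          t = suc t-1
          i≤ : i * t + j * τ ≤ i₀ * τ
          i≤ = ℕ.≮⇒≥ λ lt → <⇒≱ (⊖/-< {i₀} {j} {i} t τ lt) (above I _ Ur)
          A^t≥ : q ℚ.< ℕtoℚ A → q ^ℚ t ℚ.* ℕtoℚ (m ^ j) ℚ.≤ ℕtoℚ (A ^ t * m ^ j)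
          A^t≥ q<A = subst (q ^ℚ t ℚ.* ℕtoℚ (m ^ j) ℚ.≤_)
            (sym (trans (ℕtoℚ-* (A ^ t) (m ^ j)) (cong (ℚ._* ℕtoℚ (m ^ j)) (ℕtoℚ-^ A t))))
            (mulʳ-≤ (ℕtoℚ-nonneg (m ^ j)) (^-mono-≤ t (<⇒≤ 0<q) (<⇒≤ q<A)))

-- Walks, simple paths and computable distances

module Walks where

  import Data.Fin.Properties as Fin
  open import Data.Fin.Subset.Properties using (_∈?_)
  open import Data.List using (take; drop; lookup)
  open import Relation.Nullary.Construct.Add.Supremum using ([_]; ⊤⁺)
  open import Defs using (Digraph; edges; weight; Arcs; arcs; Walk; nil; cons; IsMin; Dist; HopDist)

  Best : (ℚ → Set) → Set
  Best S = ∃ (IsMin S)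

  best-∅ : ∀ {S} → (∀ ℓ → ¬ S ℓ) → Best S
  best-∅ ¬S = ⊤⁺ , ¬S

  best-≡ : ∀ q → Best (_≡ q)
  best-≡ q = [ q ] , refl , λ ℓ ℓ≡q → ℚ.≤-reflexive (sym ℓ≡q)

  best-resp : ∀ {S T : ℚ → Set} → (∀ ℓ → S ℓ → T ℓ) → (∀ ℓ → T ℓ → S ℓ) → Best S → Best T
  best-resp S⊆T T⊆S ([ d ] , Sd , min) = [ d ] , S⊆T d Sd , λ ℓ Tℓ → min ℓ (T⊆S ℓ Tℓ)
  best-resp S⊆T T⊆S (⊤⁺ , ¬S)         = ⊤⁺ , λ ℓ Tℓ → ¬S ℓ (T⊆S ℓ Tℓ)

  best-⊎ : ∀ {S T : ℚ → Set} → Best S → Best T → Best (λ ℓ → S ℓ ⊎ T ℓ)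
  best-⊎ (⊤⁺ , ¬S) (⊤⁺ , ¬T) = ⊤⁺ , λ { ℓ (inj₁ Sℓ) → ¬S ℓ Sℓ ; ℓ (inj₂ Tℓ) → ¬T ℓ Tℓ }
  best-⊎ (⊤⁺ , ¬S) ([ e ] , Te , min) =
    [ e ] , inj₂ Te , λ { ℓ (inj₁ Sℓ) → contradiction Sℓ (¬S ℓ) ; ℓ (inj₂ Tℓ) → min ℓ Tℓ }
  best-⊎ ([ d ] , Sd , min) (⊤⁺ , ¬T) =
    [ d ] , inj₁ Sd , λ { ℓ (inj₁ Sℓ) → min ℓ Sℓ ; ℓ (inj₂ Tℓ) → contradiction Tℓ (¬T ℓ) }
  best-⊎ {S} {T} ([ d ] , Sd , minS) ([ e ] , Te , minT) = cases (ℚ.≤-total d e)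
    where
      cases : d ℚ.≤ e ⊎ e ℚ.≤ d → Best (λ ℓ → S ℓ ⊎ T ℓ)
      cases (inj₁ d≤e) = [ d ] , inj₁ Sd ,
        λ { ℓ (inj₁ Sℓ) → minS ℓ Sℓ ; ℓ (inj₂ Tℓ) → ℚ.≤-trans d≤e (minT ℓ Tℓ) }
      cases (inj₂ e≤d) = [ e ] , inj₂ Te ,
        λ { ℓ (inj₁ Sℓ) → ℚ.≤-trans e≤d (minS ℓ Sℓ) ; ℓ (inj₂ Tℓ) → minT ℓ Tℓ }

  best-× : ∀ {P : Set} {S : ℚ → Set} → Dec P → Best S → Best (λ ℓ → P × S ℓ)
  best-× (yes p) B = best-resp (λ ℓ Sℓ → p , Sℓ) (λ ℓ → proj₂) B
  best-× (no ¬p) B = best-∅ λ ℓ → ¬p ∘ proj₁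

  best-∃ : ∀ {n} {S : Fin n → ℚ → Set} → (∀ x → Best (S x)) → Best (λ ℓ → ∃ λ x → S x ℓ)
  best-∃ {zero}  B = best-∅ λ { ℓ (() , _) }
  best-∃ {suc n} B = best-resp
    (λ { ℓ (inj₁ S₀) → Fin.zero , S₀ ; ℓ (inj₂ (x , Sx)) → Fin.suc x , Sx })
    (λ { ℓ (Fin.zero , S₀) → inj₁ S₀ ; ℓ (Fin.suc x , Sx) → inj₂ (x , Sx) })
    (best-⊎ (B Fin.zero) (best-∃ (B ∘ Fin.suc)))

  best-+ : ∀ {S : ℚ → Set} w → Best S → Best (λ ℓ → ∃ λ ℓ′ → S ℓ′ × ℓ ≡ w ℚ.+ ℓ′)
  best-+ w (⊤⁺ , ¬S) = ⊤⁺ , λ { ℓ (ℓ′ , Sℓ′ , _) → ¬S ℓ′ Sℓ′ }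
  best-+ w ([ d ] , Sd , min) = [ w ℚ.+ d ] , (d , Sd , refl) ,
    λ { _ (ℓ′ , Sℓ′ , refl) → ℚ.+-monoʳ-≤ w (min ℓ′ Sℓ′) }

  module _ {n : ℕ} (G : Digraph n) where

    -- The Bellman-Ford recursion on the first arc. Minima are computed rather than postulated, as
    -- the construction has to be an algorithm.
    hopDist : ∀ β u v → ∃ (HopDist β (arcs G) u v)
    hopDist zero u v = best-resp
      (λ { ℓ (refl , refl) → 0 , z≤n , nil })
      (λ { ℓ (.0 , z≤n , nil) → refl , refl })
      (best-× (u Fin.≟ v) (best-≡ 0ℚ))
    hopDist (suc β) u v = best-resp
      (λ { ℓ (inj₁ (refl , refl)) → 0 , z≤n , nil
         ; ℓ (inj₂ (x , e , ℓ′ , (k , k≤β , W) , refl)) → suc k , s≤s k≤β , cons (e , refl) W })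
      (λ { ℓ (.0 , _ , nil) → inj₁ (refl , refl)
         ; ℓ (.(suc _) , s≤s k≤β , cons (e , refl) W) → inj₂ (_ , e , _ , (_ , k≤β , W) , refl) })
      (best-⊎ (best-× (u Fin.≟ v) (best-≡ 0ℚ))
        (best-∃ λ x → best-× (x ∈? edges G u) (best-+ (weight G u x) (hopDist β x v))))

  mapWalk : ∀ {n} {A B : Arcs n} → (∀ {u v w} → A u v w → B u v w) →
            ∀ {u v k ℓ} → Walk A u v k ℓ → Walk B u v k ℓ
  mapWalk f nil        = nil
  mapWalk f (cons a W) = cons (f a) (mapWalk f W)

  infixr 5 _++ʷ_

  _++ʷ_ : ∀ {n} {A : Arcs n} {u x v k k′ ℓ ℓ′} →
          Walk A u x k ℓ → Walk A x v k′ ℓ′ → Walk A u v (k ℕ.+ k′) (ℓ ℚ.+ ℓ′)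
  _++ʷ_ {A = A} {ℓ′ = ℓ′} nil W′ = subst (Walk A _ _ _) (sym (ℚ.+-identityˡ ℓ′)) W′
  _++ʷ_ {A = A} {ℓ′ = ℓ′} (cons {w = w} {ℓ = ℓ} a W) W′ =
    subst (Walk A _ _ _) (sym (ℚ.+-assoc w ℓ ℓ′)) (cons a (W ++ʷ W′))

  starts : ∀ {n} {A : Arcs n} {u v k ℓ} → Walk A u v k ℓ → List (Fin n)
  starts nil              = []
  starts (cons {u = u} _ W) = u ∷ starts W

  vertices : ∀ {n} {A : Arcs n} {u v k ℓ} → Walk A u v k ℓ → List (Fin n)
  vertices (nil {u})        = u ∷ []
  vertices (cons {u = u} _ W) = u ∷ vertices W

  length-starts : ∀ {n} {A : Arcs n} {u v k ℓ} (W : Walk A u v k ℓ) → length (starts W) ≡ k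
  length-starts nil        = refl
  length-starts (cons _ W) = cong suc (length-starts W)

  starts⊆vertices : ∀ {n} {A : Arcs n} {P : Fin n → Set} {u v k ℓ} (W : Walk A u v k ℓ) →
                    All P (vertices W) → All P (starts W)
  starts⊆vertices nil        _        = []
  starts⊆vertices (cons _ W) (p ∷ ps) = p ∷ starts⊆vertices W ps

  starts-unique : ∀ {n} {A : Arcs n} {u v k ℓ} (W : Walk A u v k ℓ) → Unique (vertices W) → Unique (starts W)
  starts-unique nil        _        = []
  starts-unique (cons _ W) (p ∷ ps) = starts⊆vertices W p ∷ starts-unique W ps

  unique⇒length≤ : ∀ {n} {xs : List (Fin n)} → Unique xs → length xs ℕ.≤ n
  unique⇒length≤ {n} {xs} u = Fin.injective⇒≤ {f = lookup xs} (lookup-injective u _ _)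
    where
      lookup∈ : ∀ {A : Set} (xs : List A) i → lookup xs i ∈ xs
      lookup∈ (x ∷ xs) Fin.zero    = here refl
      lookup∈ (x ∷ xs) (Fin.suc i) = there (lookup∈ xs i)
      lookup-injective : ∀ {xs : List (Fin n)} → Unique xs → ∀ i j → lookup xs i ≡ lookup xs j → i ≡ j
      lookup-injective (_ ∷ _)  Fin.zero    Fin.zero    _  = refl
      lookup-injective {x ∷ xs} (p ∷ _)  Fin.zero    (Fin.suc j) eq =
          contradiction eq (All.lookup p (lookup∈ xs j))
      lookup-injective {x ∷ xs} (p ∷ _)  (Fin.suc i) Fin.zero    eq =
          contradiction (sym eq) (All.lookup p (lookup∈ xs i))
      lookup-injective (_ ∷ ps) (Fin.suc i) (Fin.suc j) eq = cong Fin.suc (lookup-injective ps i j eq)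

  NonNegArcs : ∀ {n} → Arcs n → Set
  NonNegArcs A = ∀ {u v w} → A u v w → 0ℚ ℚ.≤ w

  -- The number `ℓ` only bounds the length, because cutting out cycles shortens a walk.
  record Path {n} (A : Arcs n) (u v : Fin n) (ℓ : ℚ) : Set where
    constructor path
    field
      {hops}  : ℕ
      {len}   : ℚ
      walk    : Walk A u v hops len
      len≤    : len ℚ.≤ ℓ
      simple  : Unique (vertices walk)

  walk-nonneg : ∀ {n} {A : Arcs n} → NonNegArcs A → ∀ {u v k ℓ} → Walk A u v k ℓ → 0ℚ ℚ.≤ ℓ
  walk-nonneg A≥0 nil        = ℚ.≤-refl
  walk-nonneg A≥0 (cons a W) = ℚ.+-mono-≤ (A≥0 a) (walk-nonneg A≥0 W)

  ≤-+ˡ : ∀ {w ℓ} → 0ℚ ℚ.≤ w → ℓ ℚ.≤ w ℚ.+ ℓ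
  ≤-+ˡ {w} {ℓ} 0≤w = subst (ℚ._≤ w ℚ.+ ℓ) (ℚ.+-identityˡ ℓ) (ℚ.+-monoˡ-≤ ℓ 0≤w)

  module _ {n : ℕ} {A : Arcs n} (A≥0 : NonNegArcs A) where

    open import Data.List.Membership.DecPropositional (Fin._≟_ {n}) using () renaming (_∈?_ to _∈ᴸ?_)

    suffix : ∀ {u x v k ℓ} (W : Walk A u v k ℓ) → Unique (vertices W) → x ∈ vertices W → Path A x v ℓ
    suffix nil              un       (here refl) = path nil ℚ.≤-refl un
    suffix (cons a W)       un       (here refl) = path (cons a W) ℚ.≤-refl un
    suffix (cons {w = w} a W) (_ ∷ un) (there x∈) =
      let path W′ ℓ′≤ un′ = suffix W un x∈ in path W′ (ℚ.≤-trans ℓ′≤ (≤-+ˡ {w} (A≥0 a))) un′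

    -- If the new first vertex already lies on the simplified rest, the suffix starting there
    -- replaces everything before it; nonnegative weights make this no longer.
    simplify : ∀ {u v k ℓ} → Walk A u v k ℓ → Path A u v ℓ
    simplify nil = path nil ℚ.≤-refl ([] ∷ [])
    simplify (cons {u = u} {w = w} a W) = extend {a = a} (simplify W)
      where
        extend : ∀ {x v ℓ} {a : A u x w} → Path A x v ℓ → Path A u v (w ℚ.+ ℓ)
        extend {a = a} (path W′ ℓ′≤ un) with u ∈ᴸ? vertices W′
        ... | yes u∈ = let path W″ ℓ″≤ un″ = suffix W′ un u∈ in
                       path W″ (ℚ.≤-trans ℓ″≤ (ℚ.≤-trans ℓ′≤ (≤-+ˡ {w} (A≥0 a)))) un″
        ... | no u∉ = path (cons a W′) (ℚ.+-monoʳ-≤ w ℓ′≤)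
            (All.tabulate (λ y∈ u≡y → u∉ (subst (_∈ vertices W′) (sym u≡y) y∈)) ∷ un)

    hops≤n : ∀ {u v ℓ} (p : Path A u v ℓ) → Path.hops p ℕ.≤ n
    hops≤n (path W _ un) = subst (ℕ._≤ n) (length-starts W) (unique⇒length≤ (starts-unique W un))

  module _ {n : ℕ} (G : Digraph n) (G≥0 : NonNegArcs (arcs G)) where

    -- A simple path has at most n arcs, so the minimum over n hops is the minimum over all walks.
    dist : ∀ u v → ∃ (Dist (arcs G) u v)
    dist u v = extend (hopDist G n u v)
      where
        extend : ∃ (HopDist n (arcs G) u v) → ∃ (Dist (arcs G) u v)
        extend (⊤⁺ , ¬W) = ⊤⁺ , λ { ℓ (k , W) → let p = simplify G≥0 W in ¬W _ (_ , hops≤n G≥0 p , Path.walk p) }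
        extend ([ d ] , (k , _ , W) , min) = [ d ] , (k , W) ,
          λ { ℓ (k′ , W′) → let p = simplify G≥0 W′ in
              ℚ.≤-trans (min _ (_ , hops≤n G≥0 p , Path.walk p)) (Path.len≤ p) }

    ShortestPath : Fin n → Fin n → Set
    ShortestPath u v = ∃ λ d → Path (arcs G) u v d × (∀ k ℓ → Walk (arcs G) u v k ℓ → d ℚ.≤ ℓ)

    shortestPath : ∀ u v → (∀ k ℓ → ¬ Walk (arcs G) u v k ℓ) ⊎ ShortestPath u v
    shortestPath u v = cases (dist u v)
      where
        cases : ∃ (Dist (arcs G) u v) → (∀ k ℓ → ¬ Walk (arcs G) u v k ℓ) ⊎ ShortestPath u v
        cases (⊤⁺ , ¬W) = inj₁ λ k ℓ W → ¬W ℓ (k , W)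
        cases ([ d ] , (k , W) , min) = inj₂ (d , simplify G≥0 W , λ k′ ℓ W′ → min ℓ (k′ , W′))

  splitWalk : ∀ {n} {A : Arcs n} {u v ℓ} i {j} (W : Walk A u v (i ℕ.+ j) ℓ) →
    ∃₂ λ x ℓ₁ → ∃ λ ℓ₂ → Σ (Walk A u x i ℓ₁) λ W₁ → Σ (Walk A x v j ℓ₂) λ W₂ →
    ℓ₁ ℚ.+ ℓ₂ ≡ ℓ × starts W₁ ≡ take i (starts W) × starts W₂ ≡ drop i (starts W)
  splitWalk {ℓ = ℓ} zero W = _ , 0ℚ , ℓ , nil , W , ℚ.+-identityˡ ℓ , refl , refl
  splitWalk (suc i) (cons {u = u} {w = w} a W) =
    let x , ℓ₁ , ℓ₂ , W₁ , W₂ , eq , eq₁ , eq₂ = splitWalk i W in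
    x , w ℚ.+ ℓ₁ , ℓ₂ , cons a W₁ , W₂ , trans (ℚ.+-assoc w ℓ₁ ℓ₂) (cong (w ℚ.+_) eq) , cong (u ∷_) eq₁ , eq₂

  splitAtVertex : ∀ {n} {A : Arcs n} {u v x k ℓ} (W : Walk A u v k ℓ) → x ∈ starts W →
    ∃₂ λ i j → ∃₂ λ ℓ₁ ℓ₂ → Walk A u x i ℓ₁ × Walk A x v j ℓ₂ × i ℕ.+ j ≡ k × ℓ₁ ℚ.+ ℓ₂ ≡ ℓ
  splitAtVertex {ℓ = ℓ} W@(cons _ _) (here refl) = 0 , _ , 0ℚ , ℓ , nil , W , refl , ℚ.+-identityˡ ℓ
  splitAtVertex (cons {w = w} a W) (there x∈) =
    let i , j , ℓ₁ , ℓ₂ , W₁ , W₂ , eq , eq′ = splitAtVertex W x∈ in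
    suc i , j , w ℚ.+ ℓ₁ , ℓ₂ , cons a W₁ , W₂ , cong suc eq , trans (ℚ.+-assoc w ℓ₁ ℓ₂) (cong (w ℚ.+_) eq′)

  arcsIn : ∀ {n} → Digraph n → List (Fin n × Fin n) → Arcs n
  arcsIn G es u v w = arcs G u v w × (u , v) ∈ es

  edgesOf : ∀ {n} {A : Arcs n} {u v k ℓ} → Walk A u v k ℓ → List (Fin n × Fin n)
  edgesOf nil                        = []
  edgesOf (cons {u = u} {x = x} _ W) = (u , x) ∷ edgesOf W

  length-edgesOf : ∀ {n} {A : Arcs n} {u v k ℓ} (W : Walk A u v k ℓ) → length (edgesOf W) ≡ k
  length-edgesOf nil        = refl
  length-edgesOf (cons _ W) = cong suc (length-edgesOf W)

  restrict : ∀ {n} {G : Digraph n} {u v k ℓ es} (W : Walk (arcs G) u v k ℓ) →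
             (∀ {e} → e ∈ edgesOf W → e ∈ es) → Walk (arcsIn G es) u v k ℓ
  restrict nil        _  = nil
  restrict (cons a W) ⊆es = cons (a , ⊆es (here refl)) (restrict W (⊆es ∘ there))

-- Greedy hitting sets

module HittingSets where

  open import Data.Nat
  open import Data.Nat.Properties
  import Data.Fin.Properties as Fin
  open import Data.List using (filter)
  import Data.List.Relation.Unary.All.Properties as All
  import Data.Vec.Functional as V
  open import Algebra.Properties.CommutativeMonoid.Sum +-0-commutativeMonoid using
    ( sum; ∑-distrib-+; sum-cong-≗ )

  argmax : ∀ {n} (f : Fin (suc n) → ℕ) → ∃ λ v → ∀ w → f w ≤ f v
  argmax {zero}  f = Fin.zero , λ { Fin.zero → ≤-refl }
  argmax {suc n} f with argmax (f ∘ Fin.suc)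
  ... | v , max with ≤-total (f Fin.zero) (f (Fin.suc v))
  ...   | inj₁ le = Fin.suc v , λ { Fin.zero → le ; (Fin.suc w) → max w }
  ...   | inj₂ ge = Fin.zero , λ { Fin.zero → ≤-refl ; (Fin.suc w) → ≤-trans (max w) ge }

  sum≤n*max : ∀ {n} (f : Fin n → ℕ) m → (∀ w → f w ≤ m) → sum f ≤ n * m
  sum≤n*max {zero}  f m le = z≤n
  sum≤n*max {suc n} f m le = +-mono-≤ (le Fin.zero) (sum≤n*max (f ∘ Fin.suc) m (le ∘ Fin.suc))

  sum-mono-≤ : ∀ {n} {f g : Fin n → ℕ} → (∀ w → f w ≤ g w) → sum f ≤ sum g
  sum-mono-≤ {zero}  le = z≤n
  sum-mono-≤ {suc n} le = +-mono-≤ (le Fin.zero) (sum-mono-≤ (le ∘ Fin.suc))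

  f≤sum : ∀ {n} (f : Fin n → ℕ) x → f x ≤ sum f
  f≤sum {suc n} f Fin.zero    = m≤m+n _ _
  f≤sum {suc n} f (Fin.suc x) = ≤-trans (f≤sum (f ∘ Fin.suc) x) (m≤n+m _ (f Fin.zero))

  𝟙 : ∀ {P : Set} → Dec P → ℕ
  𝟙 (yes _) = 1
  𝟙 (no _)  = 0

  𝟙-yes : ∀ {P : Set} (d : Dec P) → P → 𝟙 d ≡ 1
  𝟙-yes (yes _) _ = refl
  𝟙-yes (no ¬p) p = contradiction p ¬p

  module _ {n : ℕ} where

    open import Data.List.Membership.DecPropositional (Fin._≟_ {n}) using (_∈?_; _∉?_)

    hits : List (List (Fin n)) → Fin n → ℕ
    hits Bs v = length (filter (v ∈?_) Bs)

    missed : List (List (Fin n)) → Fin n → List (List (Fin n))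
    missed Bs v = filter (v ∉?_) Bs

    hits+missed : ∀ Bs v → hits Bs v + length (missed Bs v) ≡ length Bs
    hits+missed []       v = refl
    hits+missed (B ∷ Bs) v with v ∈? B
    ... | yes _ = cong suc (hits+missed Bs v)
    ... | no  _ = trans (+-suc _ _) (cong suc (hits+missed Bs v))

    hits-∷ : ∀ B Bs v → 𝟙 (v ∈? B) + hits Bs v ≡ hits (B ∷ Bs) v
    hits-∷ B Bs v with v ∈? B
    ... | yes _ = refl
    ... | no  _ = refl

    length≤∑ : ∀ {B} → Unique B → length B ≤ sum (λ v → 𝟙 (v ∈? B))
    length≤∑ {[]}    _ = z≤n
    length≤∑ {x ∷ B} (x≢ ∷ un) = begin
      1 + length B                                              ≤⟨ +-mono-≤ 1≤ (length≤∑ un) ⟩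
      sum (λ v → 𝟙 (v Fin.≟ x)) + sum (λ v → 𝟙 (v ∈? B))
        ≡⟨ ∑-distrib-+ (λ v → 𝟙 (v Fin.≟ x)) (λ v → 𝟙 (v ∈? B)) ⟨
      sum (λ v → 𝟙 (v Fin.≟ x) + 𝟙 (v ∈? B))                   ≤⟨ sum-mono-≤ split ⟩
      sum (λ v → 𝟙 (v ∈? (x ∷ B))) ∎
      where
        open ≤-Reasoning
        1≤ : 1 ≤ sum (λ v → 𝟙 (v Fin.≟ x))
        1≤ = subst (_≤ sum (λ v → 𝟙 (v Fin.≟ x))) (𝟙-yes (x Fin.≟ x) refl) (f≤sum (λ v → 𝟙 (v Fin.≟ x)) x)
        split : ∀ v → 𝟙 (v Fin.≟ x) + 𝟙 (v ∈? B) ≤ 𝟙 (v ∈? (x ∷ B))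
        split v with v Fin.≟ x | v ∈? B
        ... | yes refl | yes v∈B = contradiction refl (All.lookup x≢ v∈B)
        ... | yes v≡x  | no _    = ≤-refl
        ... | no _     | yes v∈B = ≤-refl
        ... | no _     | no _    = z≤n

    Blocks : ℕ → List (List (Fin n)) → Set
    Blocks h = All (λ B → Unique B × length B ≡ h)

    double-count : ∀ {h Bs} → Blocks h Bs → h * length Bs ≤ sum (hits Bs)
    double-count {h} {[]} [] = subst (_≤ sum (hits [])) (sym (*-zeroʳ h)) z≤n
    double-count {h} {B ∷ Bs} ((un , refl) ∷ bs) = begin
      h * suc (length Bs)                          ≡⟨ *-suc h (length Bs) ⟩
      h + h * length Bs                            ≤⟨ +-mono-≤ (length≤∑ un) (double-count bs) ⟩
      sum (λ v → 𝟙 (v ∈? B)) + sum (hits Bs)      ≡⟨ ∑-distrib-+ (λ v → 𝟙 (v ∈? B)) (hits Bs) ⟨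
      sum (λ v → 𝟙 (v ∈? B) + hits Bs v)          ≡⟨ sum-cong-≗ (hits-∷ B Bs) ⟩
      sum (hits (B ∷ Bs)) ∎
      where open ≤-Reasoning

  -- The vertex lying in most blocks. There are h incidences per block, distributed over n vertices,
  -- so it lies in an average share of h/n of the blocks.
  greedyVertex : ∀ {n} .{{_ : NonZero n}} {h Bs} → Blocks {n} h Bs →
                 ∃ λ v → n * length (missed Bs v) ≤ (n ∸ h) * length Bs
  greedyVertex {n@(suc _)} {h} {Bs} bs = v , (begin
    n * M                    ≤⟨ m+n≤o⇒m≤o∸n (n * M) sum≤ ⟩
    n * length Bs ∸ h * length Bs ≡⟨ *-distribʳ-∸ (length Bs) n h ⟨
    (n ∸ h) * length Bs ∎)
    where
      open ≤-Reasoning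
      v = proj₁ (argmax (hits Bs))
      M = length (missed Bs v)
      sum≤ : n * M + h * length Bs ≤ n * length Bs
      sum≤ = begin
        n * M + h * length Bs   ≤⟨ +-monoʳ-≤ (n * M) (≤-trans (double-count bs)
              (sum≤n*max (hits Bs) (hits Bs v) (proj₂ (argmax (hits Bs))))) ⟩
        n * M + n * hits Bs v   ≡⟨ solution n M (hits Bs v) ⟩
        n * (hits Bs v + M)     ≡⟨ cong (n *_) (hits+missed Bs v) ⟩
        n * length Bs ∎
        where
          solution : ∀ n M H → n * M + n * H ≡ n * (H + M)
          solution = solve-∀

  -- Each greedily chosen vertex hits at least an h/n fraction of the remaining blocks.
  greedySet : ∀ {n} .{{_ : NonZero n}} {h} s Bs → Blocks {n} h Bs →
    ∃₂ λ (S : Fin s → Fin n) Rs → n ^ s * length Rs ≤ (n ∸ h) ^ s * length Bs ×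
      (∀ {B} → B ∈ Bs → (∃ λ i → S i ∈ B) ⊎ B ∈ Rs)
  greedySet zero Bs bs = (λ ()) , Bs , ≤-refl , inj₂
  greedySet {n} {h} (suc s) Bs bs =
    let v , le = greedyVertex bs
        S , Rs , le′ , covers = greedySet s (missed Bs v) (All.filter⁺ (v ∉?_) bs)
    in (v V.∷ S) , Rs , bound v Rs le le′ , cover v S covers
    where
      open import Data.List.Membership.DecPropositional (Fin._≟_ {n}) using (_∈?_; _∉?_)
      open import Data.List.Membership.Propositional.Properties using (∈-filter⁺)
      d = n ∸ h
      bound : ∀ v (Rs : List (List (Fin n))) → n * length (missed Bs v) ≤ d * length Bs →
              n ^ s * length Rs ≤ d ^ s * length (missed Bs v) → n * n ^ s * length Rs ≤ d * d ^ s * length Bs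
      bound v Rs le le′ = begin
        n * n ^ s * length Rs                 ≡⟨ *-assoc n (n ^ s) (length Rs) ⟩
        n * (n ^ s * length Rs)               ≤⟨ *-monoʳ-≤ n le′ ⟩
        n * (d ^ s * length (missed Bs v))    ≡⟨ swap n (d ^ s) (length (missed Bs v)) ⟩
        d ^ s * (n * length (missed Bs v))    ≤⟨ *-monoʳ-≤ (d ^ s) le ⟩
        d ^ s * (d * length Bs)               ≡⟨ swap′ (d ^ s) d (length Bs) ⟩
        d * d ^ s * length Bs ∎
        where
          open ≤-Reasoning
          swap : ∀ a b c → a * (b * c) ≡ b * (a * c)
          swap = solve-∀
          swap′ : ∀ a b c → a * (b * c) ≡ b * a * c
          swap′ = solve-∀
      cover : ∀ v (S : Fin s → Fin n) {Rs} → (∀ {B} → B ∈ missed Bs v → (∃ λ i → S i ∈ B) ⊎ B ∈ Rs) →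
              ∀ {B} → B ∈ Bs → (∃ λ i → (v V.∷ S) i ∈ B) ⊎ B ∈ Rs
      cover v S covers {B} B∈ with v ∈? B
      ... | yes v∈B = inj₁ (Fin.zero , v∈B)
      ... | no  v∉B with covers (∈-filter⁺ (v ∉?_) B∈ v∉B)
      ...   | inj₁ (i , Si∈B) = inj₁ (Fin.suc i , Si∈B)
      ...   | inj₂ B∈Rs       = inj₂ B∈Rs

  bernoulliℕ : ∀ d h T → d ^ T * (d + suc T * h) ≤ (d + h) ^ suc T
  bernoulliℕ d h zero = ≤-reflexive (base d h)
    where
      base : ∀ d h → 1 * (d + 1 * h) ≡ (d + h) * 1
      base = solve-∀
  bernoulliℕ d h (suc T) = begin
    d * x * (d + (2 + T) * h)                        ≤⟨ m≤m+n _ (x * (suc T * h * h)) ⟩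
    d * x * (d + (2 + T) * h) + x * (suc T * h * h)  ≡⟨ solution d h x T ⟩
    (d + h) * (x * (d + suc T * h))                  ≤⟨ *-monoʳ-≤ (d + h) (bernoulliℕ d h T) ⟩
    (d + h) * (d + h) ^ suc T ∎
    where
      open ≤-Reasoning
      x = d ^ T
      solution : ∀ d h x T → d * x * (d + (2 + T) * h) + x * (suc T * h * h) ≡ (d + h) * (x * (d + suc T * h))
      solution = solve-∀

  -- With d = n - h, Bernoulli gives (d + h)^q ≥ d^(q-1) (d + q h), and q h ≥ n ≥ d makes this at
  -- least 2 d^q. So q greedy choices halve the number of missed blocks.
  halving : ∀ n .{{_ : NonZero n}} h q → n ≤ q * h → 2 * (n ∸ h) ^ q ≤ n ^ q
  halving n h zero n≤0 = contradiction n≤0 (<⇒≱ (>-nonZero⁻¹ n))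
  halving n h (suc T) n≤qh with h ≤? n
  ... | no h≰n = subst (λ d → 2 * d ^ suc T ≤ n ^ suc T) (sym (m≤n⇒m∸n≡0 (<⇒≤ (≰⇒> h≰n)))) z≤n
  ... | yes h≤n = begin
    2 * (d * d ^ T)          ≡⟨ solution d (d ^ T) ⟩
    d ^ T * (d + d)          ≤⟨ *-monoʳ-≤ (d ^ T) (+-monoʳ-≤ d (≤-trans (m∸n≤m n h) n≤qh)) ⟩
    d ^ T * (d + suc T * h)  ≤⟨ bernoulliℕ d h T ⟩
    (d + h) ^ suc T          ≡⟨ cong (_^ suc T) (m∸n+n≡m h≤n) ⟩
    n ^ suc T ∎
    where
      open ≤-Reasoning
      d = n ∸ h
      solution : ∀ d x → 2 * (d * x) ≡ x * (d + d)
      solution = solve-∀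

  halvings : ∀ n .{{_ : NonZero n}} h q λ′ s → n ≤ q * h → q * λ′ ≤ s → 2 ^ λ′ * (n ∸ h) ^ s ≤ n ^ s
  halvings n h q λ′ s n≤qh qλ≤s = begin
    2 ^ λ′ * d ^ s                   ≡⟨ cong (λ z → 2 ^ λ′ * d ^ z) s≡ ⟨
    2 ^ λ′ * d ^ (q * λ′ + r)        ≡⟨ cong (2 ^ λ′ *_) (^-distribˡ-+-* d (q * λ′) r) ⟩
    2 ^ λ′ * (d ^ (q * λ′) * d ^ r)  ≡⟨ *-assoc (2 ^ λ′) (d ^ (q * λ′)) (d ^ r) ⟨
    2 ^ λ′ * d ^ (q * λ′) * d ^ r    ≤⟨ *-mono-≤ (power λ′) (^-monoˡ-≤ r (m∸n≤m n h)) ⟩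
    n ^ (q * λ′) * n ^ r             ≡⟨ ^-distribˡ-+-* n (q * λ′) r ⟨
    n ^ (q * λ′ + r)                 ≡⟨ cong (n ^_) s≡ ⟩
    n ^ s ∎
    where
      open ≤-Reasoning
      d = n ∸ h
      r = s ∸ q * λ′
      s≡ : q * λ′ + r ≡ s
      s≡ = m+[n∸m]≡n qλ≤s
      swap : ∀ a b c e → a * b * (c * e) ≡ a * c * (b * e)
      swap = solve-∀
      power : ∀ k → 2 ^ k * d ^ (q * k) ≤ n ^ (q * k)
      power zero = ≤-reflexive (trans (*-identityˡ _) (trans (cong (d ^_) (*-zeroʳ q))
          (cong (n ^_) (sym (*-zeroʳ q)))))
      power (suc k) = begin
        2 * 2 ^ k * d ^ (q * suc k)           ≡⟨ cong (λ z → 2 * 2 ^ k * d ^ z) (*-suc q k) ⟩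
        2 * 2 ^ k * d ^ (q + q * k)           ≡⟨ cong (2 * 2 ^ k *_) (^-distribˡ-+-* d q (q * k)) ⟩
        2 * 2 ^ k * (d ^ q * d ^ (q * k))     ≡⟨ swap 2 (2 ^ k) (d ^ q) (d ^ (q * k)) ⟩
        2 * d ^ q * (2 ^ k * d ^ (q * k))     ≤⟨ *-mono-≤ (halving n h q n≤qh) (power k) ⟩
        n ^ q * n ^ (q * k)                   ≡⟨ ^-distribˡ-+-* n q (q * k) ⟨
        n ^ (q + q * k)                       ≡⟨ cong (n ^_) (*-suc q k) ⟨
        n ^ (q * suc k) ∎

  -- After q λ′ choices fewer than one block is missed; the s - q λ′ choices to spare do no harm. A
  -- missed block would give d^s (|Bs| + 1) ≤ n^s ≤ d^s |Bs|, so d^s = 0 and then n^s = 0.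
  hittingSet : ∀ {n} .{{_ : NonZero n}} {h} q λ′ s Bs → Blocks {n} h Bs →
               n ≤ q * h → q * λ′ ≤ s → length Bs < 2 ^ λ′ →
               ∃ λ (S : Fin s → Fin n) → ∀ {B} → B ∈ Bs → ∃ λ i → S i ∈ B
  hittingSet {n} {h} q λ′ s Bs bs n≤qh qλ≤s |Bs|<2^λ with greedySet s Bs bs
  ... | S , [] , _ , covers = S , λ B∈ → hit (covers B∈)
    where
      hit : ∀ {B} → (∃ λ i → S i ∈ B) ⊎ B ∈ [] → ∃ λ i → S i ∈ B
      hit (inj₁ h) = h
  ... | S , R ∷ Rs , le , _ = contradiction (begin-strict
    0                                    <⟨ n^s>0 ⟩
    n ^ s                                ≤⟨ m≤m*n (n ^ s) (suc (length Rs)) ⟩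
    n ^ s * suc (length Rs)              ≤⟨ le ⟩
    d ^ s * length Bs                    ≡⟨ cong (_* length Bs) d^s≡0 ⟩
    0 ∎) (<-irrefl refl)
    where
      open ≤-Reasoning
      d = n ∸ h
      n^s>0 : 0 < n ^ s
      n^s>0 = m^n>0 n s
      d^s≡0 : d ^ s ≡ 0
      d^s≡0 = n≤0⇒n≡0 (+-cancelʳ-≤ (d ^ s * length Bs) (d ^ s) 0 (begin
        d ^ s + d ^ s * length Bs     ≡⟨ *-suc (d ^ s) (length Bs) ⟨
        d ^ s * suc (length Bs)       ≤⟨ *-monoʳ-≤ (d ^ s) |Bs|<2^λ ⟩
        d ^ s * 2 ^ λ′                ≡⟨ *-comm (d ^ s) (2 ^ λ′) ⟩
        2 ^ λ′ * d ^ s                ≤⟨ halvings n h q λ′ s n≤qh qλ≤s ⟩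
        n ^ s                         ≤⟨ m≤m*n (n ^ s) (suc (length Rs)) ⟩
        n ^ s * suc (length Rs)       ≤⟨ le ⟩
        d ^ s * length Bs ∎))

-- Sets of pairs as lists, and their sizes

module Pairs where

  open import Data.Nat
  open import Data.Nat.Properties
  open import Data.Bool using (if_then_else_)
  import Data.Fin.Properties as Fin
  open import Data.Fin.Subset using (Subset; ∣_∣; ⁅_⁆; _∪_; inside; outside)
  open import Data.Fin.Subset.Properties using (x∈⁅x⁆; x∈p∪q⁺; ∣⁅x⁆∣≡1; ∣⊥∣≡0; ∣p∣≤n)
  open import Data.List using (map)
  open import Data.Vec as Vec using ([]; _∷_; tabulate; sum)
  open import Relation.Nullary.Decidable using (dec-true)
  open import Defs using (PairSet; size)

  sum-tabulate-≤-+ : ∀ {m} (f g h : Fin m → ℕ) → (∀ u → f u ≤ g u + h u) →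
                     sum (tabulate f) ≤ sum (tabulate g) + sum (tabulate h)
  sum-tabulate-≤-+ {zero}  f g h le = z≤n
  sum-tabulate-≤-+ {suc m} f g h le = ≤-trans
    (+-mono-≤ (le Fin.zero) (sum-tabulate-≤-+ (f ∘ Fin.suc) (g ∘ Fin.suc) (h ∘ Fin.suc) (le ∘ Fin.suc)))
    (≤-reflexive (+-interchange (g Fin.zero) (h Fin.zero) _ _))
    where
      open import Algebra.Properties.CommutativeSemigroup +-commutativeSemigroup using () renaming (interchange to +-interchange)

  sum-tabulate-≤ : ∀ {m} (f : Fin m → ℕ) c → (∀ u → f u ≤ c) → sum (tabulate f) ≤ m * c
  sum-tabulate-≤ {zero}  f c le = z≤n
  sum-tabulate-≤ {suc m} f c le = +-mono-≤ (le Fin.zero) (sum-tabulate-≤ (f ∘ Fin.suc) c (le ∘ Fin.suc))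

  sum-tabulate-supported : ∀ {m} (f : Fin m → ℕ) x c → (∀ u → u ≢ x → f u ≡ 0) → f x ≤ c →
                           sum (tabulate f) ≤ c
  sum-tabulate-supported {suc m} f Fin.zero c f≡0 fx≤c = begin
    f Fin.zero + sum (tabulate (f ∘ Fin.suc))   ≤⟨ +-mono-≤ fx≤c
          (sum-tabulate-≤ (f ∘ Fin.suc) 0 (λ u → ≤-reflexive (f≡0 (Fin.suc u) λ ()))) ⟩
    c + m * 0                                   ≡⟨ trans (cong (c +_) (*-zeroʳ m)) (+-identityʳ c) ⟩
    c ∎
    where open ≤-Reasoning
  sum-tabulate-supported {suc m} f (Fin.suc x) c f≡0 fx≤c = subst (λ z → z + sum (tabulate (f ∘ Fin.suc)) ≤ c)
    (sym (f≡0 Fin.zero λ ()))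
    (sum-tabulate-supported (f ∘ Fin.suc) x c (λ u u≢x → f≡0 (Fin.suc u) (u≢x ∘ Fin.suc-injective)) fx≤c)

  ∣p∪q∣≤∣p∣+∣q∣ : ∀ {n} (p q : Subset n) → ∣ p ∪ q ∣ ≤ ∣ p ∣ + ∣ q ∣
  ∣p∪q∣≤∣p∣+∣q∣ []            []            = z≤n
  ∣p∪q∣≤∣p∣+∣q∣ (outside ∷ p) (outside ∷ q) = ∣p∪q∣≤∣p∣+∣q∣ p q
  ∣p∪q∣≤∣p∣+∣q∣ (inside  ∷ p) (outside ∷ q) = s≤s (∣p∪q∣≤∣p∣+∣q∣ p q)
  ∣p∪q∣≤∣p∣+∣q∣ (outside ∷ p) (inside  ∷ q) = subst (suc ∣ p ∪ q ∣ ≤_) (sym (+-suc ∣ p ∣ ∣ q ∣))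
      (s≤s (∣p∪q∣≤∣p∣+∣q∣ p q))
  ∣p∪q∣≤∣p∣+∣q∣ (inside  ∷ p) (inside  ∷ q) =
    s≤s (≤-trans (∣p∪q∣≤∣p∣+∣q∣ p q) (+-monoʳ-≤ ∣ p ∣ (n≤1+n ∣ q ∣)))

  fromPairs : ∀ {n} → List (Fin n × Fin n) → PairSet n
  fromPairs []             u = Subset.⊥
  fromPairs ((x , y) ∷ es) u = (if does (u Fin.≟ x) then ⁅ y ⁆ else Subset.⊥) ∪ fromPairs es u

  ∈-fromPairs : ∀ {n u v} {es : List (Fin n × Fin n)} → (u , v) ∈ es → v Subset.∈ fromPairs es u
  ∈-fromPairs {u = u} {v} {.(u , v) ∷ es} (here refl) = x∈p∪q⁺ (inj₁
    (subst (λ b → v Subset.∈ (if b then ⁅ v ⁆ else Subset.⊥)) (sym (dec-true (u Fin.≟ u) refl)) (x∈⁅x⁆ v)))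
  ∈-fromPairs {es = _ ∷ es} (there e∈) = x∈p∪q⁺ (inj₂ (∈-fromPairs e∈))

  size-fromPairs : ∀ {n} (es : List (Fin n × Fin n)) → size (fromPairs es) ≤ length es
  size-fromPairs {n} [] = ≤-trans (sum-tabulate-≤ {n} (λ u → ∣ Subset.⊥ {n} ∣) 0 (λ u →
      ≤-reflexive (∣⊥∣≡0 n)))
                                  (≤-reflexive (*-zeroʳ n))
  size-fromPairs {n} ((x , y) ∷ es) = ≤-trans
    (sum-tabulate-≤-+ _ (λ u → ∣ row u ∣) (λ u → ∣ fromPairs es u ∣) (λ u →
        ∣p∪q∣≤∣p∣+∣q∣ (row u) (fromPairs es u)))
    (+-mono-≤ (sum-tabulate-supported (λ u → ∣ row u ∣) x 1 other one) (size-fromPairs es))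
    where
      row : Fin n → Subset n
      row u = if does (u Fin.≟ x) then ⁅ y ⁆ else Subset.⊥
      other : ∀ u → u ≢ x → ∣ row u ∣ ≡ 0
      other u u≢x with u Fin.≟ x
      ... | yes u≡x = contradiction u≡x u≢x
      ... | no _    = ∣⊥∣≡0 n
      one : ∣ row x ∣ ≤ 1
      one with x Fin.≟ x
      ... | yes _ = ≤-reflexive (∣⁅x⁆∣≡1 y)
      ... | no _  = subst (_≤ 1) (sym (∣⊥∣≡0 n)) z≤n

  size≤n² : ∀ {n} (P : PairSet n) → size P ≤ n * n
  size≤n² {n} P = sum-tabulate-≤ (λ u → ∣ P u ∣) n (λ u → ∣p∣≤n (P u))

  elements : ∀ {n} → Subset n → List (Fin n)
  elements []            = []
  elements (inside  ∷ p) = Fin.zero ∷ map Fin.suc (elements p)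
  elements (outside ∷ p) = map Fin.suc (elements p)

  length-elements : ∀ {n} (p : Subset n) → length (elements p) ≡ ∣ p ∣
  length-elements []            = refl
  length-elements (inside  ∷ p) = cong suc (trans (length-map Fin.suc (elements p)) (length-elements p))
  length-elements (outside ∷ p) = trans (length-map Fin.suc (elements p)) (length-elements p)

  ∈-elements : ∀ {n x} {p : Subset n} → x Subset.∈ p → x ∈ elements p
  ∈-elements {p = inside ∷ p}  Vec.here       = here refl
  ∈-elements {p = inside ∷ p}  (Vec.there x∈) = there (∈-map⁺ Fin.suc (∈-elements x∈))
  ∈-elements {p = outside ∷ p} (Vec.there x∈) = ∈-map⁺ Fin.suc (∈-elements x∈)

  -- The map `g` names the sources. It is there for the induction on m, which shifts them by
  -- `Fin.suc`.
  pairsOver : ∀ {m n} {A : Set} → (Fin m → A) → (Fin m → Subset n) → List (A × Fin n)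
  pairsOver {zero}  g H = []
  pairsOver {suc m} g H = map (g Fin.zero ,_) (elements (H Fin.zero)) ++ pairsOver (g ∘ Fin.suc) (H ∘ Fin.suc)

  length-pairsOver : ∀ {m n} {A : Set} (g : Fin m → A) (H : Fin m → Subset n) →
                     length (pairsOver g H) ≡ sum (tabulate λ u → ∣ H u ∣)
  length-pairsOver {zero}  g H = refl
  length-pairsOver {suc m} g H = trans (length-++ (map (g Fin.zero ,_) (elements (H Fin.zero))))
    (cong₂ _+_ (trans (length-map _ (elements (H Fin.zero))) (length-elements (H Fin.zero)))
               (length-pairsOver (g ∘ Fin.suc) (H ∘ Fin.suc)))

  ∈-pairsOver : ∀ {m n} {A : Set} (g : Fin m → A) (H : Fin m → Subset n) {u v} →
                v Subset.∈ H u → (g u , v) ∈ pairsOver g H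
  ∈-pairsOver g H {Fin.zero}  v∈ = ∈-++⁺ˡ (∈-map⁺ (g Fin.zero ,_) (∈-elements v∈))
  ∈-pairsOver g H {Fin.suc u} v∈ = ∈-++⁺ʳ _ (∈-pairsOver (g ∘ Fin.suc) (H ∘ Fin.suc) v∈)

  toPairs : ∀ {n} → PairSet n → List (Fin n × Fin n)
  toPairs = pairsOver (λ u → u)

  infix 4 _⊆ᴸ_

  _⊆ᴸ_ : ∀ {A : Set} → List A → List A → Set
  xs ⊆ᴸ ys = ∀ {x} → x ∈ xs → x ∈ ys

  -- Each x brings a list of its own; as Q survives enlargement of the list, their concatenation
  -- serves all x. It is used for stored edges and for new demands alike.
  collect : ∀ {A E : Set} {Q : A → List E → Set} (xs : List A) c →
            (∀ {x es es′} → es ⊆ᴸ es′ → Q x es → Q x es′) →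
            (∀ {x} → x ∈ xs → ∃ λ es → length es ≤ c × Q x es) →
            ∃ λ es → length es ≤ length xs * c × (∀ {x} → x ∈ xs → Q x es)
  collect []       c mono choose = [] , z≤n , λ ()
  collect {Q = Q} (x ∷ xs) c mono choose =
    let es , le , q = choose (here refl)
        es′ , le′ , q′ = collect {Q = Q} xs c mono (choose ∘ there)
    in es ++ es′ , subst (_≤ c + length xs * c) (sym (length-++ es)) (+-mono-≤ le le′) , all q q′
    where
      all : ∀ {es es′} → Q x es → (∀ {y} → y ∈ xs → Q y es′) → ∀ {y} → y ∈ x ∷ xs → Q y (es ++ es′)
      all q q′ (here refl) = mono ∈-++⁺ˡ q
      all {es} q q′ (there y∈) = mono (∈-++⁺ʳ es) (q′ y∈)

-- Chopping a path at a hitting set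

module Chopping where

  open import Data.Nat
  open import Data.Nat.Properties
  open import Data.List using (take; drop)
  open import Data.List.Properties using (length-take; length-drop)
  import Data.List.Relation.Unary.Unique.Propositional.Properties as Unique
  open import Defs using (Arcs; Walk; nil; cons)
  open Walks
  open HittingSets using (Blocks)

  chunks : ∀ {A : Set} → ℕ → ℕ → List A → List (List A)
  chunks h zero    xs = []
  chunks h (suc f) xs = take h xs ∷ chunks h f (drop h xs)

  length-chunks : ∀ {A : Set} h f (xs : List A) → length (chunks h f xs) ≡ f
  length-chunks h zero    xs = refl
  length-chunks h (suc f) xs = cong suc (length-chunks h f (drop h xs))

  chunks-blocks : ∀ {n} h f {xs : List (Fin n)} → Unique xs → f * h ≤ length xs → Blocks h (chunks h f xs)
  chunks-blocks h zero    un le = []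
  chunks-blocks h (suc f) {xs} un le =
    (Unique.take⁺ h un , trans (length-take h xs) (m≤n⇒m⊓n≡m (m+n≤o⇒m≤o h le))) ∷
    chunks-blocks h f (Unique.drop⁺ h un)
      (subst (f * h ≤_) (sym (length-drop h xs)) (m+n≤o⇒m≤o∸n (f * h)
          (subst (_≤ length xs) (+-comm h (f * h)) le)))

  -- This is f h + r, associated so that `span h (suc f) r` computes to `h + span h f r`, the form
  -- in which `splitWalk` cuts off a block.
  span : ℕ → ℕ → ℕ → ℕ
  span h zero    r = r
  span h (suc f) r = h + span h f r

  span≡ : ∀ h f r → span h f r ≡ f * h + r
  span≡ h zero    r = refl
  span≡ h (suc f) r = trans (cong (h +_) (span≡ h f r)) (sym (+-assoc h (f * h) r))

  module _ {n s : ℕ} (A : Arcs n) (S : Fin s → Fin n) (h : ℕ) where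

    Segment : Arcs s
    Segment i j ℓ = ∃ λ k → k ≤ h + h × Walk A (S i) (S j) k ℓ

    -- Every block is cut at one of its hits. The first hit comes within h arcs, hits in adjacent
    -- blocks are at most 2h arcs apart, and behind the last hit there are the rest of its block and
    -- the remainder of at most h arcs.
    record Chopped (u v : Fin n) (l : ℕ) (ℓ : ℚ) : Set where
      field
        {i j}         : Fin s
        {k₁ k₃ m}     : ℕ
        {ℓ₁ ℓ₂ ℓ₃}    : ℚ
        first         : Walk A u (S i) k₁ ℓ₁
        k₁≤h          : k₁ ≤ h
        middle        : Walk Segment i j m ℓ₂
        m≤l           : m ≤ l
        last          : Walk A (S j) v k₃ ℓ₃
        k₃≤2h         : k₃ ≤ h + h
        total         : ℓ₁ ℚ.+ ℓ₂ ℚ.+ ℓ₃ ≡ ℓ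

    chop : ∀ f {r u v ℓ} → r ≤ h → (W : Walk A u v (span h (suc f) r) ℓ) →
           (∀ {B} → B ∈ chunks h (suc f) (starts W) → ∃ λ i → S i ∈ B) → Chopped u v f ℓ
    chop f {r} {u} {v} {ℓ} r≤h W hit =
      let x , ℓ₁ , ℓ₂ , W₁ , W₂ , ℓ≡ , starts₁ , starts₂ = splitWalk h W
          i , Si∈ = hit (here refl)
          a , b , ℓa , ℓb , Wa , Wb , a+b≡h , ℓab≡ = splitAtVertex W₁ (subst (S i ∈_) (sym starts₁) Si∈)
      in continue f i Wa Wb a+b≡h W₂ (trans (cong (ℚ._+ ℓ₂) ℓab≡) ℓ≡)
           (λ B∈ → hit (there (subst (λ xs → _ ∈ chunks h f xs) starts₂ B∈)))
      where
        continue : ∀ f i {a b x ℓa ℓb ℓ₂} → Walk A u (S i) a ℓa → Walk A (S i) x b ℓb → a + b ≡ h →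
                   (W₂ : Walk A x v (span h f r) ℓ₂) → ℓa ℚ.+ ℓb ℚ.+ ℓ₂ ≡ ℓ →
                   (∀ {B} → B ∈ chunks h f (starts W₂) → ∃ λ i → S i ∈ B) → Chopped u v f ℓ
        continue zero i {a} {b} {ℓa = ℓa} {ℓb} {ℓ₂} Wa Wb a+b≡h W₂ ℓ≡ hit = record
          { first = Wa ; k₁≤h = subst (a ≤_) a+b≡h (m≤m+n a b)
          ; middle = nil ; m≤l = z≤n
          ; last = Wb ++ʷ W₂ ; k₃≤2h = +-mono-≤ (subst (b ≤_) a+b≡h (m≤n+m b a)) r≤h
          ; total = trans (solve 3 (λ a b c → a :+ con 0ℚ :+ (b :+ c) := a :+ b :+ c) refl ℓa ℓb ℓ₂) ℓ≡
          }
          where open +-*-Solver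
        continue (suc f) i {a} {b} {ℓa = ℓa} {ℓb} {ℓ₂} Wa Wb a+b≡h W₂ ℓ≡ hit = record
          { first = Wa ; k₁≤h = subst (a ≤_) a+b≡h (m≤m+n a b)
          -- The rest of this block, followed by the initial piece of what remains, leads from this
          -- hit to the next one.
          ; middle = cons (_ , +-mono-≤ (subst (b ≤_) a+b≡h (m≤n+m b a)) C.k₁≤h , Wb ++ʷ C.first) C.middle
          ; m≤l = s≤s C.m≤l
          ; last = C.last ; k₃≤2h = C.k₃≤2h
          ; total = trans (solve 5 (λ a b c d e → a :+ (b :+ c :+ d) :+ e := a :+ b :+ (c :+ d :+ e)) refl ℓa
              ℓb C.ℓ₁ C.ℓ₂ C.ℓ₃)
                          (trans (cong (λ z → ℓa ℚ.+ ℓb ℚ.+ z) C.total) ℓ≡)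
          }
          where
            open +-*-Solver
            module C = Chopped (chop f r≤h W₂ hit)

-- The rescaled graph on the sample, and its hopset

module ScaledGraphs where

  open import Data.Bool using (Bool; true; false)
  open import Data.Rational using (_+_; _*_; _≤_; _<_; _⊔_)
  open import Data.Vec using (tabulate)
  open import Data.Vec.Properties using ([]=⇒lookup; lookup⇒[]=; lookup∘tabulate)
  open import Relation.Nullary.Decidable using (dec-true)
  open import Relation.Nullary.Construct.Add.Supremum using (_⁺; [_]; ⊤⁺)
  import Relation.Binary.Construct.Add.Supremum.NonStrict as AddSup
  open import Defs using
    ( Digraph; edges; weight; arcs; Walk; nil; cons; Dist; HopDist; PolyBounded; PairSet; ℕtoℚ; IsHopset;
      fromℚ; fromℕ; _≤[_]·_; _∪ʰ_ )
  open Rationals using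
    ( mulˡ-≤; mulʳ-≤; *-nonneg; +-nonneg; ≤-by; 0≤1; _÷_; ÷-≤; ÷-pos; ÷-cancel; ℕtoℚ-≤; ℕtoℚ-nonneg; ℕtoℚ-+ )
  open Enclosures
  open Walks
  open Pairs using (_⊆ᴸ_)
  open Chopping
  open +-*-Solver

  -- Quantifying over all walks instead of comparing distances makes unreachable pairs harmless, and
  -- lets the condition be applied to a walk that is not known to be shortest.
  Stretch : ∀ {n} → Digraph n → ℚ → List (Fin n × Fin n) → Fin n → Fin n → Set
  Stretch G t es u v = ∀ k ℓ → Walk (arcs G) u v k ℓ →
    ∃₂ λ k′ ℓ′ → Walk (arcsIn G es) u v k′ ℓ′ × ℓ′ ≤ t * ℓ

  widen : ∀ {n} {G : Digraph n} {u v k ℓ es es′} → es ⊆ᴸ es′ → Walk (arcsIn G es) u v k ℓ →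
      Walk (arcsIn G es′) u v k ℓ
  widen es⊆ = mapWalk λ (a , e∈) → a , es⊆ e∈

  hopsetStretch : ∀ {t η d d′} → t ∈[ η , η ] → 0ℚ ≤ η → 0ℚ ≤ d → [ d′ ] ≤[ t ]· [ d ] → d′ ≤ η * d
  hopsetStretch {d = d} {d′} I 0≤η 0≤d AddSup.[ le ] =
    ∈-≤⁻¹ (∈-fromℚ d′) (∈-* 0≤η 0≤d I (∈-fromℚ d)) le

  module Scaled {n s : ℕ} (G : Digraph n) (G≥0 : NonNegArcs (arcs G)) (S : Fin s → Fin n) (h m : ℕ)
    .{{_ : NonZero s}} .{{_ : NonZero m}} (m≤s : m ℕ.≤ s)
    (D I : ℚ) (0<D : 0ℚ < D) (0<I : 0ℚ < I) (DI≡1 : D * I ≡ 1ℚ) where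

    private
      instance
        ms≢0 : NonZero (m ℕ.* s)
        ms≢0 = ℕ.m*n≢0 m s

    ε : ℚ
    ε = 1 ÷ (m ℕ.* s)

    0<ε : 0ℚ < ε
    0<ε = ÷-pos 1 (m ℕ.* s)

    near : ℚ ⁺ → Bool
    near [ d ] = does (d ℚ.≤? D)
    near ⊤⁺    = false

    scaled : ℚ ⁺ → ℚ
    scaled [ d ] = d * I ⊔ ε
    scaled ⊤⁺    = 0ℚ

    -- Distances up to D are rescaled to at most 1.  Rounding them up to ε makes the weights
    -- polynomially bounded in s alone, and costs a walk of s hops no more than 1/m.
    Gₛ : Digraph s
    Gₛ = record
      { edges  = λ i → tabulate λ j → near (proj₁ (hopDist G (h ℕ.+ h) (S i) (S j)))
      ; weight = λ i j → scaled (proj₁ (hopDist G (h ℕ.+ h) (S i) (S j)))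
      }

    edge⇒near : ∀ {i j} → j Subset.∈ edges Gₛ i → near (proj₁ (hopDist G (h ℕ.+ h) (S i) (S j))) ≡ true
    edge⇒near {i} {j} j∈ = trans (sym (lookup∘tabulate _ j)) ([]=⇒lookup j∈)

    near⇒edge : ∀ {i j} → near (proj₁ (hopDist G (h ℕ.+ h) (S i) (S j))) ≡ true → j Subset.∈ edges Gₛ i
    near⇒edge {i} {j} eq = lookup⇒[]= j _ (trans (lookup∘tabulate _ j) eq)

    near⇒≤ : ∀ {d} → near [ d ] ≡ true → d ≤ D
    near⇒≤ {d} = does-true (d ℚ.≤? D)
      where
        does-true : ∀ {P : Set} (P? : Dec P) → does P? ≡ true → P
        does-true (yes p) _ = p

    *I*D-cancel : ∀ d → d * I * D ≡ d
    *I*D-cancel d = trans (solve 3 (λ d i D → d :* i :* D := d :* (D :* i)) refl d I D)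
                       (trans (cong (d *_) DI≡1) (ℚ.*-identityʳ d))

    arc-segment : ∀ {i j w} → arcs Gₛ i j w → ∃ λ ℓ → Segment (arcs G) S h i j ℓ × ℓ ≤ D × w ≡ ℓ * I ⊔ ε
    arc-segment {i} {j} (j∈ , refl) = extract (hopDist G (h ℕ.+ h) (S i) (S j)) (edge⇒near j∈)
      where
        extract : (b : ∃ (HopDist (h ℕ.+ h) (arcs G) (S i) (S j))) → near (proj₁ b) ≡ true →
                  ∃ λ ℓ → Segment (arcs G) S h i j ℓ × ℓ ≤ D × scaled (proj₁ b) ≡ ℓ * I ⊔ ε
        extract ([ d ] , seg , _) eq = d , seg , near⇒≤ eq , refl

    scaled-bounds : ∀ {w ℓ} → 0ℚ ≤ ℓ → w ≡ ℓ * I ⊔ ε → ε ≤ w × ℓ ≤ w * D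
    scaled-bounds {ℓ = ℓ} 0≤ℓ refl = ℚ.p≤q⊔p (ℓ * I) ε ,
      subst (_≤ (ℓ * I ⊔ ε) * D) (*I*D-cancel ℓ) (mulʳ-≤ (ℚ.<⇒≤ 0<D) (ℚ.p≤p⊔q (ℓ * I) ε))

    segment-arc : ∀ {i j ℓ} → Segment (arcs G) S h i j ℓ → ℓ ≤ D → ∃ λ w → arcs Gₛ i j w × w ≤ ℓ * I + ε
    segment-arc {i} {j} {ℓ} seg@(k , k≤ , W) ℓ≤D = _ , (near⇒edge (proj₁ result) , refl) , proj₂ result
      where
        bound : ∀ b → 0ℚ ≤ b → b ≤ ℓ → b * I ⊔ ε ≤ ℓ * I + ε
        bound b 0≤b b≤ℓ = ℚ.⊔-lub
          (ℚ.≤-trans (mulʳ-≤ (ℚ.<⇒≤ 0<I) b≤ℓ) (≤-by ε (ℚ.<⇒≤ 0<ε) refl))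
          (≤-+ˡ {ℓ * I} (*-nonneg (ℚ.≤-trans 0≤b b≤ℓ) (ℚ.<⇒≤ 0<I)))
        extract : (b : ∃ (HopDist (h ℕ.+ h) (arcs G) (S i) (S j))) →
                  near (proj₁ b) ≡ true × scaled (proj₁ b) ≤ ℓ * I + ε
        extract (⊤⁺ , ¬W) = contradiction seg (¬W ℓ)
        extract ([ d ] , (_ , _ , W′) , min) =
          dec-true (d ℚ.≤? D) (ℚ.≤-trans (min ℓ seg) ℓ≤D) , bound d (walk-nonneg G≥0 W′) (min ℓ seg)
        result = extract (hopDist G (h ℕ.+ h) (S i) (S j))

    Gₛ≥0 : NonNegArcs (arcs Gₛ)
    Gₛ≥0 a = let ℓ , (_ , _ , W) , _ , w≡ = arc-segment a in
      ℚ.≤-trans (ℚ.<⇒≤ 0<ε) (proj₁ (scaled-bounds (walk-nonneg G≥0 W) w≡))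

    -- The weights lie between 1/(m s) and 1, and m s ≤ s². So the exponent is 2 for every sample
    -- and every scale, and the constants of the hopset algorithm do not change from level to level.
    Gₛ-bounded : PolyBounded 2 Gₛ
    Gₛ-bounded i j j∈ =
      let ℓ , (_ , _ , W) , ℓ≤D , w≡ = arc-segment (j∈ , refl)
          ε≤w = proj₁ (scaled-bounds (walk-nonneg G≥0 W) w≡)
      in ℚ.<-≤-trans 0<ε ε≤w
       , subst (_≤ ℕtoℚ (s ℕ.^ 2)) (sym w≡) (ℚ.≤-trans (ℚ.⊔-lub
           (ℚ.≤-trans (mulʳ-≤ (ℚ.<⇒≤ 0<I) ℓ≤D) (ℚ.≤-reflexive DI≡1)) ε≤1) 1≤s²)
       , ℚ.≤-trans 1≤s²ε (mulˡ-≤ (ℕtoℚ-nonneg (s ℕ.^ 2)) ε≤w)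
      where
        1≤s² : 1ℚ ≤ ℕtoℚ (s ℕ.^ 2)
        1≤s² = ℕtoℚ-≤ (ℕ.m^n>0 s 2)
        ε≤1 : ε ≤ 1ℚ
        ε≤1 = ÷-≤ {1} {1} {m ℕ.* s} {1} (ℕ.*-monoʳ-≤ 1 (>-nonZero⁻¹ (m ℕ.* s)))
        ms≤s² : m ℕ.* s ℕ.≤ s ℕ.^ 2
        ms≤s² = subst (m ℕ.* s ℕ.≤_) (cong (s ℕ.*_) (sym (ℕ.*-identityʳ s))) (ℕ.*-monoˡ-≤ s m≤s)
        1≤s²ε : 1ℚ ≤ ℕtoℚ (s ℕ.^ 2) * ε
        1≤s²ε = ℚ.≤-trans (ℚ.≤-reflexive (sym (÷-cancel 1 (m ℕ.* s)))) (mulʳ-≤ (ℚ.<⇒≤ 0<ε) (ℕtoℚ-≤ ms≤s²))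

    -- No segment is longer than the whole walk, so each is an arc at this scale; rounding up adds
    -- at most ε per hop.
    segments-walk : ∀ {i j k ℓ} → Walk (Segment (arcs G) S h) i j k ℓ → ℓ ≤ D →
                    ∃ λ ℓ′ → Walk (arcs Gₛ) i j k ℓ′ × ℓ′ ≤ ℓ * I + ℕtoℚ k * ε
    segments-walk nil _ = 0ℚ , nil , ℚ.≤-reflexive (solve 2 (λ i e →
        con 0ℚ := con 0ℚ :* i :+ con 0ℚ :* e) refl I ε)
    segments-walk (cons {w = ℓ₁} {k = k} {ℓ = ℓ₂} seg W) ℓ≤D =
      let w , a , w≤ = segment-arc seg (ℚ.≤-trans (≤-by ℓ₂ 0≤ℓ₂ refl) ℓ≤D)
          ℓ′ , W′ , ℓ′≤ = segments-walk W (ℚ.≤-trans (≤-+ˡ {ℓ₁} 0≤ℓ₁) ℓ≤D)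
      in w + ℓ′ , cons a W′ , ℚ.≤-trans (ℚ.+-mono-≤ w≤ ℓ′≤) (ℚ.≤-reflexive
           (trans (solve 5 (λ a b i e k → a :* i :+ e :+ (b :* i :+ k :* e) := (a :+ b) :* i :+
               (con 1ℚ :+ k) :* e) refl ℓ₁ ℓ₂ I ε (ℕtoℚ k))
                  (cong (λ z → (ℓ₁ + ℓ₂) * I + z * ε) (sym (ℕtoℚ-+ 1 k)))))
      where
        0≤ℓ₁ = walk-nonneg G≥0 (proj₂ (proj₂ seg))
        0≤ℓ₂ = walk-nonneg {A = Segment (arcs G) S h} (λ (_ , _ , W) → walk-nonneg G≥0 W) W

    arc-walk : ∀ {i j w} → arcs Gₛ i j w → ∃₂ λ k ℓ → k ℕ.≤ h ℕ.+ h × Walk (arcs G) (S i) (S j) k ℓ ×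
        ℓ ≤ w * D
    arc-walk a = let ℓ , (k , k≤ , W) , _ , w≡ = arc-segment a in
      k , ℓ , k≤ , W , proj₂ (scaled-bounds (walk-nonneg G≥0 W) w≡)

    walk-walk : ∀ {i j k ℓ} → Walk (arcs Gₛ) i j k ℓ → ∃₂ λ k′ ℓ′ → Walk (arcs G) (S i) (S j) k′ ℓ′ ×
        ℓ′ ≤ ℓ * D
    walk-walk nil = 0 , 0ℚ , nil , ℚ.≤-reflexive (sym (ℚ.*-zeroˡ D))
    walk-walk (cons {w = w} {ℓ = ℓ} a W) =
      let k₁ , ℓ₁ , _ , W₁ , ℓ₁≤ = arc-walk a
          k₂ , ℓ₂ , W₂ , ℓ₂≤ = walk-walk W
      in k₁ ℕ.+ k₂ , ℓ₁ + ℓ₂ , W₁ ++ʷ W₂ ,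
         ℚ.≤-trans (ℚ.+-mono-≤ ℓ₁≤ ℓ₂≤) (ℚ.≤-reflexive (sym (ℚ.*-distribʳ-+ D w ℓ)))

    module _ (H : PairSet s) (t : ℚ) (1≤t : 1ℚ ≤ t) where

      HopsetStretch : List (Fin n × Fin n) → Set
      HopsetStretch es = ∀ {i j} → j Subset.∈ H i → Stretch G t es (S i) (S j)

      -- Hops over arcs of Gₛ are expanded into stored edges, hops over H are left to the recursion.
      expand : ∀ {i j k ℓ} → Walk (Gₛ ∪ʰ H) i j k ℓ → ∃ λ es → length es ℕ.≤ k ℕ.* (h ℕ.+ h) ×
        (∀ {es′} → es ⊆ᴸ es′ → HopsetStretch es′ →
          ∃₂ λ k′ ℓ′ → Walk (arcsIn G es′) (S i) (S j) k′ ℓ′ × ℓ′ ≤ t * (ℓ * D))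
      expand nil = [] , z≤n , λ _ _ → 0 , 0ℚ , nil ,
        ℚ.≤-reflexive (solve 2 (λ t D → con 0ℚ := t :* (con 0ℚ :* D)) refl t D)
      expand (cons {u = i} {x = x} {v = j} {w = w} {k = k} {ℓ = ℓ} a W) =
        let es , es≤ , real = expand W in first a es es≤ real
        where
          0≤t = ℚ.≤-trans 0≤1 1≤t
          Goal : List (Fin n × Fin n) → Set
          Goal es = ∀ {es′} → es ⊆ᴸ es′ → HopsetStretch es′ →
            ∃₂ λ k′ ℓ′ → Walk (arcsIn G es′) (S i) (S j) k′ ℓ′ × ℓ′ ≤ t * ((w + ℓ) * D)
          Rest : List (Fin n × Fin n) → Set
          Rest es = ∀ {es′} → es ⊆ᴸ es′ → HopsetStretch es′ →
            ∃₂ λ k′ ℓ′ → Walk (arcsIn G es′) (S x) (S j) k′ ℓ′ × ℓ′ ≤ t * (ℓ * D)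
          combine : ∀ {ℓ₁ ℓ₂} → ℓ₁ ≤ t * (w * D) → ℓ₂ ≤ t * (ℓ * D) → ℓ₁ + ℓ₂ ≤ t * ((w + ℓ) * D)
          combine le₁ le₂ = ℚ.≤-trans (ℚ.+-mono-≤ le₁ le₂)
            (ℚ.≤-reflexive (solve 4 (λ t w l D → t :* (w :* D) :+ t :* (l :* D) := t :* ((w :+ l) :* D)) refl
                t w ℓ D))
          first : (Gₛ ∪ʰ H) i x w → ∀ es → length es ℕ.≤ k ℕ.* (h ℕ.+ h) → Rest es →
                  ∃ λ es → length es ℕ.≤ suc k ℕ.* (h ℕ.+ h) × Goal es
          first (inj₁ arc) es es≤ rest =
            let k₁ , ℓ₁ , k₁≤ , W₁ , ℓ₁≤ = arc-walk arc in
            edgesOf W₁ ++ es ,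
            subst (ℕ._≤ suc k ℕ.* (h ℕ.+ h)) (sym (length-++ (edgesOf W₁)))
              (ℕ.+-mono-≤ (subst (ℕ._≤ h ℕ.+ h) (sym (length-edgesOf W₁)) k₁≤) es≤) ,
            λ ⊆es′ hs → let k₂ , ℓ₂ , W₂ , ℓ₂≤ = rest (⊆es′ ∘ ∈-++⁺ʳ (edgesOf W₁)) hs in
              k₁ ℕ.+ k₂ , ℓ₁ + ℓ₂ , restrict W₁ (⊆es′ ∘ ∈-++⁺ˡ) ++ʷ W₂ ,
              combine (ℚ.≤-trans ℓ₁≤ (grow (ℚ.≤-trans (walk-nonneg G≥0 W₁) ℓ₁≤))) ℓ₂≤
            where
              grow : ∀ {y} → 0ℚ ≤ y → y ≤ t * y
              grow {y} 0≤y = subst (_≤ t * y) (ℚ.*-identityˡ y) (mulʳ-≤ 0≤y 1≤t)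
          -- The weight of a pair of H is the length of some walk of Gₛ. Carried over to G it may
          -- have many arcs, but only its length matters: the demand is stretched relative to it,
          -- and no edges are stored here.
          first (inj₂ (x∈ , (_ , Wₓ) , _)) es es≤ rest =
            es , ℕ.≤-trans es≤ (ℕ.m≤n+m (k ℕ.* (h ℕ.+ h)) (h ℕ.+ h)) ,
            λ ⊆es′ hs →
              let k₀ , ℓ₀ , W₀ , ℓ₀≤ = walk-walk Wₓ
                  k₁ , ℓ₁ , W₁ , ℓ₁≤ = hs x∈ k₀ ℓ₀ W₀
                  k₂ , ℓ₂ , W₂ , ℓ₂≤ = rest ⊆es′ hs
              in k₁ ℕ.+ k₂ , ℓ₁ + ℓ₂ , W₁ ++ʷ W₂ , combine (ℚ.≤-trans ℓ₁≤ (mulˡ-≤ 0≤t ℓ₀≤)) ℓ₂≤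

    hopset-walk : ∀ {β η H i j k ℓ} → 0ℚ ≤ η → IsHopset Gₛ β (fromℚ η) H → Walk (arcs Gₛ) i j k ℓ →
                  ∃₂ λ k′ ℓ′ → k′ ℕ.≤ β × Walk (Gₛ ∪ʰ H) i j k′ ℓ′ × ℓ′ ≤ (1ℚ + η) * ℓ
    hopset-walk {β} {η} {H} {i} {j} {k} {ℓ} 0≤η hop W = let d , d′ , D , D′ , _ , le = hop i j in extract d d′ D D′ le
      where
        0≤1+η = +-nonneg 0≤1 0≤η
        extract : ∀ d d′ → Dist (arcs Gₛ) i j d → HopDist β (Gₛ ∪ʰ H) i j d′ →
            d′ ≤[ fromℕ 1 Defs.+ fromℚ η ]· d →
                  ∃₂ λ k′ ℓ′ → k′ ℕ.≤ β × Walk (Gₛ ∪ʰ H) i j k′ ℓ′ × ℓ′ ≤ (1ℚ + η) * ℓ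
        extract ⊤⁺    _      ¬W _ _ = contradiction (k , W) (¬W ℓ)
        extract [ d ] [ d′ ] ((_ , Wd) , min) ((k′ , k′≤β , W′) , _) le = k′ , d′ , k′≤β , W′ ,
          ℚ.≤-trans (hopsetStretch (∈-+ (∈-fromℚ 1ℚ) (∈-fromℚ η)) 0≤1+η (walk-nonneg Gₛ≥0 Wd) le)
                    (mulˡ-≤ 0≤1+η (min ℓ (k , W)))

-- One level: serving demands through the sample

module Reduction where

  open import Data.Nat
  open import Data.Nat.Properties
  open import Data.Nat.DivMod
  open import Data.List using (map)
  import Data.List.Relation.Unary.All.Properties as All
  open import Defs using (Digraph; arcs; Walk; PolyBounded; PairSet; size; ℕtoℚ; IsHopset; fromℚ)
  open Rationals using (mulˡ-≤; mulʳ-≤; mul-≤; *-nonneg; +-nonneg; ≤-by; 0≤1; _÷_; ÷-≤; ÷-nonneg; ÷-*)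
  open Walks
  open HittingSets using (Blocks; hittingSet)
  open Pairs using (_⊆ᴸ_; collect; toPairs; length-pairsOver; ∈-pairsOver)
  open Chopping
  open ScaledGraphs

  module _ {n : ℕ} (G : Digraph n) (G≥0 : NonNegArcs (arcs G)) (h : ℕ) .{{_ : NonZero h}} where

    blocks : ∀ u v → (∀ k ℓ → ¬ Walk (arcs G) u v k ℓ) ⊎ ShortestPath G G≥0 u v → List (List (Fin n))
    blocks u v (inj₁ _)           = []
    blocks u v (inj₂ (_ , p , _)) = chunks h (Path.hops p / h) (starts (Path.walk p))

    blocksOf : Fin n × Fin n → List (List (Fin n))
    blocksOf (u , v) = blocks u v (shortestPath G G≥0 u v)

    -- A simple path has at most n arcs and therefore at most n blocks. The bound can be generous,
    -- as only the logarithm of the number of blocks enters the size of the sample.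
    allBlocks : ∀ P → ∃ λ Bs → length Bs ≤ length P * n × Blocks h Bs ×
                (∀ {e B} → e ∈ P → B ∈ blocksOf e → B ∈ Bs)
    allBlocks [] = [] , z≤n , [] , λ ()
    allBlocks (e@(u , v) ∷ P) =
      let Bs , le , bs , ⊆Bs = allBlocks P
          le′ , bs′ = props (shortestPath G G≥0 u v)
      in blocksOf e ++ Bs , subst (_≤ n + length P * n) (sym (length-++ (blocksOf e))) (+-mono-≤ le′ le) ,
         All.++⁺ bs′ bs ,
         λ { (here refl) B∈ → ∈-++⁺ˡ B∈ ; (there e∈) B∈ → ∈-++⁺ʳ (blocksOf e) (⊆Bs e∈ B∈) }
      where
        props : ∀ p → length (blocks u v p) ≤ n × Blocks h (blocks u v p)
        props (inj₁ _) = z≤n , []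
        props (inj₂ (_ , p , _)) =
          subst (_≤ n) (sym (length-chunks h (k / h) (starts W))) (≤-trans (m/n≤m k h) (hops≤n G≥0 p)) ,
          chunks-blocks h (k / h) (starts-unique W (Path.simple p))
            (subst (k / h * h ≤_) (sym (length-starts W)) (m/n*n≤m k h))
          where
            k = Path.hops p
            W = Path.walk p

  record Scale : Set where
    field
      D I  : ℚ
      0<D  : 0ℚ ℚ.< D
      0<I  : 0ℚ ℚ.< I
      DI≡1 : D ℚ.* I ≡ 1ℚ

  -- Rounding at a scale D costs up to D/m, so D must not exceed a constant multiple of the length.
  -- Walks without arcs have length 0 and fit no scale, hence `1 ≤ k`.
  Covers : ∀ {n} → Digraph n → List Scale → Set
  Covers {n} G scales = ∀ {u v k ℓ} → Walk (arcs G) u v k ℓ → 1 ≤ k → k ≤ n →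
    ∃ λ sc → sc ∈ scales × ℓ ℚ.≤ Scale.D sc × Scale.D sc ℚ.≤ ℓ ℚ.+ ℓ

  private
    -- The hopset contributes the factor 1 + η. Rounding adds κ D ≤ η · 2ℓ to the middle part, which
    -- is the factor 1 + 2η on the whole; t is the stretch of the new demands. The two end pieces
    -- are stored exactly.
    stretchBound : ∀ {t η D I κ ℓ₁ ℓ₂ ℓ₃ ℓ ℓmid ℓ″ ℓ′ : ℚ} → 1ℚ ℚ.≤ t → 0ℚ ℚ.≤ η → D ℚ.* I ≡ 1ℚ → 0ℚ ℚ.≤ D →
      0ℚ ℚ.≤ ℓ₁ → 0ℚ ℚ.≤ ℓ₃ → ℓ₁ ℚ.+ ℓ₂ ℚ.+ ℓ₃ ≡ ℓ → D ℚ.≤ ℓ ℚ.+ ℓ → κ ℚ.≤ η →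
      ℓ′ ℚ.≤ ℓ₂ ℚ.* I ℚ.+ κ → ℓ″ ℚ.≤ (1ℚ ℚ.+ η) ℚ.* ℓ′ → ℓmid ℚ.≤ t ℚ.* (ℓ″ ℚ.* D) →
      ℓ₁ ℚ.+ (ℓmid ℚ.+ ℓ₃) ℚ.≤ t ℚ.* ((1ℚ ℚ.+ η) ℚ.* (1ℚ ℚ.+ (η ℚ.+ η))) ℚ.* ℓ
    stretchBound {t} {η} {D} {I} {κ} {ℓ₁} {ℓ₂} {ℓ₃} {ℓ} {ℓmid} {ℓ″} {ℓ′} 1≤t 0≤η DI≡1 0≤D 0≤ℓ₁ 0≤ℓ₃ refl D≤2ℓ
        κ≤η le′ le″ lemid = begin
      ℓ₁ ℚ.+ (ℓmid ℚ.+ ℓ₃)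
        ≤⟨ ℚ.+-mono-≤ (grow 0≤ℓ₁) (ℚ.+-mono-≤ mid (grow 0≤ℓ₃)) ⟩
      t ℚ.* (e ℚ.* ℓ₁) ℚ.+ (t ℚ.* (e ℚ.* (ℓ₂ ℚ.+ η ℚ.* (ℓ ℚ.+ ℓ))) ℚ.+ t ℚ.* (e ℚ.* ℓ₃))
        ≡⟨ solve 6 (λ t e a b c η → t :* (e :* a) :+ (t :*
              (e :* (b :+ η :* (a :+ b :+ c :+ (a :+ b :+ c)))) :+ t :* (e :* c))
                     := t :* (e :* (con 1ℚ :+ (η :+ η))) :* (a :+ b :+ c)) refl t e ℓ₁ ℓ₂ ℓ₃ η ⟩
      t ℚ.* (e ℚ.* (1ℚ ℚ.+ (η ℚ.+ η))) ℚ.* ℓ ∎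
      where
        open ℚ.≤-Reasoning
        open +-*-Solver
        e = 1ℚ ℚ.+ η
        0≤t = ℚ.≤-trans 0≤1 1≤t
        0≤e : 0ℚ ℚ.≤ e
        0≤e = +-nonneg 0≤1 0≤η
        1≤e : 1ℚ ℚ.≤ e
        1≤e = ≤-by η 0≤η refl
        grow : ∀ {x} → 0ℚ ℚ.≤ x → x ℚ.≤ t ℚ.* (e ℚ.* x)
        grow {x} 0≤x = ℚ.≤-trans
          (subst (ℚ._≤ e ℚ.* x) (ℚ.*-identityˡ x) (mulʳ-≤ 0≤x 1≤e))
          (subst (ℚ._≤ t ℚ.* (e ℚ.* x)) (ℚ.*-identityˡ (e ℚ.* x)) (mulʳ-≤ (*-nonneg 0≤e 0≤x) 1≤t))
        unscale : (ℓ₂ ℚ.* I ℚ.+ κ) ℚ.* D ≡ ℓ₂ ℚ.+ κ ℚ.* D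
        unscale = trans (solve 4 (λ l i k d → (l :* i :+ k) :* d := l :* (d :* i) :+ k :* d) refl ℓ₂ I κ D)
          (cong (ℚ._+ κ ℚ.* D) (trans (cong (ℓ₂ ℚ.*_) DI≡1) (ℚ.*-identityʳ ℓ₂)))
        mid : ℓmid ℚ.≤ t ℚ.* (e ℚ.* (ℓ₂ ℚ.+ η ℚ.* (ℓ ℚ.+ ℓ)))
        mid = begin
          ℓmid                                      ≤⟨ lemid ⟩
          t ℚ.* (ℓ″ ℚ.* D)                          ≤⟨ mulˡ-≤ 0≤t (mulʳ-≤ 0≤D le″) ⟩
          t ℚ.* (e ℚ.* ℓ′ ℚ.* D)                    ≡⟨ cong (t ℚ.*_) (ℚ.*-assoc e ℓ′ D) ⟩
          t ℚ.* (e ℚ.* (ℓ′ ℚ.* D))                  ≤⟨ mulˡ-≤ 0≤t (mulˡ-≤ 0≤e (mulʳ-≤ 0≤D le′)) ⟩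
          t ℚ.* (e ℚ.* ((ℓ₂ ℚ.* I ℚ.+ κ) ℚ.* D))    ≡⟨ cong (λ z → t ℚ.* (e ℚ.* z)) unscale ⟩
          t ℚ.* (e ℚ.* (ℓ₂ ℚ.+ κ ℚ.* D))            ≤⟨ mulˡ-≤ 0≤t (mulˡ-≤ 0≤e (ℚ.+-monoʳ-≤ ℓ₂
                                                         (ℚ.≤-trans (mulʳ-≤ 0≤D κ≤η) (mulˡ-≤ 0≤η D≤2ℓ)))) ⟩
          t ℚ.* (e ℚ.* (ℓ₂ ℚ.+ η ℚ.* (ℓ ℚ.+ ℓ))) ∎

  module OneLevel {n s : ℕ} (G : Digraph n) (G≥0 : NonNegArcs (arcs G)) (S : Fin s → Fin n) (h m : ℕ)
    .{{_ : NonZero s}} .{{_ : NonZero m}} .{{_ : NonZero h}} (m≤s : m ≤ s) (n≤sh : n ≤ s * h)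
    (scales : List Scale) (covers : Covers G scales) (β : ℕ) where

    module At (sc : Scale) where
      open Scale sc
      open Scaled G G≥0 S h m m≤s D I 0<D 0<I DI≡1 public

    η : ℚ
    η = 1 ÷ m

    0≤η : 0ℚ ℚ.≤ η
    0≤η = ÷-nonneg 1 m

    loss : ℚ
    loss = (1ℚ ℚ.+ η) ℚ.* (1ℚ ℚ.+ (η ℚ.+ η))

    cost : ℕ
    cost = h + (β * (h + h) + (h + h))

    module _ (H : Scale → PairSet s) (isHopset : ∀ sc → IsHopset (At.Gₛ sc) β (fromℚ η) (H sc)) (t : ℚ)
        (1≤t : 1ℚ ℚ.≤ t) where

      NewDemands : List (Fin n × Fin n) → Set
      NewDemands es = ∀ {sc} → sc ∈ scales → ∀ {i j} → j Subset.∈ H sc i → Stretch G t es (S i) (S j)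

      -- The list `es` is fixed before the edges for the new demands are known, so the promise is
      -- made for every larger list in which those demands are met.
      Serves : Fin n × Fin n → List (Fin n × Fin n) → Set
      Serves (u , v) es = ∀ {es′} → es ⊆ᴸ es′ → NewDemands es′ → Stretch G (t ℚ.* loss) es′ u v

      private
        1≤loss : 1ℚ ℚ.≤ loss
        1≤loss = mul-≤ 0≤1 0≤1 (≤-by η 0≤η refl) (≤-by (η ℚ.+ η) (+-nonneg 0≤η 0≤η) refl)
        1≤tloss : 1ℚ ℚ.≤ t ℚ.* loss
        1≤tloss = mul-≤ 0≤1 0≤1 1≤t 1≤loss
        0≤tloss = ℚ.≤-trans 0≤1 1≤tloss

      serveSpan : ∀ f r {u v k ℓ} → k ≡ span h f r → r ≤ h → (W : Walk (arcs G) u v k ℓ) → k ≤ n →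
        (∀ k ℓ′ → Walk (arcs G) u v k ℓ′ → ℓ ℚ.≤ ℓ′) →
        (∀ {B} → B ∈ chunks h f (starts W) → ∃ λ i → S i ∈ B) → ∃ λ es → length es ≤ cost × Serves (u , v) es
      -- A path with no complete block has at most h arcs and is stored as it is.
      serveSpan zero r refl r≤h W _ shortest _ =
        edgesOf W , ≤-trans (≤-reflexive (length-edgesOf W)) (≤-trans r≤h (m≤m+n h _)) ,
        λ ⊆es′ _ k ℓ′ W′ → r , _ , restrict W ⊆es′ ,
          ℚ.≤-trans (shortest k ℓ′ W′) (subst (ℚ._≤ t ℚ.* loss ℚ.* ℓ′) (ℚ.*-identityˡ ℓ′)
              (mulʳ-≤ (walk-nonneg G≥0 W′) 1≤tloss))
      serveSpan (suc f) r {u} {v} {ℓ = ℓ} refl r≤h W k≤n shortest hit =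
        let sc , sc∈ , ℓ≤D , D≤2ℓ = covers W (≤-trans (>-nonZero⁻¹ h) (m≤m+n h (span h f r))) k≤n
        in viaScale sc sc∈ ℓ≤D D≤2ℓ
        where
          open Chopped (chop (arcs G) S h f r≤h W hit)
            using (i; j; k₁; k₃; ℓ₁; ℓ₂; ℓ₃; first; k₁≤h; middle; m≤l; last; k₃≤2h; total)
            renaming (m to b)
          0≤ℓ₁ = walk-nonneg G≥0 first
          0≤ℓ₃ = walk-nonneg G≥0 last
          -- From f h ≤ n ≤ s h: the path has too few arcs for more than s segments. Hence all
          -- roundings together cost at most s · 1/(m s) = 1/m.
          b≤s : b ≤ s
          b≤s = ≤-trans m≤l (*-cancelʳ-≤ f s h (begin
            f * h                    ≤⟨ m≤m+n (f * h) r ⟩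
            f * h + r              ≡⟨ span≡ h f r ⟨
            span h f r                 ≤⟨ m≤n+m (span h f r) h ⟩
            h + span h f r           ≤⟨ k≤n ⟩
            n                          ≤⟨ n≤sh ⟩
            s * h ∎))
            where open ≤-Reasoning
          bε≤η : ℕtoℚ b ℚ.* (1 ÷ (m * s)) {{m*n≢0 m s}} ℚ.≤ η
          bε≤η = subst (ℚ._≤ η) (sym (÷-* b 1 1 (m * s)))
            (÷-≤ {b * 1} {1} {1 * (m * s)} {m} (subst₂ _≤_ (sym (arrange b m)) (sym (arrange′ m s))
                (*-monoʳ-≤ m b≤s)))
            where
              instance
                _ = m*n≢0 m s
                _ = m*n≢0 1 (m * s)
              arrange : ∀ b m → b * 1 * m ≡ m * b
              arrange = solve-∀
              arrange′ : ∀ m s → 1 * (1 * (m * s)) ≡ m * s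
              arrange′ = solve-∀
          viaScale : ∀ sc → sc ∈ scales → ℓ ℚ.≤ Scale.D sc → Scale.D sc ℚ.≤ ℓ ℚ.+ ℓ →
                     ∃ λ es → length es ≤ cost × Serves (u , v) es
          viaScale sc sc∈ ℓ≤D D≤2ℓ =
            let ℓ₂≤ℓ = ℚ.≤-trans (≤-+ˡ {ℓ₁} 0≤ℓ₁) (ℚ.≤-trans (≤-by ℓ₃ 0≤ℓ₃ refl) (ℚ.≤-reflexive total))
                ℓ′ , W′ , ℓ′≤ = At.segments-walk sc middle (ℚ.≤-trans ℓ₂≤ℓ ℓ≤D)
                k″ , ℓ″ , k″≤β , W″ , ℓ″≤ = At.hopset-walk sc 0≤η (isHopset sc) W′
                es , es≤ , real = At.expand sc (H sc) t 1≤t W″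
            in edgesOf first ++ (es ++ edgesOf last) ,
               subst (_≤ cost) (sym (lengths es))
                 (+-mono-≤ k₁≤h (+-mono-≤ (≤-trans es≤ (*-monoˡ-≤ (h + h) k″≤β)) k₃≤2h)) ,
               λ ⊆es′ new k ℓ‴ W‴ →
                 let k₂ , ℓmid , Wmid , ℓmid≤ = real (⊆es′ ∘ ∈-++⁺ʳ (edgesOf first) ∘ ∈-++⁺ˡ) (new sc∈)
                 in _ , _ ,
                    restrict first (⊆es′ ∘ ∈-++⁺ˡ) ++ʷ (Wmid ++ʷ
                      restrict last (⊆es′ ∘ ∈-++⁺ʳ (edgesOf first) ∘ ∈-++⁺ʳ es)) ,
                    ℚ.≤-trans (stretchBound 1≤t 0≤η (Scale.DI≡1 sc) (ℚ.<⇒≤ (Scale.0<D sc)) 0≤ℓ₁ 0≤ℓ₃ total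
                        D≤2ℓ bε≤η ℓ′≤ ℓ″≤ ℓmid≤)
                              (mulˡ-≤ 0≤tloss (shortest k ℓ‴ W‴))
            where
              lengths : ∀ es → length (edgesOf first ++ (es ++ edgesOf last)) ≡ k₁ + (length es + k₃)
              lengths es = trans (length-++ (edgesOf first))
                (cong₂ _+_ (length-edgesOf first) (trans (length-++ es)
                    (cong (length es +_) (length-edgesOf last))))

      serve : ∀ e → (∀ {B} → B ∈ blocksOf G G≥0 h e → ∃ λ i → S i ∈ B) → ∃ λ es → length es ≤ cost ×
          Serves e es
      serve (u , v) = cases (shortestPath G G≥0 u v)
        where
          cases : ∀ p → (∀ {B} → B ∈ blocks G G≥0 h u v p → ∃ λ i → S i ∈ B) →
                  ∃ λ es → length es ≤ cost × Serves (u , v) es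
          cases (inj₁ ¬W) _ = [] , z≤n , λ _ _ k ℓ W → contradiction W (¬W k ℓ)
          cases (inj₂ (d , path {k} W len≤d un , min)) hit =
            serveSpan (k / h) (k % h)
              (trans (m≡m%n+[m/n]*n k h) (trans (+-comm (k % h) (k / h * h)) (sym (span≡ h (k / h) (k % h)))))
              (<⇒≤ (m%n<n k h)) W (hops≤n G≥0 (path W len≤d un)) (λ k ℓ′ W′ →
                  ℚ.≤-trans len≤d (min k ℓ′ W′)) hit

      serveAll : ∀ P → (∀ {e B} → e ∈ P → B ∈ blocksOf G G≥0 h e → ∃ λ i → S i ∈ B) →
        ∃ λ es → length es ≤ length P * cost × (∀ {e} → e ∈ P → Serves e es)
      serveAll P hit = collect {Q = Serves} P cost (λ ⊆es q ⊆es′ → q (⊆es′ ∘ ⊆es)) (λ {e} e∈ →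
          serve e (hit e∈))

  -- The order of quantifiers matters: the new demands `P′` depend on the sample and the hopsets
  -- alone, whereas t is the stretch that the recursion achieves for them afterwards. One hopset per
  -- scale accounts for the factor `length scales`.
  reduceDemands : ∀ {n} .{{_ : NonZero n}} (G : Digraph n) (G≥0 : NonNegArcs (arcs G)) (scales : List Scale) →
      Covers G scales →
    ∀ {s h m} q λ′ .{{_ : NonZero s}} .{{_ : NonZero m}} .{{_ : NonZero h}} β R →
    m ≤ s → n ≤ q * h → .{{_ : NonZero λ′}} → q * λ′ ≤ s →
    (∀ (Γ : Digraph s) → PolyBounded 2 Γ → ∃ λ H → IsHopset Γ β (fromℚ (1 ÷ m)) H × size H ≤ R) →
    ∀ P → length P * n < 2 ^ λ′ →
    ∃ λ P′ → length P′ ≤ length scales * R ×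
      (∀ t → 1ℚ ℚ.≤ t → ∃ λ es → length es ≤ length P * (h + (β * (h + h) + (h + h))) ×
        (∀ {es′} → es ⊆ᴸ es′ → (∀ {u v} → (u , v) ∈ P′ → Stretch G t es′ u v) →
          ∀ {u v} → (u , v) ∈ P → Stretch G (t ℚ.* ((1ℚ ℚ.+ 1 ÷ m) ℚ.* (1ℚ ℚ.+ (1 ÷ m ℚ.+ 1 ÷ m)))) es′ u v))
  reduceDemands {n} G G≥0 scales covers {s} {h} {m} q λ′ β R m≤s n≤qh qλ≤s hopset P |P|n<2^λ =
    let P′ , P′≤ , new = collect {Q = λ sc ps → ∀ {i j} → j Subset.∈ H sc i →
          (S i , S j) ∈ ps} scales R (λ ⊆ q j∈ → ⊆ (q j∈)) pairs
    in P′ , P′≤ , λ t 1≤t →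
       let es , es≤ , serves = serveAll H isHopset t 1≤t P (λ e∈ B∈ → proj₂ S-hits (⊆Bs e∈ B∈))
       in es , es≤ , λ ⊆es′ good e∈ → serves e∈ ⊆es′ (λ sc∈ j∈ → good (new sc∈ j∈))
    where
      Bs = proj₁ (allBlocks G G≥0 h P)
      ⊆Bs = proj₂ (proj₂ (proj₂ (allBlocks G G≥0 h P)))
      S-hits = hittingSet q λ′ s Bs (proj₁ (proj₂ (proj₂ (allBlocks G G≥0 h P)))) n≤qh qλ≤s
        (≤-<-trans (proj₁ (proj₂ (allBlocks G G≥0 h P))) |P|n<2^λ)
      S = proj₁ S-hits
      open OneLevel G G≥0 S h m m≤s
        (≤-trans n≤qh (*-monoˡ-≤ h (≤-trans (m≤m*n q λ′) qλ≤s))) scales covers β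
      H : Scale → PairSet s
      H sc = proj₁ (hopset (At.Gₛ sc) (At.Gₛ-bounded sc))
      isHopset : ∀ sc → IsHopset (At.Gₛ sc) β (fromℚ η) (H sc)
      isHopset sc = proj₁ (proj₂ (hopset (At.Gₛ sc) (At.Gₛ-bounded sc)))
      pairs : ∀ {sc} → sc ∈ scales →
              ∃ λ ps → length ps ≤ R × (∀ {i j} → j Subset.∈ H sc i → (S i , S j) ∈ ps)
      pairs {sc} _ = map (λ (i , j) → S i , S j) (toPairs (H sc)) ,
        ≤-trans (≤-reflexive (trans (length-map _ (toPairs (H sc))) (length-pairsOver (λ u → u) (H sc))))
                  (proj₂ (proj₂ (hopset (At.Gₛ sc) (At.Gₛ-bounded sc)))) ,
        λ j∈ → ∈-map⁺ (λ (i , j) → S i , S j) (∈-pairsOver (λ u → u) (H sc) j∈)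

-- Dyadic distance scales

module Scales where

  open import Data.Nat
  open import Data.Nat.Properties
  open import Defs using (Digraph; arcs; Walk; nil; cons; PolyBounded; ℕtoℚ)
  open Rationals using (mulˡ-≤; ≤-by; _÷_; ÷-≤; ÷-pos; ÷-nonneg; ÷-+; ÷-*; ÷-≡; ÷-cancel; ℕtoℚ-+)
  open Walks
  open Reduction using (Scale; Covers)

  module _ {n : ℕ} (G : Digraph n) (c : ℕ) (bounded : PolyBounded c G) .{{_ : NonZero n}} where

    private
      K : ℕ
      K = n ^ c
      instance
        K≢0 : NonZero K
        K≢0 = m^n≢0 n c

    arcs≥0 : NonNegArcs (arcs G)
    arcs≥0 (v∈ , refl) = ℚ.<⇒≤ (proj₁ (bounded _ _ v∈))

    walk-upper : ∀ {u v k ℓ} → Walk (arcs G) u v k ℓ → ℓ ℚ.≤ ℕtoℚ (k * K)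
    walk-upper nil = ℚ.≤-refl
    walk-upper {k = suc k} (cons (v∈ , refl) W) = subst (_ ℚ.≤_) (sym (ℕtoℚ-+ K (k * K)))
      (ℚ.+-mono-≤ (proj₁ (proj₂ (bounded _ _ v∈))) (walk-upper W))

    walk-lower : ∀ {u v k ℓ} → Walk (arcs G) u v (suc k) ℓ → 1 ÷ K ℚ.≤ ℓ
    walk-lower (cons {ℓ = ℓ} (v∈ , refl) W) = ℚ.≤-trans (recip≤ (proj₂ (proj₂ (bounded _ _ v∈))))
        (≤-by ℓ (walk-nonneg arcs≥0 W) refl)
      where
        recip≤ : ∀ {w} → 1ℚ ℚ.≤ ℕtoℚ K ℚ.* w → 1 ÷ K ℚ.≤ w
        recip≤ {w} le = ℚ.≤-trans (ℚ.≤-reflexive (sym (ℚ.*-identityʳ (1 ÷ K))))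
            (ℚ.≤-trans (mulˡ-≤ (÷-nonneg 1 K) le)
          (ℚ.≤-reflexive (trans (solve 3 (λ i k w → i :* (k :* w) := k :* i :* w) refl (1 ÷ K) (ℕtoℚ K) w)
            (trans (cong (ℚ._* w) (÷-cancel 1 K)) (ℚ.*-identityˡ w)))))
          where open +-*-Solver

    scale : ℕ → Scale
    scale j = record
      { D = (2 ^ j) ÷ K
      ; I = K ÷ (2 ^ j)
      ; 0<D = ÷-pos (2 ^ j) K
      ; 0<I = ÷-pos K (2 ^ j)
      ; DI≡1 = trans (÷-* (2 ^ j) K K (2 ^ j))
          (÷-≡ {2 ^ j * K} {1} {K * 2 ^ j} {1} (trans (*-identityʳ _)
              (trans (*-comm (2 ^ j) K) (sym (*-identityˡ _)))))
      }
      where instance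
        _ = m^n≢0 2 j
        _ = m*n≢0 K (2 ^ j)

    scalesUpTo : ℕ → List Scale
    scalesUpTo zero    = scale 0 ∷ []
    scalesUpTo (suc j) = scale (suc j) ∷ scalesUpTo j

    length-scalesUpTo : ∀ j → length (scalesUpTo j) ≡ suc j
    length-scalesUpTo zero    = refl
    length-scalesUpTo (suc j) = cong suc (length-scalesUpTo j)

    findScale : ∀ j {ℓ} → 1 ÷ K ℚ.≤ ℓ → ℓ ℚ.≤ Scale.D (scale j) →
                ∃ λ sc → sc ∈ scalesUpTo j × ℓ ℚ.≤ Scale.D sc × Scale.D sc ℚ.≤ ℓ ℚ.+ ℓ
    findScale zero {ℓ} 1/K≤ℓ ℓ≤D = scale 0 , here refl , ℓ≤D ,
      ℚ.≤-trans 1/K≤ℓ (≤-by ℓ (ℚ.≤-trans (÷-nonneg 1 K) 1/K≤ℓ) refl)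
    findScale (suc j) {ℓ} 1/K≤ℓ ℓ≤D = cases (ℚ.≤-total ℓ (Scale.D (scale j)))
      where
        cases : ℓ ℚ.≤ Scale.D (scale j) ⊎ Scale.D (scale j) ℚ.≤ ℓ →
                ∃ λ sc → sc ∈ scalesUpTo (suc j) × ℓ ℚ.≤ Scale.D sc × Scale.D sc ℚ.≤ ℓ ℚ.+ ℓ
        cases (inj₁ ℓ≤D′) = let sc , sc∈ , ≤D , D≤ = findScale j 1/K≤ℓ ℓ≤D′ in sc , there sc∈ , ≤D , D≤
        cases (inj₂ D′≤ℓ) = scale (suc j) , here refl , ℓ≤D ,
          ℚ.≤-trans (ℚ.≤-reflexive (trans (cong (_÷ K) (cong (2 ^ j +_) (+-identityʳ (2 ^ j))))
              (sym (÷-+ (2 ^ j) (2 ^ j) K))))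
                    (ℚ.+-mono-≤ D′≤ℓ D′≤ℓ)

    -- With K = n^c, a walk of 1 to n arcs has a length between 1/K and n K. The scales 2^i/K start
    -- at the lower end, and n K² ≤ 2^j makes the last one reach the upper end.
    covers : ∀ j → n * K * K ≤ 2 ^ j → Covers G (scalesUpTo j)
    covers j nKK≤ {k = suc k} W _ k≤n = findScale j (walk-lower W) (ℚ.≤-trans (walk-upper W)
      (÷-≤ {suc k * K} {2 ^ j} {1} {K} (≤-trans (*-monoˡ-≤ K (*-monoˡ-≤ K k≤n))
        (≤-trans nKK≤ (≤-reflexive (sym (*-identityʳ (2 ^ j))))))))

-- Choosing the sample size and the hop bound

module Parameters where

  open import Data.Nat
  open import Data.Nat.Properties
  open import Data.Nat.DivMod

  m<suc[m/n]*n : ∀ m n .{{_ : NonZero n}} → m < suc (m / n) * n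
  m<suc[m/n]*n m n = subst (_< suc (m / n) * n) (sym (m≡m%n+[m/n]*n m n)) (+-monoˡ-< (m / n * n) (m%n<n m n))

  -- The search stops at the first failure. Monotonicity of P is not assumed: a success followed by
  -- a failure, or success up to the end, is all that the estimates use.
  lastTrue : ∀ {P : ℕ → Set} (P? : ∀ k → Dec (P k)) a d → P a →
             ∃ λ k → a ≤ k × k ≤ a + d × P k × (k ≡ a + d ⊎ (k < a + d × ¬ P (suc k)))
  lastTrue P? a zero    Pa = a , ≤-refl , m≤m+n a 0 , Pa , inj₁ (sym (+-identityʳ a))
  lastTrue {P} P? a (suc d) Pa with P? (suc a)
  ... | no ¬Psa = a , ≤-refl , m≤m+n a (suc d) , Pa , inj₂ (m<m+n a (s≤s z≤n) , ¬Psa)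
  ... | yes Psa = let k , a≤ , k≤ , Pk , end = lastTrue P? (suc a) d Psa in
                  k , ≤-trans (n≤1+n a) a≤ , subst (k ≤_) (sym (+-suc a d)) k≤ , Pk ,
                  subst (λ z → k ≡ z ⊎ (k < z × ¬ P (suc k))) (sym (+-suc a d)) end

  firstTrue : ∀ {P : ℕ → Set} (P? : ∀ k → Dec (P k)) b → P b →
              ∃ λ k → k ≤ b × P k × (k ≡ 0 ⊎ ∃ λ k′ → k ≡ suc k′ × ¬ P k′)
  firstTrue P? zero    Pb = 0 , ≤-refl , Pb , inj₁ refl
  firstTrue P? (suc b) Pb with P? b
  ... | no ¬Pb = suc b , ≤-refl , Pb , inj₂ (b , refl , ¬Pb)
  ... | yes Pb′ = let k , k≤ , Pk , end = firstTrue P? b Pb′ in k , m≤n⇒m≤1+n k≤ , Pk , end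

  -- ω/t and α/t approximate b and a from below, ω′/t and α′/t from above, and n ≈ 2 ^ N.
  -- Γ/t² is a lower bound of 2 − ab.

  module Exponents (t ω τ α₁ A N : ℕ) (t≡ω+τ : t ≡ ω + τ) (0<τ : 1 ≤ τ) (2N+2≤t : 2 * N + 2 ≤ t)
    (α′≤At : t + α₁ + 2 ≤ A * t) (gap : (t + α₁ + 2) * (ω + 2) ≤ t * t + t * ω) where

    α α′ ω′ Γ : ℕ
    α  = t + α₁
    α′ = α + 2
    ω′ = ω + 2
    Γ  = 2 * (t * t) ∸ α′ * ω′

    0<t : 1 ≤ t
    0<t = ≤-trans (s≤s z≤n) (≤-trans (m≤n+m 2 (2 * N)) 2N+2≤t)

    0<α : 1 ≤ α
    0<α = ≤-trans 0<t (m≤m+n t α₁)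

    instance
      t≢0 : NonZero t
      t≢0 = >-nonZero 0<t
      α≢0 : NonZero α
      α≢0 = >-nonZero 0<α
      α′≢0 : NonZero α′
      α′≢0 = >-nonZero (≤-trans 0<α (m≤m+n α 2))

    open ≤-Reasoning

    tτ+α′ω′≤2t² : t * τ + α′ * ω′ ≤ 2 * (t * t)
    tτ+α′ω′≤2t² = begin
      t * τ + α′ * ω′           ≤⟨ +-monoʳ-≤ (t * τ) gap ⟩
      t * τ + (t * t + t * ω)   ≡⟨ id₁ t ω τ ⟩
      t * t + t * (ω + τ)       ≡⟨ cong (λ z → t * t + t * z) t≡ω+τ ⟨
      t * t + t * t             ≡⟨ id₂ (t * t) ⟩
      2 * (t * t) ∎
      where
        id₁ : ∀ t ω τ → t * τ + (t * t + t * ω) ≡ t * t + t * (ω + τ)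
        id₁ = solve-∀
        id₂ : ∀ x → x + x ≡ 2 * x
        id₂ = solve-∀

    -- In rounded form this is 2 - ab ≥ 1 - b, the consequence of b < 1/(a - 1). It makes the
    -- truncated subtraction in `u` a true one.
    tτ≤Γ : t * τ ≤ Γ
    tτ≤Γ = m+n≤o⇒m≤o∸n (t * τ) tτ+α′ω′≤2t²

    Γ+α′ω′≡2t² : Γ + α′ * ω′ ≡ 2 * (t * t)
    Γ+α′ω′≡2t² = m∸n+n≡m (≤-trans (m≤n+m (α′ * ω′) (t * τ)) tτ+α′ω′≤2t²)

    instance
      Γ≢0 : NonZero Γ
      Γ≢0 = >-nonZero (≤-trans (*-mono-≤ 0<t 0<τ) tτ≤Γ)

    -- Integer parts of the exponents of n p^(1-1/k) and of n^(2/a) p^(1-1/a), when p ≈ 2 ^ w.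
    v₁ : ℕ
    v₁ = 2 * N * t / α′

    u v : ℕ → ℕ
    u w  = w * (Γ ∸ t * τ) / Γ
    v w  = v₁ + w * α₁ / α

    u-mono : ∀ {w w′} → w ≤ w′ → u w ≤ u w′
    u-mono w≤ = /-monoˡ-≤ Γ (*-monoˡ-≤ (Γ ∸ t * τ) w≤)

    v-mono : ∀ {w w′} → w ≤ w′ → v w ≤ v w′
    v-mono w≤ = +-monoʳ-≤ v₁ (/-monoˡ-≤ α (*-monoˡ-≤ α₁ w≤))

    -- With s = 2^σ and β = 2^x, the condition β ≤ s^b is guaranteed for x ≤ X σ, and 2^(Y x) is a
    -- lower bound of β^a.
    X Y : ℕ → ℕ
    X σ = ω * σ / t
    Y x = α * x / t

    Y*t≤ : ∀ x → Y x * t ≤ α * x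
    Y*t≤ x = m/n*n≤m (α * x) t

    X≤ : ∀ σ → X σ ≤ σ
    X≤ σ = ≤-trans (/-monoˡ-≤ t (*-monoˡ-≤ σ (subst (ω ≤_) (sym t≡ω+τ) (m≤m+n ω τ))))
                   (≤-reflexive (trans (cong (_/ t) (*-comm t σ)) (m*n/n≡m σ t)))

    -- This fixes the size of t: raising the numerator of an exponent by 2 changes the exponent of 2
    -- by at most 2x/t ≤ 1, a constant factor.
    2x≤t : ∀ {x} → x ≤ N → 2 * x ≤ t
    2x≤t x≤N = ≤-trans (*-monoʳ-≤ 2 x≤N) (≤-trans (m≤m+n (2 * N) 2) 2N+2≤t)

    -- Of the 2, one is the floor in Y and one is the passage from α to α′.
    Y-lower : ∀ {x} → x ≤ N → α′ * x ≤ t * (Y x + 2)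
    Y-lower {x} x≤N = begin
      (α + 2) * x           ≡⟨ *-distribʳ-+ x α 2 ⟩
      α * x + 2 * x         ≤⟨ +-mono-≤ (<⇒≤ (m<suc[m/n]*n (α * x) t)) (2x≤t x≤N) ⟩
      suc (Y x) * t + t     ≡⟨ id₁ (Y x) t ⟩
      t * (Y x + 2) ∎
      where
        id₁ : ∀ y t → suc y * t + t ≡ t * (y + 2)
        id₁ = solve-∀

    α′ω′-lower : ∀ {σ} → σ ≤ N → α′ * ω′ * σ ≤ t * t * (Y (X σ) + 2) + 2 * A * (t * t)
    α′ω′-lower {σ} σ≤N = begin
      α′ * ω′ * σ                        ≡⟨ *-assoc α′ ω′ σ ⟩
      α′ * (ω′ * σ)                      ≤⟨ *-monoʳ-≤ α′ ω′σ≤ ⟩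
      α′ * (t * (X σ + 2))               ≡⟨ id₁ α′ t (X σ) ⟩
      t * (α′ * X σ) + 2 * (α′ * t)      ≤⟨ +-mono-≤ (*-monoʳ-≤ t (Y-lower (≤-trans (X≤ σ) σ≤N)))
            (*-monoʳ-≤ 2 (*-monoˡ-≤ t α′≤At)) ⟩
      t * (t * (Y (X σ) + 2)) + 2 * (A * t * t) ≡⟨ id₂ t (Y (X σ)) A ⟩
      t * t * (Y (X σ) + 2) + 2 * A * (t * t) ∎
      where
        id₀ : ∀ y t → suc y * t + t ≡ t * (y + 2)
        id₀ = solve-∀
        ω′σ≤ : ω′ * σ ≤ t * (X σ + 2)
        ω′σ≤ = begin
          (ω + 2) * σ         ≡⟨ *-distribʳ-+ σ ω 2 ⟩
          ω * σ + 2 * σ       ≤⟨ +-mono-≤ (<⇒≤ (m<suc[m/n]*n (ω * σ) t)) (2x≤t σ≤N) ⟩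
          suc (X σ) * t + t   ≡⟨ id₀ (X σ) t ⟩
          t * (X σ + 2) ∎
        id₁ : ∀ a t x → a * (t * (x + 2)) ≡ t * (a * x) + 2 * (a * t)
        id₁ = solve-∀
        id₂ : ∀ t y A → t * (t * (y + 2)) + 2 * (A * t * t) ≡ t * t * (y + 2) + 2 * A * (t * t)
        id₂ = solve-∀

    -- The last hypothesis says that σ + 1 is too large, so π is at most about (2 - ab) σ. The cost
    -- exponent w + x - σ is at most w - (1 - b) σ because x ≤ b σ. Eliminating σ leaves w (1 - (1 -
    -- b)/(2 - ab)) = w (1 - 1/k).
    smallSample : ∀ {σ x} π θ → suc σ ≤ N → x ≤ X σ → π + Y (X (suc σ)) < 2 * suc σ →
                  suc (π + θ) + x ≤ σ + u (π + θ) + (4 + 2 * A + θ)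
    smallSample {σ} {x} π θ σ<N x≤ lt = begin
      suc (w + x)                            ≤⟨ s≤s (*-cancelˡ-≤ Γ step₅) ⟩
      suc (suc (u w) + (σ + 2 + 2 * A + θ))  ≡⟨ id₅ (u w) σ A θ ⟩
      σ + u w + (4 + 2 * A + θ) ∎
      where
        w = π + θ
        y = Y (X (suc σ))
        id₅ : ∀ u σ A θ → suc (suc u + (σ + 2 + 2 * A + θ)) ≡ σ + u + (4 + 2 * A + θ)
        id₅ = solve-∀
        step₁ : t * t * π ≤ Γ * suc σ + (1 + 2 * A) * (t * t)
        step₁ = +-cancelʳ-≤ (t * t * (y + 1)) (t * t * π) _ (begin
          t * t * π + t * t * (y + 1)                ≡⟨ id₁ (t * t) π y ⟩
          t * t * suc (π + y)                        ≤⟨ *-monoʳ-≤ (t * t) lt ⟩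
          t * t * (2 * suc σ)                        ≡⟨ id₂ (t * t) (suc σ) ⟩
          2 * (t * t) * suc σ                        ≡⟨ cong (_* suc σ) Γ+α′ω′≡2t² ⟨
          (Γ + α′ * ω′) * suc σ                      ≡⟨ *-distribʳ-+ (suc σ) Γ (α′ * ω′) ⟩
          Γ * suc σ + α′ * ω′ * suc σ                ≤⟨ +-monoʳ-≤ (Γ * suc σ) (α′ω′-lower σ<N) ⟩
          Γ * suc σ + (t * t * (y + 2) + 2 * A * (t * t)) ≡⟨ id₃ (Γ * suc σ) (t * t) y A ⟩
          Γ * suc σ + (1 + 2 * A) * (t * t) + t * t * (y + 1) ∎)
          where
            id₁ : ∀ q π y → q * π + q * (y + 1) ≡ q * suc (π + y)
            id₁ = solve-∀
            id₂ : ∀ q s → q * (2 * s) ≡ 2 * q * s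
            id₂ = solve-∀
            id₃ : ∀ g q y A → g + (q * (y + 2) + 2 * A * q) ≡ g + (1 + 2 * A) * q + q * (y + 1)
            id₃ = solve-∀
        step₂ : τ * σ + t * x ≤ t * σ
        step₂ = begin
          τ * σ + t * x        ≤⟨ +-monoʳ-≤ (τ * σ) (≤-trans (*-monoʳ-≤ t x≤)
                (≤-trans (≤-reflexive (*-comm t (X σ))) (m/n*n≤m (ω * σ) t))) ⟩
          τ * σ + ω * σ        ≡⟨ id₁ τ σ ω ⟩
          (ω + τ) * σ          ≡⟨ cong (_* σ) t≡ω+τ ⟨
          t * σ ∎
          where
            id₁ : ∀ τ σ ω → τ * σ + ω * σ ≡ (ω + τ) * σ
            id₁ = solve-∀
        τ≤t : τ ≤ t
        τ≤t = subst (τ ≤_) (sym t≡ω+τ) (m≤n+m τ ω)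
        -- This is τ times `step₁` plus Γ times `step₂`, divided by t; the multiples of σ combine to
        -- Γ σ.
        step₃ : t * τ * π + Γ * x ≤ Γ * suc σ + (1 + 2 * A) * (t * τ)
        step₃ = *-cancelˡ-≤ t (begin
          t * (t * τ * π + Γ * x)                            ≡⟨ id₁ t τ π Γ x ⟩
          τ * (t * t * π) + Γ * (t * x)                      ≤⟨ +-monoˡ-≤ (Γ * (t * x)) (*-monoʳ-≤ τ step₁) ⟩
          τ * (Γ * suc σ + (1 + 2 * A) * (t * t)) + Γ * (t * x) ≡⟨ id₂ t τ σ Γ x A ⟩
          Γ * (τ * σ + t * x + τ) + t * ((1 + 2 * A) * (t * τ))
            ≤⟨ +-monoˡ-≤ (t * ((1 + 2 * A) * (t * τ))) (*-monoʳ-≤ Γ (+-mono-≤ step₂ τ≤t)) ⟩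
          Γ * (t * σ + t) + t * ((1 + 2 * A) * (t * τ))      ≡⟨ id₃ Γ t σ ((1 + 2 * A) * (t * τ)) ⟩
          t * (Γ * suc σ + (1 + 2 * A) * (t * τ)) ∎)
          where
            id₁ : ∀ t τ π Γ x → t * (t * τ * π + Γ * x) ≡ τ * (t * t * π) + Γ * (t * x)
            id₁ = solve-∀
            id₂ : ∀ t τ σ Γ x A → τ * (Γ * suc σ + (1 + 2 * A) * (t * t)) + Γ * (t * x) ≡
                  Γ * (τ * σ + t * x + τ) + t * ((1 + 2 * A) * (t * τ))
            id₂ = solve-∀
            id₃ : ∀ Γ t σ k → Γ * (t * σ + t) + t * k ≡ t * (Γ * suc σ + k)
            id₃ = solve-∀
        step₄ : w * (t * τ) + Γ * x ≤ Γ * (σ + 2 + 2 * A + θ)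
        step₄ = begin
          (π + θ) * (t * τ) + Γ * x                          ≡⟨ id₁ π θ (t * τ) (Γ * x) ⟩
          (t * τ * π + Γ * x) + t * τ * θ                    ≤⟨ +-mono-≤ step₃ (*-monoˡ-≤ θ tτ≤Γ) ⟩
          Γ * suc σ + (1 + 2 * A) * (t * τ) + Γ * θ
            ≤⟨ +-monoˡ-≤ (Γ * θ) (+-monoʳ-≤ (Γ * suc σ) (*-monoʳ-≤ (1 + 2 * A) tτ≤Γ)) ⟩
          Γ * suc σ + (1 + 2 * A) * Γ + Γ * θ                ≡⟨ id₂ Γ σ A θ ⟩
          Γ * (σ + 2 + 2 * A + θ) ∎
          where
            id₁ : ∀ π θ q r → (π + θ) * q + r ≡ (q * π + r) + q * θ
            id₁ = solve-∀
            id₂ : ∀ Γ σ A θ → Γ * suc σ + (1 + 2 * A) * Γ + Γ * θ ≡ Γ * (σ + 2 + 2 * A + θ)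
            id₂ = solve-∀
        step₅ : Γ * (w + x) ≤ Γ * (suc (u w) + (σ + 2 + 2 * A + θ))
        step₅ = begin
          Γ * (w + x)                                         ≡⟨ cong (λ z → z * (w + x)) (m∸n+n≡m tτ≤Γ) ⟨
          (Γ ∸ t * τ + t * τ) * (w + x)                       ≡⟨ id₁ (Γ ∸ t * τ) (t * τ) w x ⟩
          w * (Γ ∸ t * τ) + (w * (t * τ) + (Γ ∸ t * τ + t * τ) * x)
            ≡⟨ cong (λ z → w * (Γ ∸ t * τ) + (w * (t * τ) + z * x)) (m∸n+n≡m tτ≤Γ) ⟩
          w * (Γ ∸ t * τ) + (w * (t * τ) + Γ * x)
            ≤⟨ +-mono-≤ (<⇒≤ (m<suc[m/n]*n (w * (Γ ∸ t * τ)) Γ)) step₄ ⟩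
          suc (u w) * Γ + Γ * (σ + 2 + 2 * A + θ)             ≡⟨ id₂ (suc (u w)) Γ (σ + 2 + 2 * A + θ) ⟩
          Γ * (suc (u w) + (σ + 2 + 2 * A + θ)) ∎
          where
            id₁ : ∀ g q w x → (g + q) * (w + x) ≡ w * g + (w * q + (g + q) * x)
            id₁ = solve-∀
            id₂ : ∀ u g r → u * g + g * r ≡ g * (u + r)
            id₂ = solve-∀

    -- Here the sample is as large as possible and x is at most about (2N - π)/a. So w + x is at
    -- most 2N/a + w (1 - 1/a) up to θ and constants, the exponent of n^(2/a) p^(1-1/a).
    fullSample : ∀ {x} π θ → x ≤ N → π + θ ≤ 2 * N + 1 → π + Y x ≤ 2 * N + 1 → π + θ + x ≤ v (π + θ) + (8 + θ)
    fullSample {x} π θ x≤N w≤ le = *-cancelˡ-≤ α′ (begin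
      α′ * (w + x)                                       ≡⟨ id₁ t α₁ π θ x ⟩
      t * π + α′ * x + t * θ + w * α₁ + 2 * w            ≤⟨ +-mono-≤
            (+-monoˡ-≤ (w * α₁) (+-mono-≤ (+-monoʳ-≤ (t * π) (Y-lower x≤N)) (*-monoˡ-≤ θ t≤α′))) 2w≤ ⟩
      t * π + t * (Y x + 2) + α′ * θ + w * α₁ + 2 * α′   ≡⟨ id₂ t π (Y x) (α′ * θ) (w * α₁) (2 * α′) ⟩
      t * (π + Y x) + 2 * t + (w * α₁ + α′ * θ + 2 * α′) ≤⟨ +-monoˡ-≤ _ (+-monoˡ-≤ (2 * t) (*-monoʳ-≤ t le)) ⟩
      t * (2 * N + 1) + 2 * t + (w * α₁ + α′ * θ + 2 * α′) ≡⟨ id₃ t N (w * α₁) (α′ * θ) α′ ⟩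
      2 * N * t + w * α₁ + (3 * t + α′ * θ + 2 * α′)     ≤⟨ +-mono-≤
            (+-mono-≤ (<⇒≤ (m<suc[m/n]*n (2 * N * t) α′)) v₂≤)
            (+-monoˡ-≤ (2 * α′) (+-monoˡ-≤ (α′ * θ) (*-monoʳ-≤ 3 t≤α′))) ⟩
      suc a₁ * α′ + suc a₂ * α′ + (3 * α′ + α′ * θ + 2 * α′) ≡⟨ id₄ a₁ a₂ α′ θ ⟩
      α′ * (a₁ + a₂ + (7 + θ))                           ≤⟨ *-monoʳ-≤ α′
            (+-monoʳ-≤ (a₁ + a₂) (+-monoˡ-≤ θ (n≤1+n 7))) ⟩
      α′ * (a₁ + a₂ + (8 + θ)) ∎)
      where
        w = π + θ
        a₁ = 2 * N * t / α′
        a₂ = w * α₁ / α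
        t≤α′ : t ≤ α′
        t≤α′ = ≤-trans (m≤m+n t α₁) (m≤m+n α 2)
        2w≤ : 2 * w ≤ 2 * α′
        2w≤ = *-monoʳ-≤ 2 (≤-trans w≤ (≤-trans (+-monoʳ-≤ (2 * N) (s≤s z≤n)) (≤-trans 2N+2≤t t≤α′)))
        v₂≤ : w * α₁ ≤ suc a₂ * α′
        v₂≤ = ≤-trans (<⇒≤ (m<suc[m/n]*n (w * α₁) α)) (*-monoʳ-≤ (suc a₂) (m≤m+n α 2))
        id₁ : ∀ t α₁ π θ x → (t + α₁ + 2) * (π + θ + x) ≡ t * π + (t + α₁ + 2) * x + t * θ + (π + θ) * α₁ +
            2 * (π + θ)
        id₁ = solve-∀
        id₂ : ∀ t π y a b c → t * π + t * (y + 2) + a + b + c ≡ t * (π + y) + 2 * t + (b + a + c)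
        id₂ = solve-∀
        id₃ : ∀ t N b a c → t * (2 * N + 1) + 2 * t + (b + a + 2 * c) ≡ 2 * N * t + b + (3 * t + a + 2 * c)
        id₃ = solve-∀
        id₄ : ∀ x y α θ → suc x * α + suc y * α + (3 * α + α * θ + 2 * α) ≡ α * (x + y + (7 + θ))
        id₄ = solve-∀

    -- The field `2σ≤` bounds s²/β^a by 2^π, which leaves 2^θ for hidden factors and scales; `θ≤σ`
    -- makes the sample larger than m and than the number of halvings. The alternatives of `cost`
    -- belong to the two summands of the target.
    record Choice (π θ : ℕ) : Set where
      field
        σ x   : ℕ
        θ≤σ   : θ ≤ σ
        σ≤N   : σ ≤ N
        x≤X   : x * t ≤ ω * σ
        2σ≤   : 2 * σ ≤ π + Y x
        cost  : suc (π + θ) + x ≤ σ + u (π + θ) + (10 + 2 * A + θ) ⊎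
                (σ ≡ N × suc (π + θ) + x ≤ v (π + θ) + (10 + 2 * A + θ))

    -- The sample is enlarged as long as the largest admissible β still leaves few demands, since
    -- cost falls with s. Then β is made as small as the condition on the demands allows.
    choose : ∀ π θ → 2 * θ ≤ π → π + θ ≤ 2 * N + 1 → Choice π θ
    choose π θ 2θ≤π w≤ =
      -- The search for σ starts at θ, where 2θ ≤ π makes the condition true whatever Y is.
      let σ , θ≤σ , σ≤ , Pσ , end = lastTrue (λ σ → 2 * σ ≤? π + Y (X σ)) θ (N ∸ θ) (≤-trans 2θ≤π (m≤m+n π _))
          x , x≤ , Qx , end′ = firstTrue (λ x → 2 * σ ≤? π + Y x) (X σ) Pσ
      in record
        { σ = σ ; x = x ; θ≤σ = θ≤σ ; σ≤N = subst (σ ≤_) θ+d≡N σ≤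
        ; x≤X = ≤-trans (*-monoˡ-≤ t x≤) (m/n*n≤m (ω * σ) t) ; 2σ≤ = Qx
        ; cost = cost σ x x≤ end end′ }
      where
        θ≤N : θ ≤ N
        θ≤N = ≮⇒≥ λ N<θ → <⇒≱ (begin-strict
          2 * N + 1          <⟨ n<1+n _ ⟩
          suc (2 * N + 1)    ≡⟨ id N ⟩
          2 * suc N          ≤⟨ *-monoʳ-≤ 2 N<θ ⟩
          2 * θ              ≤⟨ 2θ≤π ⟩
          π                  ≤⟨ m≤m+n π θ ⟩
          π + θ ∎) w≤
          where
            id : ∀ N → suc (2 * N + 1) ≡ 2 * suc N
            id = solve-∀
        θ+d≡N : θ + (N ∸ θ) ≡ N
        θ+d≡N = m+[n∸m]≡n θ≤N
        cost : ∀ σ x → x ≤ X σ → σ ≡ θ + (N ∸ θ) ⊎ (σ < θ + (N ∸ θ) × ¬ (2 * suc σ ≤ π + Y (X (suc σ)))) →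
               x ≡ 0 ⊎ (∃ λ x′ → x ≡ suc x′ × ¬ (2 * σ ≤ π + Y x′)) →
               suc (π + θ) + x ≤ σ + u (π + θ) + (10 + 2 * A + θ) ⊎ (σ ≡ N ×
                   suc (π + θ) + x ≤ v (π + θ) + (10 + 2 * A + θ))
        cost σ x x≤ (inj₂ (σ< , ¬P)) _ = inj₁ (≤-trans (smallSample π θ (subst (σ <_) θ+d≡N σ<) x≤ (≰⇒> ¬P))
          (+-monoʳ-≤ (σ + u (π + θ)) (+-monoˡ-≤ θ (+-monoˡ-≤ (2 * A) (m≤m+n 4 6)))))
        cost σ x x≤ (inj₁ σ≡) (inj₁ refl) = inj₂ (trans σ≡ θ+d≡N ,
            ≤-trans (s≤s (fullSample π θ z≤n w≤ π+Y0≤)) (slack (v (π + θ))))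
          where
            π+Y0≤ : π + Y 0 ≤ 2 * N + 1
            π+Y0≤ = subst (λ z → π + z ≤ 2 * N + 1) (sym (trans (cong (_/ t) (*-zeroʳ α)) (0/n≡0 t)))
              (≤-trans (≤-reflexive (+-identityʳ π)) (≤-trans (m≤m+n π θ) w≤))
            slack : ∀ v → suc (v + (8 + θ)) ≤ v + (10 + 2 * A + θ)
            slack v = subst (suc (v + (8 + θ)) ≤_) (id v θ A) (m≤m+n _ (1 + 2 * A))
              where
                id : ∀ v θ A → suc (v + (8 + θ)) + (1 + 2 * A) ≡ v + (10 + 2 * A + θ)
                id = solve-∀
        -- The estimate is made for x - 1, where the condition fails; the step back to x costs one
        -- more in the exponent, which the 10 covers.
        cost σ x x≤ (inj₁ σ≡) (inj₂ (x′ , refl , ¬Q)) = inj₂ (σ≡N ,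
            ≤-trans (≤-reflexive (cong suc (+-suc (π + θ) x′)))
                (≤-trans (s≤s (s≤s full)) (slack (v (π + θ)))))
          where
            σ≡N = trans σ≡ θ+d≡N
            x′≤N : x′ ≤ N
            x′≤N = ≤-trans (n≤1+n x′) (≤-trans x≤ (≤-trans (X≤ σ) (≤-reflexive σ≡N)))
            full : π + θ + x′ ≤ v (π + θ) + (8 + θ)
            full = fullSample π θ x′≤N w≤ (≤-trans (<⇒≤ (≰⇒> ¬Q))
                (≤-trans (≤-reflexive (cong (2 *_) σ≡N)) (m≤m+n (2 * N) 1)))
            slack : ∀ v → suc (suc (v + (8 + θ))) ≤ v + (10 + 2 * A + θ)
            slack v = subst (suc (suc (v + (8 + θ))) ≤_) (id v θ A) (m≤m+n _ (2 * A))
              where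
                id : ∀ v θ A → suc (suc (v + (8 + θ))) + 2 * A ≡ v + (10 + 2 * A + θ)
                id = solve-∀

-- The recursion over levels

module Recursion where

  open import Data.Nat
  open import Data.Nat.Properties
  open import Data.Nat.DivMod
  open import Defs using (Digraph; arcs; Walk; PolyBounded; size; ℕtoℚ; IsHopset; fromℚ)
  open Rationals using
    ( mulˡ-≤; mulʳ-≤; *-nonneg; +-nonneg; ≤-by; 0≤1; _÷_; ÷-≤; ÷-nonneg; ÷-*; ÷-+; ÷-≡; ℕtoℚ-nonneg )
  open Walks
  open Pairs using (_⊆ᴸ_; collect)
  open ScaledGraphs using (Stretch; widen)
  open Reduction
  open Parameters

  stretch-mono : ∀ {n} {G : Digraph n} → NonNegArcs (arcs G) → ∀ {t t′ es u v} → t ℚ.≤ t′ →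
      Stretch G t es u v → Stretch G t′ es u v
  stretch-mono G≥0 t≤t′ st k ℓ W = let k′ , ℓ′ , W′ , le = st k ℓ W in
    k′ , ℓ′ , W′ , ℚ.≤-trans le (mulʳ-≤ (walk-nonneg G≥0 W) t≤t′)

  allPaths : ∀ {n} (G : Digraph n) → NonNegArcs (arcs G) → ∀ P →
    ∃ λ es → length es ≤ length P * n × (∀ {u v} → (u , v) ∈ P → Stretch G 1ℚ es u v)
  allPaths {n} G G≥0 P =
    let es , le , st = collect {Q = λ (u , v) es → Stretch G 1ℚ es u v} P n
          (λ ⊆es q k ℓ W → let k′ , ℓ′ , W′ , le = q k ℓ W in k′ , ℓ′ , widen {G = G} ⊆es W′ , le)
          (λ {(u , v)} _ → onePath u v (shortestPath G G≥0 u v))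
    in es , le , λ e∈ → st e∈
    where
      onePath : ∀ u v → (∀ k ℓ → ¬ Walk (arcs G) u v k ℓ) ⊎ ShortestPath G G≥0 u v →
                ∃ λ es → length es ≤ n × Stretch G 1ℚ es u v
      onePath u v (inj₁ ¬W) = [] , z≤n , λ k ℓ W → contradiction W (¬W k ℓ)
      onePath u v (inj₂ (d , p@(path W len≤d _) , min)) =
        edgesOf W , subst (_≤ n) (sym (length-edgesOf W)) (hops≤n G≥0 p) ,
        λ k ℓ W′ → _ , _ , restrict W (λ e∈ → e∈) , ℚ.≤-trans len≤d
            (ℚ.≤-trans (min k ℓ W′) (ℚ.≤-reflexive (sym (ℚ.*-identityˡ ℓ))))

  -- The origin of the 10: (1 + η)(1 + 2η) ≤ 1 + 5η because η ≤ 1, and the cross term with the error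
  -- T ≤ 1 accumulated so far is at most another 5η.
  accumulate : ∀ m .{{_ : NonZero m}} w → 10 * suc w ≤ m →
    (1ℚ ℚ.+ (10 * w) ÷ m) ℚ.* ((1ℚ ℚ.+ 1 ÷ m) ℚ.* (1ℚ ℚ.+ (1 ÷ m ℚ.+ 1 ÷ m))) ℚ.≤ 1ℚ ℚ.+ (10 * suc w) ÷ m
  accumulate m w 10w≤m = begin
    (1ℚ ℚ.+ T) ℚ.* ((1ℚ ℚ.+ η) ℚ.* (1ℚ ℚ.+ (η ℚ.+ η)))           ≤⟨ mulˡ-≤ (+-nonneg 0≤1 0≤T) loss≤ ⟩
    (1ℚ ℚ.+ T) ℚ.* (1ℚ ℚ.+ 5ℚ ℚ.* η)
      ≡⟨ solve 3 (λ t f e → (con 1ℚ :+ t) :* (con 1ℚ :+ f :* e) := con 1ℚ :+ t :+ f :* e :+ t :* (f :* e))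
          refl T 5ℚ η ⟩
    1ℚ ℚ.+ T ℚ.+ 5ℚ ℚ.* η ℚ.+ T ℚ.* (5ℚ ℚ.* η)
      ≤⟨ ℚ.+-monoʳ-≤ (1ℚ ℚ.+ T ℚ.+ 5ℚ ℚ.* η) (ℚ.≤-trans (mulʳ-≤ 0≤5η T≤1)
          (ℚ.≤-reflexive (ℚ.*-identityˡ (5ℚ ℚ.* η)))) ⟩
    1ℚ ℚ.+ T ℚ.+ 5ℚ ℚ.* η ℚ.+ 5ℚ ℚ.* η                         ≡⟨ cong (λ z → 1ℚ ℚ.+ T ℚ.+ z ℚ.+ z) 5η≡ ⟩
    1ℚ ℚ.+ T ℚ.+ 5 ÷ m ℚ.+ 5 ÷ m
      ≡⟨ solve 3 (λ t a o → o :+ t :+ a :+ a := o :+ (t :+ (a :+ a))) refl T (5 ÷ m) 1ℚ ⟩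
    1ℚ ℚ.+ (T ℚ.+ (5 ÷ m ℚ.+ 5 ÷ m))
      ≡⟨ cong (1ℚ ℚ.+_) (trans (cong (T ℚ.+_) (÷-+ 5 5 m)) (÷-+ (10 * w) 10 m)) ⟩
    1ℚ ℚ.+ (10 * w + 10) ÷ m                                   ≡⟨ cong (λ z → 1ℚ ℚ.+ z ÷ m) (arrange w) ⟩
    1ℚ ℚ.+ (10 * suc w) ÷ m ∎
    where
      open ℚ.≤-Reasoning
      open +-*-Solver
      arrange : ∀ w → 10 * w + 10 ≡ 10 * suc w
      arrange = solve-∀
      5ℚ = ℕtoℚ 5
      η = 1 ÷ m
      T = (10 * w) ÷ m
      0≤T = ÷-nonneg (10 * w) m
      0≤η = ÷-nonneg 1 m
      0≤5η = *-nonneg (ℕtoℚ-nonneg 5) 0≤η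
      5η≡ : 5ℚ ℚ.* η ≡ 5 ÷ m
      5η≡ = trans (÷-* 5 1 1 m) (÷-≡ {5} {5} {1 * m} {m} {{m*n≢0 1 m}} (cong (5 *_) (sym (*-identityˡ m))))
      T≤1 : T ℚ.≤ 1ℚ
      T≤1 = ÷-≤ {10 * w} {1} {m} {1} (subst₂ _≤_ (sym (*-identityʳ (10 * w))) (sym (*-identityˡ m))
        (≤-trans (*-monoʳ-≤ 10 (n≤1+n w)) 10w≤m))
      η≤1 : η ℚ.≤ 1ℚ
      η≤1 = ÷-≤ {1} {1} {m} {1} (subst₂ _≤_ refl (sym (*-identityˡ m)) (>-nonZero⁻¹ m))
      loss≤ : (1ℚ ℚ.+ η) ℚ.* (1ℚ ℚ.+ (η ℚ.+ η)) ℚ.≤ 1ℚ ℚ.+ 5ℚ ℚ.* η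
      loss≤ = ≤-by (ℕtoℚ 2 ℚ.* (η ℚ.* (1ℚ ℚ.- η))) (*-nonneg (ℕtoℚ-nonneg 2)
          (*-nonneg 0≤η (Rationals.0≤-diff η≤1)))
        (solve 1 (λ e → (con 1ℚ :+ e) :* (con 1ℚ :+ (e :+ e)) :+ con (ℕtoℚ 2) :* (e :* (con 1ℚ :- e)) := con
            1ℚ :+ con (ℕtoℚ 5) :* e) refl η)

  module Recurse {n : ℕ} .{{_ : NonZero n}} (G : Digraph n) (G≥0 : NonNegArcs (arcs G)) (scales : List Scale)
      (covers : Covers G scales)
    (t ω τ α₁ A N : ℕ) (t≡ω+τ : t ≡ ω + τ) (0<τ : 1 ≤ τ) (2N+2≤t : 2 * N + 2 ≤ t)
    (α′≤At : t + α₁ + 2 ≤ A * t) (gap : (t + α₁ + 2) * (ω + 2) ≤ t * t + t * ω)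
    (2^N≤n : 2 ^ N ≤ n) (n<2^N+1 : n < 2 ^ suc N) where

    open Exponents t ω τ α₁ A N t≡ω+τ 0<τ 2N+2≤t α′≤At gap using (u; v; u-mono; v-mono; Y; Choice; choose)

    module _ (m θ Hid : ℕ) .{{_ : NonZero m}} (m≤ : m ≤ 2 ^ θ) (λ≤ : 3 * N + 3 ≤ 2 ^ θ)
      (JHid≤ : length scales * Hid ≤ 2 ^ θ)
      (hopset : ∀ σ x → σ ≤ N → x * t ≤ ω * σ → ∀ (Γ : Digraph (2 ^ σ)) → PolyBounded 2 Γ →
                ∃ λ H → IsHopset Γ (2 ^ x) (fromℚ (1 ÷ m)) H × size H * 2 ^ Y x ≤ Hid * 2 ^ (2 * σ)) where

      -- At most 2^(2N+2) demands with at most n < 2^(N+1) blocks each give fewer than 2^Λ blocks,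
      -- so Λ halvings suffice. In the exponent of W, θ + 2A + 10 comes from `Choice.cost`, 5 from
      -- the factor 32 and 1 from n < 2 · 2^N; having 3θ in place of θ pays for the base case.
      Λ W : ℕ
      Λ = 3 * N + 3
      W = 2 ^ (3 * θ + (2 * A + 16)) * Λ

      target : ℕ → ℕ
      target w = n * 2 ^ u w + 2 ^ v w

      target-mono : ∀ {w w′} → w ≤ w′ → target w ≤ target w′
      target-mono w≤ = +-mono-≤ (*-monoʳ-≤ n (^-monoʳ-≤ 2 (u-mono w≤))) (^-monoʳ-≤ 2 (v-mono w≤))

      n≤target : ∀ w → n ≤ target w
      n≤target w = ≤-trans (m≤m*n n (2 ^ u w) {{m^n≢0 2 (u w)}}) (m≤m+n _ _)

      Λ≥1 : 1 ≤ Λ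
      Λ≥1 = ≤-trans (s≤s z≤n) (m≤n+m 3 (3 * N))

      instance
        Λ≢0 : NonZero Λ
        Λ≢0 = >-nonZero Λ≥1

      2^≤W : ∀ {e} → e ≤ 3 * θ + (2 * A + 16) → 2 ^ e * Λ ≤ W
      2^≤W e≤ = *-monoˡ-≤ Λ (^-monoʳ-≤ 2 e≤)

      Reduced : ℕ → List (Fin n × Fin n) → Set
      Reduced w P = ∃ λ P′ → length P′ ≤ 2 ^ w ×
          (∀ r → 1ℚ ℚ.≤ r → ∃ λ es → length es ≤ W * target w ×
            (∀ {es′} → es ⊆ᴸ es′ → (∀ {u v} → (u , v) ∈ P′ → Stretch G r es′ u v) →
              ∀ {u v} → (u , v) ∈ P → Stretch G (r ℚ.* ((1ℚ ℚ.+ 1 ÷ m) ℚ.* (1ℚ ℚ.+ (1 ÷ m ℚ.+ 1 ÷ m)))) es′ u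
                  v))

      module Step {π : ℕ} (choice : Choice π θ) (w≤ : π + θ ≤ 2 * N + 1) where
        open Choice choice
        w = π + θ
        s β q h R : ℕ
        s = 2 ^ σ
        β = 2 ^ x
        q = s / Λ

        Λ≤s : Λ ≤ s
        Λ≤s = ≤-trans λ≤ (^-monoʳ-≤ 2 θ≤σ)

        instance
          s≢0 : NonZero s
          s≢0 = m^n≢0 2 σ
          2^Yx≢0 : NonZero (2 ^ Y x)
          2^Yx≢0 = m^n≢0 2 (Y x)
          q≢0 : NonZero q
          q≢0 = >-nonZero (m≥n⇒m/n>0 Λ≤s)

        -- This makes n ≤ q h, so that q choices halve the missed blocks; q Λ ≤ s choices do so Λ
        -- times. Up to constants h is Λ n/s.
        h = suc (n / q)
        R = Hid * 2 ^ (2 * σ) / 2 ^ Y x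

        s≤n : s ≤ n
        s≤n = ≤-trans (^-monoʳ-≤ 2 σ≤N) 2^N≤n

        qΛ≤s : q * Λ ≤ s
        qΛ≤s = m/n*n≤m s Λ

        n≤qh : n ≤ q * h
        n≤qh = ≤-trans (<⇒≤ (m<suc[m/n]*n n q)) (≤-reflexive (*-comm h q))

        qh≤2n : q * h ≤ n + n
        qh≤2n = ≤-trans (≤-reflexive (*-suc q (n / q)))
          (+-mono-≤ (≤-trans (m/n≤m s Λ) s≤n) (≤-trans (≤-reflexive (*-comm q (n / q))) (m/n*n≤m n q)))

        hs≤4Λn : h * s ≤ 4 * Λ * n
        hs≤4Λn = begin
          h * s                         ≤⟨ *-monoʳ-≤ h (<⇒≤ (m<suc[m/n]*n s Λ)) ⟩
          h * (suc q * Λ)             ≤⟨ *-monoʳ-≤ h (*-monoˡ-≤ Λ (+-monoˡ-≤ q (>-nonZero⁻¹ q))) ⟩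
          h * ((q + q) * Λ)         ≡⟨ id₁ h q Λ ⟩
          2 * Λ * (q * h)           ≤⟨ *-monoʳ-≤ (2 * Λ) qh≤2n ⟩
          2 * Λ * (n + n)           ≡⟨ id₂ Λ n ⟩
          4 * Λ * n ∎
          where
            open ≤-Reasoning
            id₁ : ∀ h q l → h * ((q + q) * l) ≡ 2 * l * (q * h)
            id₁ = solve-∀
            id₂ : ∀ l n → 2 * l * (n + n) ≡ 4 * l * n
            id₂ = solve-∀

        perPair : ℕ
        perPair = h + (β * (h + h) + (h + h))

        levelCost : ℕ
        levelCost = 2 ^ suc w * perPair

        cost*s≤ : levelCost * s ≤ 2 ^ (suc w + x) * (32 * Λ * n)
        cost*s≤ = begin
          2 ^ suc w * perPair * s                      ≤⟨ *-monoˡ-≤ s (*-monoʳ-≤ (2 ^ suc w) perPair≤) ⟩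
          2 ^ suc w * (β * (8 * h)) * s            ≡⟨ id₁ (2 ^ suc w) β h s ⟩
          2 ^ suc w * β * (8 * (h * s))            ≤⟨ *-monoʳ-≤ (2 ^ suc w * β) (*-monoʳ-≤ 8 hs≤4Λn) ⟩
          2 ^ suc w * β * (8 * (4 * Λ * n))      ≡⟨ cong₂ _*_ (sym (^-distribˡ-+-* 2 (suc w) x)) (id₂ Λ n) ⟩
          2 ^ (suc w + x) * (32 * Λ * n) ∎
          where
            open ≤-Reasoning
            id₁ : ∀ p b h s → p * (b * (8 * h)) * s ≡ p * b * (8 * (h * s))
            id₁ = solve-∀
            id₂ : ∀ l n → 8 * (4 * l * n) ≡ 32 * l * n
            id₂ = solve-∀
            id₃ : ∀ b h → b * h + (b * (h + h) + (b * (h + h) + 3 * (b * h))) ≡ b * (8 * h)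
            id₃ = solve-∀
            1≤β : 1 ≤ β
            1≤β = m^n>0 2 x
            b* : ∀ y → y ≤ β * y
            b* y = ≤-trans (≤-reflexive (sym (*-identityˡ y))) (*-monoˡ-≤ y 1≤β)
            perPair≤ : perPair ≤ β * (8 * h)
            perPair≤ = ≤-trans (+-mono-≤ (b* h) (+-monoʳ-≤ (β * (h + h))
                (≤-trans (b* (h + h)) (m≤m+n _ (3 * (β * h))))))
                         (≤-reflexive (id₃ β h))

        32Λn : ∀ e → 2 ^ e * (32 * Λ * n) ≡ 2 ^ (e + 5) * Λ * n
        32Λn e = trans (id (2 ^ e) Λ n) (cong (λ z → z * Λ * n) (sym (^-distribˡ-+-* 2 e 5)))
          where
            id : ∀ p l n → p * (32 * l * n) ≡ p * 32 * l * n
            id = solve-∀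

        -- The cost is compared after multiplication by s. In the second alternative s = 2^N > n/2,
        -- so the factor n/s of the cost is a constant and n disappears from it.
        levelCost≤ : levelCost ≤ W * target w
        levelCost≤ = bound (10 + 2 * A + θ) (≤-trans (m≤m+n _ (2 * θ)) (≤-reflexive (constants θ A))) cost
          where
            open ≤-Reasoning
            constants : ∀ θ A → 10 + 2 * A + θ + 6 + 2 * θ ≡ 3 * θ + (2 * A + 16)
            constants = solve-∀
            bound : ∀ C → C + 6 ≤ 3 * θ + (2 * A + 16) →
                    suc w + x ≤ σ + u w + C ⊎ (σ ≡ N × suc w + x ≤ v w + C) → levelCost ≤ W * target w
            bound C C≤ (inj₁ le) = ≤-trans (*-cancelʳ-≤ levelCost (2 ^ (C + 5) * Λ * (n * 2 ^ u w)) s (begin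
              levelCost * s                                        ≤⟨ cost*s≤ ⟩
              2 ^ (suc w + x) * (32 * Λ * n)               ≤⟨ *-monoˡ-≤ (32 * Λ * n) (^-monoʳ-≤ 2 le) ⟩
              2 ^ (σ + u w + C) * (32 * Λ * n)           ≡⟨ cong (_* (32 * Λ * n))
                    (trans (^-distribˡ-+-* 2 (σ + u w) C) (cong (_* 2 ^ C) (^-distribˡ-+-* 2 σ (u w)))) ⟩
              s * 2 ^ u w * 2 ^ C * (32 * Λ * n)       ≡⟨ *-assoc (s * 2 ^ u w) (2 ^ C) (32 * Λ * n) ⟩
              s * 2 ^ u w * (2 ^ C * (32 * Λ * n))     ≡⟨ cong (s * 2 ^ u w *_) (32Λn C) ⟩
              s * 2 ^ u w * (2 ^ (C + 5) * Λ * n)      ≡⟨ id s (2 ^ u w) (2 ^ (C + 5) * Λ) n ⟩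
              2 ^ (C + 5) * Λ * (n * 2 ^ u w) * s ∎))
              (*-mono-≤ (2^≤W (≤-trans (+-monoʳ-≤ C (n≤1+n 5)) C≤)) (m≤m+n (n * 2 ^ u w) _))
              where
                id : ∀ s p c n → s * p * (c * n) ≡ c * (n * p) * s
                id = solve-∀
            bound C C≤ (inj₂ (refl , le)) = ≤-trans (*-cancelʳ-≤ levelCost (2 ^ (C + 6) * Λ * 2 ^ v w) s
                (begin
              levelCost * s                                        ≤⟨ cost*s≤ ⟩
              2 ^ (suc w + x) * (32 * Λ * n)               ≤⟨ *-monoˡ-≤ (32 * Λ * n) (^-monoʳ-≤ 2 le) ⟩
              2 ^ (v w + C) * (32 * Λ * n)
                ≡⟨ cong (_* (32 * Λ * n)) (^-distribˡ-+-* 2 (v w) C) ⟩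
              2 ^ v w * 2 ^ C * (32 * Λ * n)             ≡⟨ *-assoc (2 ^ v w) (2 ^ C) (32 * Λ * n) ⟩
              2 ^ v w * (2 ^ C * (32 * Λ * n))           ≡⟨ cong (2 ^ v w *_) (32Λn C) ⟩
              2 ^ v w * (2 ^ (C + 5) * Λ * n)            ≤⟨ *-monoʳ-≤ (2 ^ v w)
                    (*-monoʳ-≤ (2 ^ (C + 5) * Λ) (<⇒≤ n<2^N+1)) ⟩
              2 ^ v w * (2 ^ (C + 5) * Λ * (2 * s))    ≡⟨ id (2 ^ v w) (2 ^ (C + 5)) Λ s ⟩
              2 * 2 ^ (C + 5) * Λ * 2 ^ v w * s        ≡⟨ cong (λ z → 2 ^ z * Λ * 2 ^ v w * s) (+-suc C 5) ⟨
              2 ^ (C + 6) * Λ * 2 ^ v w * s ∎))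
              (*-mono-≤ (2^≤W C≤) (m≤n+m (2 ^ v w) _))
              where
                id : ∀ p c l s → p * (c * l * (2 * s)) ≡ 2 * c * l * p * s
                id = solve-∀

        -- The reserve 2^θ is spent here, on the number of scales and the hidden factor of the
        -- hopset size.
        JR≤ : length scales * R ≤ 2 ^ w
        JR≤ = *-cancelʳ-≤ (length scales * R) (2 ^ w) (2 ^ Y x) (begin
          length scales * R * 2 ^ Y x            ≡⟨ *-assoc (length scales) R (2 ^ Y x) ⟩
          length scales * (R * 2 ^ Y x)          ≤⟨ *-monoʳ-≤ (length scales)
                (m/n*n≤m (Hid * 2 ^ (2 * σ)) (2 ^ Y x)) ⟩
          length scales * (Hid * 2 ^ (2 * σ))  ≡⟨ *-assoc (length scales) Hid (2 ^ (2 * σ)) ⟨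
          length scales * Hid * 2 ^ (2 * σ)    ≤⟨ *-mono-≤ JHid≤ (^-monoʳ-≤ 2 2σ≤) ⟩
          2 ^ θ * 2 ^ (π + Y x)                ≡⟨ ^-distribˡ-+-* 2 θ (π + Y x) ⟨
          2 ^ (θ + (π + Y x))                    ≡⟨ cong (2 ^_)
                (trans (sym (+-assoc θ π (Y x))) (cong (_+ Y x) (+-comm θ π))) ⟩
          2 ^ (w + Y x)                            ≡⟨ ^-distribˡ-+-* 2 w (Y x) ⟩
          2 ^ w * 2 ^ Y x ∎)
          where open ≤-Reasoning

        oracle : ∀ (Γ : Digraph s) → PolyBounded 2 Γ → ∃ λ H → IsHopset Γ β (fromℚ (1 ÷ m)) H × size H ≤ R
        oracle Γ Γ-bounded = let H , isH , le = hopset σ x σ≤N x≤X Γ Γ-bounded in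
          H , isH , ≤-trans (≤-reflexive (sym (m*n/n≡m (size H) (2 ^ Y x)))) (/-monoˡ-≤ (2 ^ Y x) le)

        m≤s : m ≤ s
        m≤s = ≤-trans m≤ (^-monoʳ-≤ 2 θ≤σ)

        Pn< : ∀ {p} → p ≤ 2 ^ suc w → p * n < 2 ^ Λ
        Pn< {p} p≤ = begin-strict
          p * n                                ≤⟨ *-monoˡ-≤ n p≤ ⟩
          2 ^ suc w * n                      <⟨ *-monoʳ-< (2 ^ suc w) {{m^n≢0 2 (suc w)}} n<2^N+1 ⟩
          2 ^ suc w * 2 ^ suc N            ≡⟨ ^-distribˡ-+-* 2 (suc w) (suc N) ⟨
          2 ^ (suc w + suc N)                ≤⟨ ^-monoʳ-≤ 2 (+-monoˡ-≤ (suc N) (s≤s w≤)) ⟩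
          2 ^ (suc (2 * N + 1) + suc N)  ≡⟨ cong (2 ^_) (id N) ⟩
          2 ^ Λ ∎
          where
            open ≤-Reasoning
            id : ∀ N → suc (2 * N + 1) + suc N ≡ 3 * N + 3
            id = solve-∀

        reduced : ∀ P → length P ≤ 2 ^ suc w → Reduced w P
        reduced P |P|≤ =
          let P′ , P′≤ , level = reduceDemands G G≥0 scales covers {s} {h} {m} q Λ β R m≤s n≤qh qΛ≤s oracle P
                (Pn< |P|≤)
          in P′ , ≤-trans P′≤ JR≤ , λ r 1≤r → let es , es≤ , st = level r 1≤r in
             es , ≤-trans es≤ (≤-trans (*-monoˡ-≤ perPair |P|≤) levelCost≤) , st

      factor : ℕ → ℚ
      factor π = 1ℚ ℚ.+ (10 * π) ÷ m

      1≤factor : ∀ π → 1ℚ ℚ.≤ factor π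
      1≤factor π = ≤-by ((10 * π) ÷ m) (÷-nonneg (10 * π) m) refl

      -- A level leads from 2^(w+1) demands to 2^w. Later levels are charged at the target of the
      -- present one, which is monotone, so the number of levels is just a factor. The base case π ≤
      -- 3θ is forced by `choose`: it needs 2θ ≤ w - θ.
      preserve : ∀ π → π ≤ 2 * N + 2 → 10 * π ≤ m → ∀ P → length P ≤ 2 ^ π →
        ∃ λ es → length es ≤ suc π * (W * target (pred π)) ×
            (∀ {u v} → (u , v) ∈ P → Stretch G (factor π) es u v)
      preserve π π≤ 10π≤m P |P|≤ = cases π π≤ 10π≤m P |P|≤ (π ≤? 3 * θ)
        where
          cases : ∀ π → π ≤ 2 * N + 2 → 10 * π ≤ m → ∀ P → length P ≤ 2 ^ π → Dec (π ≤ 3 * θ) →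
            ∃ λ es → length es ≤ suc π * (W * target (pred π)) ×
                (∀ {u v} → (u , v) ∈ P → Stretch G (factor π) es u v)
          cases π _ _ P |P|≤ (yes π≤3θ) =
            let es , es≤ , st = allPaths G G≥0 P in
            es , ≤-trans es≤ (begin
              length P * n                       ≤⟨ *-mono-≤
                    (≤-trans |P|≤ (^-monoʳ-≤ 2 (≤-trans π≤3θ (m≤m+n _ (2 * A + 16))))) (n≤target (pred π)) ⟩
              2 ^ e * target (pred π)        ≤⟨ *-monoˡ-≤ (target (pred π)) (m≤m*n (2 ^ e) Λ) ⟩
              W * target (pred π)              ≤⟨ m≤n*m _ (suc π) ⟩
              suc π * (W * target (pred π)) ∎) ,
            λ e∈ → stretch-mono {G = G} G≥0 (1≤factor π) (st e∈)
            where
              open ≤-Reasoning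
              e = 3 * θ + (2 * A + 16)
          cases zero _ _ _ _ (no π≰3θ) = contradiction z≤n π≰3θ
          cases (suc w) w≤ 10w≤m P |P|≤ (no w≰3θ) =
            let P′ , P′≤ , level = reduced P |P|≤
                es′ , es′≤ , st′ = preserve w (≤-trans (n≤1+n w) w≤) (≤-trans (*-monoʳ-≤ 10 (n≤1+n w)) 10w≤m)
                    P′ P′≤
                es , es≤ , st = level (factor w) (1≤factor w)
            in es ++ es′ ,
               ≤-trans (≤-reflexive (length-++ es)) (+-mono-≤ es≤
                   (≤-trans es′≤ (*-monoʳ-≤ (suc w) (*-monoʳ-≤ W (target-mono {pred w} {w} pred[n]≤n))))) ,
               λ e∈ → stretch-mono {G = G} G≥0 (accumulate m w 10w≤m)
                 (st ∈-++⁺ˡ (λ e∈′ k ℓ Wk → let k′ , ℓ′ , W′ , le = st′ e∈′ k ℓ Wk in k′ , ℓ′ , widen {G = G} (∈-++⁺ʳ es) W′ , le) e∈)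
            where
              3θ≤w : 3 * θ ≤ w
              3θ≤w = ≤-pred (≰⇒> w≰3θ)
              w≡ : w ∸ θ + θ ≡ w
              w≡ = m∸n+n≡m (≤-trans (m≤n*m θ 3) 3θ≤w)
              2θ≤ : 2 * θ ≤ w ∸ θ
              2θ≤ = m+n≤o⇒m≤o∸n (2 * θ) (subst (_≤ w) (+-comm θ (2 * θ)) 3θ≤w)
              reduced : ∀ P → length P ≤ 2 ^ suc w → Reduced w P
              reduced = reducedAt (w ∸ θ) w≡ 2θ≤ (subst (_≤ 2 * N + 1) (sym w≡)
                  (≤-pred (subst (suc w ≤_) (+-suc (2 * N) 1) w≤)))
                where
                  reducedAt : ∀ π {w} → π + θ ≡ w → 2 * θ ≤ π → π + θ ≤ 2 * N + 1 → ∀ P →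
                      length P ≤ 2 ^ suc w → Reduced w P
                  reducedAt π refl 2θ≤ w≤ = Step.reduced (choose π θ 2θ≤ w≤) w≤

-- Rational approximation of a and b

module Approximation where

  open import Data.Nat using (_+_; _*_; _^_; _∸_; _≤_; _<_; _/_)
  open import Data.Integer using (+_; -[1+_])
  open import Data.Rational using (mkℚ)
  open import Data.Rational.Properties
  open import Function.Bundles using (module Equivalence; mk⇔)
  open import Defs hiding (_≤_; _<_; _+_; _-_; _*_; _/_; _⊓_; _^_; _⁻¹)
  import Defs as ℝ
  open Rationals using (mulˡ-≤; 0≤-diff; _÷_; ÷-≤; ÷-≤⁻¹; ÷-<; ÷-<⁻¹; ÷-≡; ÷-+; ÷-*)
  open Enclosures

  fromℚ-isReal : ∀ p → IsReal (fromℚ p)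
  fromℚ-isReal p = record
    { inhabitedˡ = p ℚ.- 1ℚ , Rationals.<-by 1ℚ Rationals.0<1
        (solve 1 (λ p → p :- con 1ℚ :+ con 1ℚ := p) refl p)
    ; inhabitedᵘ = p ℚ.+ 1ℚ , Rationals.<-by 1ℚ Rationals.0<1 refl
    ; roundedˡ = λ q → mk⇔ (λ q<p → <-dense q<p) (λ { (r , q<r , r<p) → <-trans q<r r<p })
    ; roundedᵘ = λ q → mk⇔ (λ p<q → let r , p<r , r<q = <-dense p<q in r , r<q , p<r) (λ { (r , r<q , p<r) → <-trans p<r r<q })
    ; disjoint = λ { q (q<p , p<q) → <-asym q<p p<q }
    ; located = λ q r q<r → locate q r q<r (p ℚ.≤? q)
    }
    where
      open +-*-Solver
      locate : ∀ q r → q ℚ.< r → Dec (p ℚ.≤ q) → q ℚ.< p ⊎ p ℚ.< r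
      locate q r q<r (yes p≤q) = inj₂ (≤-<-trans p≤q q<r)
      locate q r q<r (no p≰q)  = inj₁ (≰⇒> p≰q)

  nonneg-fraction : ∀ {q} → 0ℚ ℚ.≤ q → ∃₂ λ i e → Σ (NonZero e) λ nz → q ≡ (i ÷ e) {{nz}}
  nonneg-fraction {q@(mkℚ (+ i) d-1 _)} _ = i , suc d-1 , _ , sym (↥p/↧p≡p q)
  nonneg-fraction {mkℚ -[1+ i ] d-1 _} (ℚ.*≤* ())

  -- `located` is asked about consecutive grid points until it answers from above. It may answer
  -- either way near x, hence a window of width 2/t instead of 1/t. The bound B limits the number of
  -- questions.
  approximate : ∀ {x} → IsReal x → ∀ t .{{_ : NonZero t}} α₀ → (∀ r → r ℚ.< α₀ ÷ t → L x r) →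
    ∀ {B} → U x (ℕtoℚ B) → ∃ λ e → (∀ r → r ℚ.< (α₀ + e) ÷ t → L x r) × U x ((α₀ + e + 2) ÷ t)
  approximate {x} R t α₀ Lα₀ {B} UB =
    search (B * t) 0 (ℕ.m≤n+m (B * t) (α₀ + 0)) (subst (λ z → ∀ r → r ℚ.< z ÷ t →
        L x r) (sym (ℕ.+-identityʳ α₀)) Lα₀)
    where
      Goal = ∃ λ e → (∀ r → r ℚ.< (α₀ + e) ÷ t → L x r) × U x ((α₀ + e + 2) ÷ t)
      grow : ∀ {q r} → q ℚ.< r → U x q → U x r
      grow {q} {r} q<r Uq = Equivalence.from (IsReal.roundedᵘ R r) (q , q<r , Uq)
      search : ∀ fuel e → B * t ≤ α₀ + e + fuel → (∀ r → r ℚ.< (α₀ + e) ÷ t → L x r) → Goal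
      search zero e le Le = e , Le , grow (÷-< {B} {α₀ + e + 2} {1} {t}
          (subst (B * t <_) (sym (ℕ.*-identityʳ _))
        (ℕ.≤-<-trans le (ℕ.+-monoʳ-< (α₀ + e) (s≤s (z≤n {1})))))) UB
      search (suc fuel) e le Le = cases (IsReal.located R ((α₀ + suc e) ÷ t) ((α₀ + e + 2) ÷ t) step)
        where
          step : (α₀ + suc e) ÷ t ℚ.< (α₀ + e + 2) ÷ t
          step = ÷-< {α₀ + suc e} {α₀ + e + 2} (ℕ.*-monoˡ-< t (ℕ.≤-reflexive (id α₀ e)))
            where
              id : ∀ a e → suc (a + suc e) ≡ a + e + 2
              id = solve-∀
          cases : L x ((α₀ + suc e) ÷ t) ⊎ U x ((α₀ + e + 2) ÷ t) → Goal
          cases (inj₁ Lr) = search fuel (suc e) (ℕ.≤-trans le (ℕ.≤-reflexive (id α₀ e fuel))) (L-below R Lr)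
            where
              id : ∀ a e f → a + e + suc f ≡ a + suc e + f
              id = solve-∀
          cases (inj₂ Ur) = e , Le , Ur

  -- b < min (1 , 1/(a − 1)) with rational bounds on b and on a − 1, which leave room for rounding.

  record Gap (a b : Cut) : Set where
    field
      d q₁ q₄ : ℕ
      {{d≢0}} : NonZero d
      Ub      : U b (q₁ ÷ d)
      Ua      : U a ((d + q₄) ÷ d)
      q₁<d    : q₁ < d
      q₁q₄<d² : q₁ * q₄ < d * d

    -- The coefficient of t in the rounding errors of α′ω′ after multiplication by d², with the
    -- bounds q₁/d for ω/t and q₄/d for α₁/t. For t above it these errors are at most t².
    threshold : ℕ
    threshold = 2 * d * q₁ + 2 * d * q₄ + 6 * d * d

  -- The strict inequality of cuts carries rationals q > b and r₁ > a with q < 1 and q (r₁ - 1) < 1.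
  -- Putting q and r₁ - 1 over a common denominator d turns these into inequalities of naturals.
  gap : ∀ {a b} → IsReal a → IsReal b → fromℕ 1 ℝ.< a → fromℕ 0 ℝ.≤ b →
      b ℝ.< fromℕ 1 ℝ.⊓ (a ℝ.- fromℕ 1) ℝ.⁻¹ → Gap a b
  gap {a} {b} Ra Rb (r₀ , 1<r₀ , Lr₀) 0≤b (q , Uq , q<1 , r , 0<r , (r₁ , s₁ , Ur₁ , s₁<1 , r₁-s₁<r) , qr<1) =
    build (nonneg-fraction 0≤q) (nonneg-fraction 0≤ρ)
    where
      open +-*-Solver
      0≤q : 0ℚ ℚ.≤ q
      0≤q = ≮⇒≥ λ q<0 → IsReal.disjoint Rb q (0≤b q q<0 , Uq)
      1≤r₁ : 1ℚ ℚ.≤ r₁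
      1≤r₁ = ≮⇒≥ λ r₁<1 → IsReal.disjoint Ra r₁ (L-below Ra Lr₀ r₁ (<-trans r₁<1 1<r₀) , Ur₁)
      ρ = r₁ ℚ.- 1ℚ
      0≤ρ : 0ℚ ℚ.≤ ρ
      0≤ρ = 0≤-diff 1≤r₁
      qρ<1 : q ℚ.* ρ ℚ.< 1ℚ
      qρ<1 = ≤-<-trans (mulˡ-≤ 0≤q (<⇒≤ (<-trans (+-monoʳ-< r₁ (neg-antimono-< s₁<1)) r₁-s₁<r))) qr<1
      build : (∃₂ λ i e → Σ (NonZero e) λ nz → q ≡ (i ÷ e) {{nz}}) →
              (∃₂ λ j f → Σ (NonZero f) λ nz → ρ ≡ (j ÷ f) {{nz}}) → Gap a b
      build (i , e , nze , q≡) (j , f , nzf , ρ≡) = record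
        { d = e * f ; q₁ = i * f ; q₄ = j * e
        ; Ub = subst (U b) (trans q≡ (÷-≡ {i} {i * f} {e} {e * f} (id₁ i e f))) Uq
        ; Ua = subst (U a) r₁≡ Ur₁
        ; q₁<d = ℕ.*-monoˡ-< f i<e
        ; q₁q₄<d² = subst₂ _<_ (id₂ i j e f) refl (ℕ.*-monoˡ-< (e * f) ij<ef)
        }
        where
          instance
            _ = nze
            _ = nzf
            d≢0 : NonZero (e * f)
            d≢0 = ℕ.m*n≢0 e f
          id₁ : ∀ i e f → i * (e * f) ≡ i * f * e
          id₁ = solve-∀
          id₂ : ∀ i j e f → i * j * (e * f) ≡ i * f * (j * e)
          id₂ = solve-∀
          id₃ : ∀ j e f → j * (e * f) ≡ j * e * f
          id₃ = solve-∀
          i<e : i < e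
          i<e = subst₂ _<_ (ℕ.*-identityʳ i) (ℕ.*-identityˡ e)
              (÷-<⁻¹ {i} {1} {e} {1} (subst (ℚ._< 1ℚ) q≡ q<1))
          ij<ef : i * j < e * f
          ij<ef = subst₂ _<_ (ℕ.*-identityʳ (i * j)) (ℕ.*-identityˡ (e * f))
            (÷-<⁻¹ {i * j} {1} {e * f} {1} (subst (ℚ._< 1ℚ) (trans (cong₂ ℚ._*_ q≡ ρ≡) (÷-* i j e f)) qρ<1))
          r₁≡ : r₁ ≡ (e * f + j * e) ÷ (e * f)
          r₁≡ = begin
            r₁
              ≡⟨ solve 1 (λ r → r := con 1ℚ :+ (r :- con 1ℚ)) refl r₁ ⟩
            1ℚ ℚ.+ ρ
              ≡⟨ cong₂ ℚ._+_ (÷-≡ {1} {e * f} {1} {e * f} (trans (ℕ.*-identityˡ _) (sym (ℕ.*-identityʳ _))))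
                                                                 (trans ρ≡
                                                                     (÷-≡ {j} {j * e} {f} {e * f}
                                                                     (id₃ j e f))) ⟩
            (e * f) ÷ (e * f) ℚ.+ (j * e) ÷ (e * f) ≡⟨ ÷-+ (e * f) (j * e) (e * f) ⟩
            (e * f + j * e) ÷ (e * f) ∎
            where open ≡-Reasoning

  -- There are two upper ends for b. The fine one, (ω + 2)/t, bounds 2 - ab; the coarse one, q₁/d <
  -- 1, keeps 1 - b away from 0 independently of t. As a > 1, its numerator is written t + α₁, and
  -- α₁/t approximates a - 1.
  record Approximants {a b : Cut} (g : Gap a b) (t : ℕ) .{{_ : NonZero t}} : Set where
    open Gap g
    field
      α₁ ω  : ℕ
      a∈    : a ∈[ (t + α₁) ÷ t , (t + α₁ + 2) ÷ t ]
      b∈    : b ∈[ ω ÷ t , (ω + 2) ÷ t ]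
      b<    : b ∈[ ω ÷ t , q₁ ÷ d ]
      α₁d≤  : α₁ * d ≤ q₄ * t
      ωd≤   : ω * d ≤ q₁ * t

  approximants : ∀ {a b} → IsReal a → IsReal b → fromℕ 1 ℝ.< a → fromℕ 0 ℝ.≤ b → (g : Gap a b) →
      ∀ t .{{_ : NonZero t}} → Approximants g t
  approximants {a} {b} Ra Rb (r₀ , 1<r₀ , Lr₀) 0≤b g t =
    let α₁ , Lα , Uα = approximate Ra t t (λ r r<1 → L-below Ra Lr₀ r (<-trans (<-≤-trans r<1 t/t≤1) 1<r₀))
          {d + q₄} (grow Ra (÷≤ℕ (d + q₄)) Ua)
        ω , Lω , Uω = approximate Rb t 0 (λ r r<0 → 0≤b r (<-≤-trans r<0 0/t≤0)) {q₁} (grow Rb (÷≤ℕ q₁) Ub)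
        a∈ = real∈ Ra Lα Uα
        b∈ = real∈ Rb Lω Uω
        b< = real∈ Rb Lω Ub
    in record
      { α₁ = α₁ ; ω = ω ; a∈ = a∈ ; b∈ = b∈ ; b< = b<
      ; α₁d≤ = ℕ.+-cancelˡ-≤ (t * d) _ _ (subst₂ _≤_ (ℕ.*-distribʳ-+ d t α₁)
          (trans (ℕ.*-distribʳ-+ t d q₄) (cong (_+ q₄ * t) (ℕ.*-comm d t)))
                 (÷-≤⁻¹ {t + α₁} {d + q₄} {t} {d} (above a∈ _ Ua)))
      ; ωd≤ = ÷-≤⁻¹ {ω} {q₁} {t} {d} (p≤q b<) }
    where
      open Gap g
      grow : ∀ {x q r} → IsReal x → q ℚ.≤ r → U x q → U x r
      grow {x} {q} {r} R q≤r Uq = let s , s<q , Us = Equivalence.to (IsReal.roundedᵘ R q) Uq in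
        Equivalence.from (IsReal.roundedᵘ R r) (s , <-≤-trans s<q q≤r , Us)
      ÷≤ℕ : ∀ i → i ÷ d ℚ.≤ ℕtoℚ i
      ÷≤ℕ i = ÷-≤ {i} {i} {d} {1} (ℕ.*-monoʳ-≤ i (>-nonZero⁻¹ d))
      t/t≤1 : t ÷ t ℚ.≤ 1ℚ
      t/t≤1 = ÷-≤ {t} {1} {t} {1} (ℕ.≤-reflexive (trans (ℕ.*-identityʳ t) (sym (ℕ.*-identityˡ t))))
      0/t≤0 : 0 ÷ t ℚ.≤ 0ℚ
      0/t≤0 = ÷-≤ {0} {0} {t} {1} z≤n

  module Rounded {a b : Cut} (g : Gap a b) (t : ℕ) .{{_ : NonZero t}} (ap : Approximants g t)
    (threshold≤t : Gap.threshold g ≤ t) where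

    open Gap g
    open Approximants ap

    A τ : ℕ
    A = q₄ + 3
    τ = t ∸ ω

    ω<t : ω < t
    ω<t = ℕ.*-cancelʳ-< d ω t (ℕ.≤-<-trans ωd≤ (subst (q₁ * t <_) (ℕ.*-comm d t) (ℕ.*-monoˡ-< t q₁<d)))

    t≡ω+τ : t ≡ ω + τ
    t≡ω+τ = sym (ℕ.m+[n∸m]≡n (ℕ.<⇒≤ ω<t))

    0<τ : 1 ≤ τ
    0<τ = ℕ.m<n⇒0<n∸m ω<t

    α′≤At : t + α₁ + 2 ≤ A * t
    α′≤At = ℕ.≤-trans (ℕ.+-mono-≤ (ℕ.+-monoʳ-≤ t (ℕ.≤-trans (ℕ.m≤m*n α₁ d) α₁d≤))
        (ℕ.*-monoʳ-≤ 2 (>-nonZero⁻¹ t)))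
              (ℕ.≤-reflexive (id t q₄))
      where
        id : ∀ t q → t + q * t + 2 * t ≡ (q + 3) * t
        id = solve-∀

    -- That is ab ≤ 1 + b with a and b rounded up on the left and b rounded down on the right. The
    -- integers q₁ q₄ < d² differ by at least 1, which leaves t² for the rounding errors.
    α′ω′≤ : (t + α₁ + 2) * (ω + 2) ≤ t * t + t * ω
    α′ω′≤ = ℕ.*-cancelʳ-≤ _ _ (d * d) {{ℕ.m*n≢0 d d}} (begin
      (t + α₁ + 2) * (ω + 2) * (d * d)
        ≡⟨ id₁ t α₁ ω d ⟩
      t * ω * (d * d) + ((α₁ * d) * (ω * d) + (2 * d * (ω * d) + 2 * d * (α₁ * d) +
          (2 * d * d * t + 4 * d * d * 1)))
        ≤⟨ ℕ.+-monoʳ-≤ (t * ω * (d * d)) (ℕ.+-mono-≤ (ℕ.*-mono-≤ α₁d≤ ωd≤)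
             (ℕ.+-mono-≤ (ℕ.+-mono-≤ (ℕ.*-monoʳ-≤ (2 * d) ωd≤) (ℕ.*-monoʳ-≤ (2 * d) α₁d≤))
               (ℕ.+-monoʳ-≤ (2 * d * d * t) (ℕ.*-monoʳ-≤ (4 * d * d) (>-nonZero⁻¹ t))))) ⟩
      t * ω * (d * d) + ((q₄ * t) * (q₁ * t) + (2 * d * (q₁ * t) + 2 * d * (q₄ * t) +
          (2 * d * d * t + 4 * d * d * t)))
        ≡⟨ id₂ t ω d q₁ q₄ ⟩
      t * ω * (d * d) + (q₁ * q₄ * (t * t) + (2 * d * q₁ + 2 * d * q₄ + 6 * d * d) * t)
        ≤⟨ ℕ.+-monoʳ-≤ (t * ω * (d * d)) (ℕ.+-monoʳ-≤ (q₁ * q₄ * (t * t)) (ℕ.*-monoˡ-≤ t threshold≤t)) ⟩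
      t * ω * (d * d) + (q₁ * q₄ * (t * t) + t * t)
        ≡⟨ cong (λ z → t * ω * (d * d) + z) (ℕ.+-comm (q₁ * q₄ * (t * t)) (t * t)) ⟩
      t * ω * (d * d) + suc (q₁ * q₄) * (t * t)
        ≤⟨ ℕ.+-monoʳ-≤ (t * ω * (d * d)) (ℕ.*-monoˡ-≤ (t * t) q₁q₄<d²) ⟩
      t * ω * (d * d) + d * d * (t * t)
        ≡⟨ id₃ t ω d ⟩
      (t * t + t * ω) * (d * d) ∎)
      where
        open ℕ.≤-Reasoning
        id₁ : ∀ t α₁ ω d → (t + α₁ + 2) * (ω + 2) * (d * d) ≡
          t * ω * (d * d) + ((α₁ * d) * (ω * d) + (2 * d * (ω * d) + 2 * d * (α₁ * d) +
              (2 * d * d * t + 4 * d * d * 1)))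
        id₁ = solve-∀
        id₂ : ∀ t ω d q₁ q₄ →
          t * ω * (d * d) + ((q₄ * t) * (q₁ * t) + (2 * d * (q₁ * t) + 2 * d * (q₄ * t) +
              (2 * d * d * t + 4 * d * d * t))) ≡
          t * ω * (d * d) + (q₁ * q₄ * (t * t) + (2 * d * q₁ + 2 * d * q₄ + 6 * d * d) * t)
        id₂ = solve-∀
        id₃ : ∀ t ω d → t * ω * (d * d) + d * d * (t * t) ≡ (t * t + t * ω) * (d * d)
        id₃ = solve-∀

-- Enclosing the exponents and powers of the target

module TargetExponents where

  open import Data.Nat using (_+_; _*_; _^_; _∸_; _≤_; _<_; _/_)
  open import Data.Rational.Properties
  open import Defs hiding (_≤_; _<_; _+_; _-_; _*_; _/_; _⊓_; _^_; _⁻¹)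
  import Defs as ℝ
  open Rationals using
    ( mulˡ-≤; *-nonneg; *-pos; ≤-by; 0≤1; _÷_; ÷-≤; ÷-≡; ÷-+; ÷-*; ÷-nonneg; ÷-pos; ÷-cancel; ℕtoℚ-nonneg )
  open Enclosures
  open Powers
  open Approximation
  open Parameters using (module Exponents)

  ≤-minus : ∀ {p q r} → p ℚ.+ q ℚ.≤ r → p ℚ.≤ r ℚ.- q
  ≤-minus {p} {q} {r} le = subst (ℚ._≤ r ℚ.- q) (solve 2 (λ p q → p :+ q :- q := p) refl p q)
      (+-monoˡ-≤ (ℚ.- q) le)
    where open +-*-Solver

  minus-≤ : ∀ {p q r} → r ℚ.≤ p ℚ.+ q → r ℚ.- q ℚ.≤ p
  minus-≤ {p} {q} {r} le = subst (r ℚ.- q ℚ.≤_) (solve 2 (λ p q → p :+ q :- q := p) refl p q)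
      (+-monoˡ-≤ (ℚ.- q) le)
    where open +-*-Solver

  ÷-self : ∀ i .{{_ : NonZero i}} → i ÷ i ≡ 1ℚ
  ÷-self i = ÷-≡ {i} {1} {i} {1} (trans (ℕ.*-identityʳ i) (sym (ℕ.*-identityˡ i)))

  ÷-inverse : ∀ i j .{{_ : NonZero i}} .{{_ : NonZero j}} → i ÷ j ℚ.* (j ÷ i) ≡ 1ℚ
  ÷-inverse i j = trans (÷-* i j j i) (÷-≡ {i * j} {1} {j * i} {1} {{ℕ.m*n≢0 j i}}
    (trans (ℕ.*-identityʳ (i * j)) (trans (ℕ.*-comm i j) (sym (ℕ.*-identityˡ (j * i))))))

  module Encloses {a b : Cut} (g : Gap a b) (N t : ℕ) .{{_ : NonZero t}} (ap : Approximants g t)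
    (threshold≤t : Gap.threshold g ≤ t)
    (2N+2≤t : 2 * N + 2 ≤ t) where

    open Gap g using (d; q₁; q₁<d)
    open Approximants ap public
    open Rounded g t ap threshold≤t public
    open Exponents t ω τ α₁ A N t≡ω+τ 0<τ 2N+2≤t α′≤At α′ω′≤ public
      using (α; α′; ω′; Γ; α≢0; α′≢0; Γ≢0; tτ≤Γ; Γ+α′ω′≡2t²; u; v₁; v; Y; Y*t≤)

    private
      instance
        _ = α≢0
        _ = α′≢0
        _ = Γ≢0
        τ≢0 : NonZero τ
        τ≢0 = >-nonZero 0<τ
        tt≢0 : NonZero (t * t)
        tt≢0 = ℕ.m*n≢0 t t

    k : Cut
    k = (fromℕ 2 ℝ.- a ℝ.* b) ℝ./ (fromℕ 1 ℝ.- b)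

    2-ab∈ : ∃ λ q → fromℕ 2 ℝ.- a ℝ.* b ∈[ Γ ÷ (t * t) , q ]
    2-ab∈ = _ , ∈-widen (∈-minus (∈-fromℚ (ℕtoℚ 2)) (∈-* (÷-nonneg α t) (÷-nonneg ω t) a∈ b∈))
      (≤-minus (≤-reflexive (begin
        Γ ÷ (t * t) ℚ.+ α′ ÷ t ℚ.* (ω′ ÷ t)             ≡⟨ cong (Γ ÷ (t * t) ℚ.+_) (÷-* α′ ω′ t t) ⟩
        Γ ÷ (t * t) ℚ.+ (α′ * ω′) ÷ (t * t)         ≡⟨ ÷-+ Γ (α′ * ω′) (t * t) ⟩
        (Γ + α′ * ω′) ÷ (t * t)                     ≡⟨ ÷-≡ {Γ + α′ * ω′} {2} {t * t} {1}
              (trans (ℕ.*-identityʳ _) Γ+α′ω′≡2t²) ⟩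
        ℕtoℚ 2 ∎)))
      ≤-refl
      where open ≡-Reasoning

    1-b∈ : fromℕ 1 ℝ.- b ∈[ 1 ÷ d , τ ÷ t ]
    1-b∈ = ∈-widen (∈-minus (∈-fromℚ 1ℚ) b<)
      (≤-minus (≤-trans (≤-reflexive (÷-+ 1 q₁ d)) (÷-≤ {suc q₁} {1} {d} {1}
          (subst₂ _≤_ (sym (ℕ.*-identityʳ (suc q₁))) (sym (ℕ.*-identityˡ d)) q₁<d))))
      (minus-≤ (≤-reflexive (begin
        1ℚ                    ≡⟨ ÷-self t ⟨
        t ÷ t                 ≡⟨ cong (_÷ t) (trans t≡ω+τ (ℕ.+-comm ω τ)) ⟩
        (τ + ω) ÷ t         ≡⟨ ÷-+ τ ω t ⟨
        τ ÷ t ℚ.+ ω ÷ t ∎)))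
      where open ≡-Reasoning

    -- Only the upper end is informative, as 1 - 1/k is wanted from below; it combines the lower end
    -- of 2 - ab with the upper end of 1 - b. The lower end 1/d of 1 - b serves to make the inner
    -- reciprocal meaningful.
    1/k∈ : k ℝ.⁻¹ ∈[ 0ℚ , (t * τ) ÷ Γ ]
    1/k∈ = ∈-⁻¹ {i = 0ℚ} {(t * τ) ÷ Γ} (*-pos (÷-pos Γ (t * t)) (÷-pos t τ))
        (≤-trans (≤-reflexive (*-zeroˡ (proj₁ 2-ab∈ ℚ.* ℕtoℚ d))) 0≤1)
        (≤-reflexive (sym product≡1))
        (∈-* (÷-nonneg Γ (t * t)) (÷-nonneg t τ) (proj₂ 2-ab∈)
          (∈-⁻¹ {i = t ÷ τ} {ℕtoℚ d} (÷-pos 1 d) (≤-reflexive (÷-inverse t τ))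
              (≤-reflexive (sym (÷-cancel 1 d))) 1-b∈))
      where
        open ≡-Reasoning
        instance
          ttτ≢0 : NonZero (t * t * τ)
          ttτ≢0 = ℕ.m*n≢0 (t * t) τ
          Γttτ≢0 : NonZero (Γ * (t * t * τ))
          Γttτ≢0 = ℕ.m*n≢0 Γ (t * t * τ)
        arrange : ∀ t τ Γ → t * τ * (Γ * t) * 1 ≡ 1 * (Γ * (t * t * τ))
        arrange = solve-∀
        product≡1 : (t * τ) ÷ Γ ℚ.* (Γ ÷ (t * t) ℚ.* (t ÷ τ)) ≡ 1ℚ
        product≡1 = begin
          (t * τ) ÷ Γ ℚ.* (Γ ÷ (t * t) ℚ.* (t ÷ τ))        ≡⟨ cong ((t * τ) ÷ Γ ℚ.*_) (÷-* Γ t (t * t) τ) ⟩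
          (t * τ) ÷ Γ ℚ.* ((Γ * t) ÷ (t * t * τ))      ≡⟨ ÷-* (t * τ) (Γ * t) Γ (t * t * τ) ⟩
          (t * τ * (Γ * t)) ÷ (Γ * (t * t * τ))    ≡⟨ ÷-≡ {t * τ * (Γ * t)} {1} {Γ * (t * t * τ)} {1}
                (arrange t τ Γ) ⟩
          1ℚ ∎

    private
      complement : ∀ i j {m} .{{_ : NonZero m}} → i + j ≡ m → i ÷ m ℚ.≤ 1ℚ ℚ.- 1ℚ ℚ.* (j ÷ m)
      complement i j {m} eq = ≤-minus (≤-reflexive (begin
        i ÷ m ℚ.+ 1ℚ ℚ.* (j ÷ m)   ≡⟨ cong (i ÷ m ℚ.+_) (*-identityˡ (j ÷ m)) ⟩
        i ÷ m ℚ.+ j ÷ m            ≡⟨ ÷-+ i j m ⟩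
        (i + j) ÷ m              ≡⟨ trans (cong (_÷ m) eq) (÷-self m) ⟩
        1ℚ ∎))
        where open ≡-Reasoning
      1-≤1 : ∀ {x} → 0ℚ ℚ.≤ x → 1ℚ ℚ.- 1ℚ ℚ.* x ℚ.≤ 1ℚ
      1-≤1 {x} 0≤x = minus-≤ {1ℚ} {1ℚ ℚ.* x} {1ℚ} (≤-by (1ℚ ℚ.* x) (*-nonneg 0≤1 0≤x) refl)

    1-1/k∈ : fromℕ 1 ℝ.- fromℕ 1 ℝ./ k ∈[ (Γ ∸ t * τ) ÷ Γ , ℕtoℚ 1 ]
    1-1/k∈ = ∈-widen (∈-minus (∈-fromℚ 1ℚ) (∈-* 0≤1 ≤-refl (∈-fromℚ 1ℚ) 1/k∈))
      (complement (Γ ∸ t * τ) (t * τ) (ℕ.m∸n+n≡m tτ≤Γ)) (1-≤1 ≤-refl)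

    1/a∈ : a ℝ.⁻¹ ∈[ t ÷ α′ , t ÷ α ]
    1/a∈ = ∈-⁻¹ (÷-pos α t) (≤-reflexive (÷-inverse t α′)) (≤-reflexive (sym (÷-inverse t α))) a∈

    1-1/a∈ : fromℕ 1 ℝ.- fromℕ 1 ℝ./ a ∈[ α₁ ÷ α , ℕtoℚ 1 ]
    1-1/a∈ = ∈-widen (∈-minus (∈-fromℚ 1ℚ) (∈-* 0≤1 (÷-nonneg t α′) (∈-fromℚ 1ℚ) 1/a∈))
      (complement α₁ t (ℕ.+-comm α₁ t)) (1-≤1 (÷-nonneg t α′))

    2/a∈ : fromℕ 2 ℝ./ a ∈[ (2 * t) ÷ α′ , ℕtoℚ 2 ]
    2/a∈ = ∈-widen (∈-* (ℕtoℚ-nonneg 2) (÷-nonneg t α′) (∈-fromℚ (ℕtoℚ 2)) 1/a∈)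
      (≤-reflexive (sym (trans (÷-* 2 t 1 α′) (÷-≡ {2 * t} {2 * t} {1 * α′} {α′} {{ℕ.m*n≢0 1 α′}}
          (cong (2 * t *_) (sym (ℕ.*-identityˡ α′)))))))
      (≤-trans (mulˡ-≤ (ℕtoℚ-nonneg 2) (÷-≤ {t} {1} {α} {1}
          (subst₂ _≤_ (sym (ℕ.*-identityʳ t)) (sym (ℕ.*-identityˡ α)) (ℕ.m≤m+n t α₁))))
               (≤-reflexive (*-identityʳ (ℕtoℚ 2))))

    a∈′ : a ∈[ α ÷ t , ℕtoℚ A ]
    a∈′ = ∈-widen a∈ ≤-refl (÷-≤ {α′} {A} {t} {1} (subst (_≤ A * t) (sym (ℕ.*-identityʳ α′)) α′≤At))

    b∈′ : b ∈[ ω ÷ t , ℕtoℚ 1 ]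
    b∈′ = ∈-widen b< ≤-refl (÷-≤ {q₁} {1} {d} {1} (subst₂ _≤_ (sym (ℕ.*-identityʳ q₁)) (sym (ℕ.*-identityˡ d))
        (ℕ.<⇒≤ q₁<d)))

    2^-power : ∀ {m y} .{{_ : NonZero m}} i τ .{{_ : NonZero τ}} i′ e w → y ∈[ i ÷ τ , ℕtoℚ i′ ] →
               2 ^ w ≤ m → e * τ ≤ w * i → m ℝ.^ y ∈[ ℕtoℚ (2 ^ e) , ℕtoℚ (m ^ i′) ]
    2^-power {m} i τ i′ e w y∈ 2^w≤m eτ≤wi = ∈-^ m i τ i′ (2 ^ e) y∈ (begin
      (2 ^ e) ^ τ    ≡⟨ ℕ.^-*-assoc 2 e τ ⟩
      2 ^ (e * τ)    ≤⟨ ℕ.^-monoʳ-≤ 2 eτ≤wi ⟩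
      2 ^ (w * i)    ≡⟨ ℕ.^-*-assoc 2 w i ⟨
      (2 ^ w) ^ i    ≤⟨ ℕ.^-monoˡ-≤ i 2^w≤m ⟩
      m ^ i ∎)
      where open ℕ.≤-Reasoning

    p^[1-1/k]∈ : ∀ {p w} .{{_ : NonZero p}} → 2 ^ w ≤ p →
      p ℝ.^ (fromℕ 1 ℝ.- fromℕ 1 ℝ./ k) ∈[ ℕtoℚ (2 ^ u w) , ℕtoℚ (p ^ 1) ]
    p^[1-1/k]∈ {w = w} le = 2^-power (Γ ∸ t * τ) Γ 1 (u w) w 1-1/k∈ le (ℕ.m/n*n≤m (w * (Γ ∸ t * τ)) Γ)

    p^[1-1/a]∈ : ∀ {p w} .{{_ : NonZero p}} → 2 ^ w ≤ p →
      p ℝ.^ (fromℕ 1 ℝ.- fromℕ 1 ℝ./ a) ∈[ ℕtoℚ (2 ^ (w * α₁ / α)) , ℕtoℚ (p ^ 1) ]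
    p^[1-1/a]∈ {w = w} le = 2^-power α₁ α 1 (w * α₁ / α) w 1-1/a∈ le (ℕ.m/n*n≤m (w * α₁) α)

    n^[2/a]∈ : ∀ {n} .{{_ : NonZero n}} → 2 ^ N ≤ n →
      n ℝ.^ (fromℕ 2 ℝ./ a) ∈[ ℕtoℚ (2 ^ (2 * N * t / α′)) , ℕtoℚ (n ^ 2) ]
    n^[2/a]∈ le = 2^-power (2 * t) α′ 2 (2 * N * t / α′) N 2/a∈ le
      (ℕ.≤-trans (ℕ.m/n*n≤m (2 * N * t) α′) (ℕ.≤-reflexive (id N t)))
      where
        id : ∀ N t → 2 * N * t ≡ N * (2 * t)
        id = solve-∀

    2^x≤s^b : ∀ {σ x} → x * t ≤ ω * σ → fromℕ (2 ^ x) ℝ.≤ (2 ^ σ) ℝ.^ b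
    2^x≤s^b {σ} {x} le = fromℚ-≤ (2^-power {{ℕ.m^n≢0 2 σ}} ω t 1 x σ b∈′ ℕ.≤-refl
        (subst (x * t ≤_) (ℕ.*-comm ω σ) le)) ≤-refl

    β^a∈ : ∀ x → (2 ^ x) ℝ.^ a ∈[ ℕtoℚ (2 ^ Y x) , ℕtoℚ ((2 ^ x) ^ A) ]
    β^a∈ x = 2^-power {{ℕ.m^n≢0 2 x}} α t A (Y x) x a∈′ ℕ.≤-refl
      (ℕ.≤-trans (Y*t≤ x) (ℕ.≤-reflexive (ℕ.*-comm α x)))

-- Logarithms and the total overhead

module Growth where

  open import Data.Nat
  open import Data.Nat.Properties
  open import Data.Nat.Logarithm
  open import Data.Nat.Induction using (<-rec)

  2^⌊log₂n⌋≤n : ∀ n .{{_ : NonZero n}} → 2 ^ ⌊log₂ n ⌋ ≤ n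
  2^⌊log₂n⌋≤n n = <-rec (λ n → 1 ≤ n → 2 ^ ⌊log₂ n ⌋ ≤ n) step n (>-nonZero⁻¹ n)
    where
      open ≤-Reasoning
      2*⌊n/2⌋≤n : ∀ n → 2 * ⌊ n /2⌋ ≤ n
      2*⌊n/2⌋≤n n = begin
        2 * ⌊ n /2⌋           ≡⟨ cong (⌊ n /2⌋ +_) (+-identityʳ ⌊ n /2⌋) ⟩
        ⌊ n /2⌋ + ⌊ n /2⌋     ≤⟨ +-monoʳ-≤ ⌊ n /2⌋ (⌊n/2⌋≤⌈n/2⌉ n) ⟩
        ⌊ n /2⌋ + ⌈ n /2⌉     ≡⟨ ⌊n/2⌋+⌈n/2⌉≡n n ⟩
        n ∎
      step : ∀ n → (∀ {m} → m < n → 1 ≤ m → 2 ^ ⌊log₂ m ⌋ ≤ m) → 1 ≤ n → 2 ^ ⌊log₂ n ⌋ ≤ n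
      step 1 rec _ = ≤-reflexive (cong (2 ^_) (⌊log₂[2^n]⌋≡n 0))
      step n@(suc (suc k)) rec _ = begin
        2 ^ ⌊log₂ n ⌋              ≡⟨ cong (2 ^_) log≡ ⟩
        2 * 2 ^ ⌊log₂ ⌊ n /2⌋ ⌋    ≤⟨ *-monoʳ-≤ 2 (rec (⌊n/2⌋<n (suc k)) (s≤s z≤n)) ⟩
        2 * ⌊ n /2⌋                ≤⟨ 2*⌊n/2⌋≤n n ⟩
        n ∎
        where
          1≤log : 1 ≤ ⌊log₂ n ⌋
          1≤log = subst (_≤ ⌊log₂ n ⌋) (⌊log₂[2^n]⌋≡n 1) (⌊log₂⌋-mono-≤ {2} {n} (s≤s (s≤s z≤n)))
          log≡ : ⌊log₂ n ⌋ ≡ suc ⌊log₂ ⌊ n /2⌋ ⌋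
          log≡ = trans (sym (m+[n∸m]≡n 1≤log)) (cong suc (sym (⌊log₂⌊n/2⌋⌋≡⌊log₂n⌋∸1 n)))

  n<2^[1+⌊log₂n⌋] : ∀ n → n < 2 ^ suc ⌊log₂ n ⌋
  n<2^[1+⌊log₂n⌋] n = ≰⇒> λ le → 1+n≰n (subst (_≤ ⌊log₂ n ⌋) (⌊log₂[2^n]⌋≡n (suc ⌊log₂ n ⌋))
      (⌊log₂⌋-mono-≤ le))

  n<2^n : ∀ n → n < 2 ^ n
  n<2^n zero    = s≤s z≤n
  n<2^n (suc n) = begin-strict
    suc n              ≤⟨ n<2^n n ⟩
    2 ^ n              <⟨ m<m+n (2 ^ n) (m^n>0 2 n) ⟩
    2 ^ n + 2 ^ n      ≡⟨ cong (2 ^ n +_) (sym (+-identityʳ (2 ^ n))) ⟩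
    2 ^ suc n ∎
    where open ≤-Reasoning

  2^-cancel-< : ∀ {a b} → 2 ^ a < 2 ^ b → a < b
  2^-cancel-< {a} {b} lt = ≰⇒> λ b≤a → <⇒≱ lt (^-monoʳ-≤ 2 b≤a)

  ⌊log₂n⌋≤n : ∀ n → ⌊log₂ n ⌋ ≤ n
  ⌊log₂n⌋≤n zero      = z≤n
  ⌊log₂n⌋≤n n@(suc _) = <⇒≤ (<-≤-trans (n<2^n ⌊log₂ n ⌋) (2^⌊log₂n⌋≤n n))

  module Polynomial {I : Set} (Y : I → ℕ) (1≤Y : ∀ i → 1 ≤ Y i) where

    private instance
      Y≢0 : ∀ {i} → NonZero (Y i)
      Y≢0 {i} = >-nonZero (1≤Y i)

    -- The constants are uniform in the index. The closure properties below assemble them, so that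
    -- no explicit exponent of the overhead has to be written down.
    PolyIn : (I → ℕ) → Set
    PolyIn f = ∃₂ λ K g → ∀ i → f i ≤ K * Y i ^ g

    open ≤-Reasoning

    poly-mono : ∀ {f f′} → (∀ i → f i ≤ f′ i) → PolyIn f′ → PolyIn f
    poly-mono f≤f′ (K , g , f′≤) = K , g , λ i → ≤-trans (f≤f′ i) (f′≤ i)

    poly-* : ∀ {f f′} → PolyIn f → PolyIn f′ → PolyIn (λ i → f i * f′ i)
    poly-* {f} {f′} (K , g , f≤) (L , h , f′≤) = K * L , g + h , λ i → begin
      f i * f′ i                         ≤⟨ *-mono-≤ (f≤ i) (f′≤ i) ⟩
      K * Y i ^ g * (L * Y i ^ h)        ≡⟨ [m*n]*[o*p]≡[m*o]*[n*p] K (Y i ^ g) L (Y i ^ h) ⟩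
      K * L * (Y i ^ g * Y i ^ h)        ≡⟨ cong (K * L *_) (^-distribˡ-+-* (Y i) g h) ⟨
      K * L * Y i ^ (g + h) ∎

    poly-+ : ∀ {f f′} → PolyIn f → PolyIn f′ → PolyIn (λ i → f i + f′ i)
    poly-+ {f} {f′} (K , g , f≤) (L , h , f′≤) = K + L , g + h , λ i → begin
      f i + f′ i                               ≤⟨ +-mono-≤ (f≤ i) (f′≤ i) ⟩
      K * Y i ^ g + L * Y i ^ h                ≤⟨ +-mono-≤ (*-monoʳ-≤ K (^-monoʳ-≤ (Y i) (m≤m+n g h)))
            (*-monoʳ-≤ L (^-monoʳ-≤ (Y i) (m≤n+m h g))) ⟩
      K * Y i ^ (g + h) + L * Y i ^ (g + h)    ≡⟨ *-distribʳ-+ (Y i ^ (g + h)) K L ⟨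
      (K + L) * Y i ^ (g + h) ∎

    poly-const : ∀ c → PolyIn (λ _ → c)
    poly-const c = c , 0 , λ _ → ≤-reflexive (sym (*-identityʳ c))

    poly-^ : ∀ {f} e → PolyIn f → PolyIn (λ i → f i ^ e)
    poly-^ zero    _  = poly-const 1
    poly-^ (suc e) pf = poly-* pf (poly-^ e pf)

    poly-≤ : ∀ {f} → (∀ i → f i ≤ Y i) → PolyIn f
    poly-≤ f≤Y = 1 , 1 , λ i → ≤-trans (f≤Y i) (≤-reflexive
        (sym (trans (*-identityˡ (Y i ^ 1)) (*-identityʳ (Y i)))))

  -- The quantities of the recursion, for weights bounded by n ^ c and a hopset algorithm
  -- whose bound is C′ * (log s * (1 + m)) ^ e′.

  module Quantities (c C′ e′ A N m₀ : ℕ) where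

    scaleCount precision hidden sampleLog total θ : ℕ
    scaleCount = suc (suc N * (2 * c + 1))
    -- There are at most 2N + 2 levels, each adding 10/m to the error; with this m the sum is at
    -- most 1/m₀.
    precision  = 10 * (2 * N + 2) * m₀
    hidden     = C′ * (suc N * suc precision) ^ e′
    sampleLog  = 3 * N + 3
    -- The power 2^θ has to dominate three quantities; exceeding their sum by a factor of at most 2,
    -- it remains polynomial in them.
    total      = scaleCount * hidden + precision + sampleLog
    θ          = suc ⌊log₂ total ⌋

    total≤2^θ : total ≤ 2 ^ θ
    total≤2^θ = <⇒≤ (n<2^[1+⌊log₂n⌋] total)

    total>0 : 1 ≤ total
    total>0 = ≤-trans (s≤s z≤n) (≤-trans (m≤n+m 3 (3 * N))
        (m≤n+m (3 * N + 3) (scaleCount * hidden + precision)))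

    2^θ≤ : 2 ^ θ ≤ 2 * total
    2^θ≤ = *-monoʳ-≤ 2 (2^⌊log₂n⌋≤n total {{>-nonZero total>0}})

    overhead : ℕ → ℕ
    overhead π = suc π * (2 ^ (3 * θ + (2 * A + 16)) * sampleLog)

  -- Everything is polynomial in log n and m₀, including 2^(3θ), since 2^θ is at most twice a
  -- polynomial. The constants depend on the weight exponent, the hopset constants and the bound A
  -- for a.
  overhead≤ : ∀ c C′ e′ A → ∃₂ λ C e → ∀ N m₀ π → π ≤ 2 * N + 2 →
              Quantities.overhead c C′ e′ A N m₀ π ≤ C * (suc N + m₀) ^ e
  overhead≤ c C′ e′ A =
    let C , e , le = bound in
    C , e , λ N m₀ π π≤ → ≤-trans (*-monoˡ-≤ (2 ^ (3 * Q.θ N m₀ + (2 * A + 16)) * Q.sampleLog N m₀) (s≤s π≤))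
        (le (N , m₀))
    where
      module Q = Quantities c C′ e′ A
      open Polynomial {ℕ × ℕ} (λ (N , m₀) → suc N + m₀) (λ _ → s≤s z≤n)
      on : (ℕ → ℕ → ℕ) → ℕ × ℕ → ℕ
      on f (N , m₀) = f N m₀
      N-poly : PolyIn (on λ N _ → N)
      N-poly = poly-≤ λ (N , m₀) → ≤-trans (n≤1+n N) (m≤m+n (suc N) m₀)
      sucN : PolyIn (on λ N _ → suc N)
      sucN = poly-≤ λ (N , m₀) → m≤m+n (suc N) m₀
      2N+2 : PolyIn (on λ N _ → 2 * N + 2)
      2N+2 = poly-+ (poly-* (poly-const 2) N-poly) (poly-const 2)
      precision : PolyIn (on Q.precision)
      precision = poly-* (poly-* (poly-const 10) 2N+2) (poly-≤ λ (N , m₀) → m≤n+m m₀ (suc N))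
      sampleLog : PolyIn (on Q.sampleLog)
      sampleLog = poly-+ (poly-* (poly-const 3) N-poly) (poly-const 3)
      scaleCount : PolyIn (on Q.scaleCount)
      scaleCount = poly-+ (poly-const 1) (poly-* sucN (poly-const (2 * c + 1)))
      hidden : PolyIn (on Q.hidden)
      hidden = poly-* (poly-const C′) (poly-^ e′ (poly-* sucN (poly-+ (poly-const 1) precision)))
      total : PolyIn (on Q.total)
      total = poly-+ (poly-+ (poly-* scaleCount hidden) precision) sampleLog
      2^θ : PolyIn (on λ N m₀ → 2 ^ Q.θ N m₀)
      2^θ = poly-mono (λ (N , m₀) → Q.2^θ≤ N m₀) (poly-* (poly-const 2) total)
      2^[3θ+c] : PolyIn (on λ N m₀ → 2 ^ (3 * Q.θ N m₀ + (2 * A + 16)))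
      2^[3θ+c] = poly-mono (λ (N , m₀) → ≤-reflexive (split (Q.θ N m₀)))
          (poly-* (poly-^ 3 2^θ) (poly-const (2 ^ (2 * A + 16))))
        where
          split : ∀ θ → 2 ^ (3 * θ + (2 * A + 16)) ≡ (2 ^ θ) ^ 3 * 2 ^ (2 * A + 16)
          split θ = trans (^-distribˡ-+-* 2 (3 * θ) (2 * A + 16))
            (cong (_* 2 ^ (2 * A + 16)) (trans (cong (2 ^_) (*-comm 3 θ)) (sym (^-*-assoc 2 θ 3))))
      bound : PolyIn (on λ N m₀ → suc (2 * N + 2) * (2 ^ (3 * Q.θ N m₀ + (2 * A + 16)) * Q.sampleLog N m₀))
      bound = poly-* (poly-+ (poly-const 1) 2N+2) (poly-* 2^[3θ+c] sampleLog)

-- The precision ε and the hidden factors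

module Errors where

  open import Data.Nat using (_+_; _*_; _^_; _≤_; _<_; _/_)
  open import Data.Nat.Logarithm using (⌊log₂_⌋)
  open import Data.Rational.Properties
  open import Function.Bundles using (module Equivalence)
  open import Defs hiding (_≤_; _<_; _+_; _-_; _*_; _/_; _⊓_; _^_; _⁻¹)
  import Defs as ℝ
  open Rationals using
    ( mulˡ-≤; mulʳ-≤; mul-≤; *-nonneg; +-nonneg; 0≤1; recip; archimedean; _÷_; ÷-≤; ÷-≤⁻¹; ÷-≡; ÷-+; ÷-*;
      ÷-nonneg; ÷-pos; ÷-cancel; ℕtoℚ-≤; ℕtoℚ-nonneg; ℕtoℚ-+; ℕtoℚ-*; ℕtoℚ-^; ^-nonneg; ^-mono-≤; *-^ )
    renaming (_^_ to _^ℚ_)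
  open Enclosures
  open Approximation
  open TargetExponents using (÷-inverse)
  open Parameters using (m<suc[m/n]*n)
  open Growth using (⌊log₂n⌋≤n)

  record Precision (ε : Cut) : Set where
    field
      m₀      : ℕ
      {{m₀≢0}} : NonZero m₀
      ε∈      : ε ∈[ 1 ÷ m₀ , 6 ÷ m₀ ]

  -- A fraction κ/M approximates ε, with M so large that κ ≥ 1 is possible, and m₀ is M/κ rounded
  -- up. The factor 6 is 3 · 2: κ + 2 ≤ 3κ, and m₀ κ ≤ 2M because κ ≤ M.
  precision : ∀ {ε} → IsReal ε → fromℕ 0 ℝ.< ε → ε ℝ.< fromℕ 1 → Precision ε
  precision {ε} R (q₀ , 0<q₀ , Lq₀) (q₁ , Uq₁ , q₁<1) = build (approximate R M 1 L1/M {1} U1)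
    where
      M-1 = proj₁ (archimedean (proj₁ (recip 0<q₀)))
      M = suc M-1
      1/M≤q₀ : 1 ÷ M ℚ.≤ q₀
      1/M≤q₀ = ≤-trans (≤-reflexive (sym (*-identityʳ (1 ÷ M)))) (≤-trans
        (mulˡ-≤ (÷-nonneg 1 M) (≤-trans (≤-reflexive (sym (proj₂ (proj₂ (recip 0<q₀)))))
          (mulʳ-≤ (<⇒≤ 0<q₀) (≤-trans (proj₂ (archimedean (proj₁ (recip 0<q₀)))) (ℕtoℚ-≤ (ℕ.n≤1+n M-1))))))
        (≤-reflexive (trans (solve 3 (λ i m q → i :* (m :* q) := m :* i :* q) refl (1 ÷ M) (ℕtoℚ M) q₀)
          (trans (cong (ℚ._* q₀) (÷-cancel 1 M)) (*-identityˡ q₀)))))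
        where open +-*-Solver
      L1/M : ∀ r → r ℚ.< 1 ÷ M → L ε r
      L1/M r r< = L-below R Lq₀ r (<-≤-trans r< 1/M≤q₀)
      U1 : U ε 1ℚ
      U1 = Equivalence.from (IsReal.roundedᵘ R 1ℚ) (q₁ , q₁<1 , Uq₁)
      build : (∃ λ e → (∀ r → r ℚ.< (1 + e) ÷ M → L ε r) × U ε ((1 + e + 2) ÷ M)) → Precision ε
      build (e , Le , Ue) = record { m₀ = m₀ ; ε∈ = ∈-widen I lower′ upper′ }
        where
          κ = suc e
          m₀ = suc (M / κ)
          I : ε ∈[ κ ÷ M , (κ + 2) ÷ M ]
          I = real∈ R Le Ue
          κ≤M : κ ≤ M
          κ≤M = subst₂ _≤_ (ℕ.*-identityʳ κ) (ℕ.*-identityˡ M) (÷-≤⁻¹ {κ} {1} {M} {1} (above I 1ℚ U1))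
          lower′ : 1 ÷ m₀ ℚ.≤ κ ÷ M
          lower′ = ÷-≤ {1} {κ} {m₀} {M} (subst₂ _≤_ (sym (ℕ.*-identityˡ M)) (ℕ.*-comm m₀ κ)
              (ℕ.<⇒≤ (m<suc[m/n]*n M κ)))
          upper′ : (κ + 2) ÷ M ℚ.≤ 6 ÷ m₀
          upper′ = ÷-≤ {κ + 2} {6} {M} {m₀} (begin
            (κ + 2) * m₀                    ≤⟨ ℕ.*-monoˡ-≤ m₀
                  (ℕ.+-monoʳ-≤ κ (ℕ.*-monoʳ-≤ 2 (s≤s (z≤n {e})))) ⟩
            (κ + 2 * κ) * m₀              ≡⟨ id₁ κ (M / κ) ⟩
            3 * (κ + M / κ * κ)         ≤⟨ ℕ.*-monoʳ-≤ 3 (ℕ.+-mono-≤ κ≤M (ℕ.m/n*n≤m M κ)) ⟩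
            3 * (M + M)                     ≡⟨ id₂ M ⟩
            6 * M ∎)
            where
              open ℕ.≤-Reasoning
              id₁ : ∀ k x → (k + 2 * k) * suc x ≡ 3 * (k + x * k)
              id₁ = solve-∀
              id₂ : ∀ M → 3 * (M + M) ≡ 6 * M
              id₂ = solve-∀

  Hidden-upper : ∀ C e s m .{{_ : NonZero m}} →
    Hidden C e s (fromℚ (1 ÷ m)) ∈[ 0ℚ , ℕtoℚ (C * (log s * suc m) ^ e) ]
  Hidden-upper C e s m = ∈-widen
    (∈-* (ℕtoℚ-nonneg C) (^-nonneg e 0≤X) (∈-fromℚ (ℕtoℚ C)) (∈-^ℕ e 0≤X
      (∈-* (ℕtoℚ-nonneg (log s)) 0≤1+m (∈-fromℚ (ℕtoℚ (log s)))
        (∈-+ (∈-fromℚ 1ℚ) (∈-⁻¹ {i = ℕtoℚ m} {ℕtoℚ m} (÷-pos 1 m) (≤-reflexive (÷-cancel 1 m))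
            (≤-reflexive (sym (÷-cancel 1 m))) (∈-fromℚ (1 ÷ m)))))))
    (*-nonneg (ℕtoℚ-nonneg C) (^-nonneg e 0≤X))
    (≤-reflexive (begin
      ℕtoℚ C ℚ.* (ℕtoℚ (log s) ℚ.* (1ℚ ℚ.+ ℕtoℚ m)) ^ℚ e
        ≡⟨ cong (λ z → ℕtoℚ C ℚ.* (ℕtoℚ (log s) ℚ.* z) ^ℚ e) (ℕtoℚ-+ 1 m) ⟨
      ℕtoℚ C ℚ.* (ℕtoℚ (log s) ℚ.* ℕtoℚ (suc m)) ^ℚ e
        ≡⟨ cong (λ z → ℕtoℚ C ℚ.* z ^ℚ e) (ℕtoℚ-* (log s) (suc m)) ⟨
      ℕtoℚ C ℚ.* ℕtoℚ (log s * suc m) ^ℚ e                 ≡⟨ cong (ℕtoℚ C ℚ.*_) (ℕtoℚ-^ (log s * suc m) e) ⟨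
      ℕtoℚ C ℚ.* ℕtoℚ ((log s * suc m) ^ e)              ≡⟨ ℕtoℚ-* C ((log s * suc m) ^ e) ⟨
      ℕtoℚ (C * (log s * suc m) ^ e) ∎))
    where
      open ≡-Reasoning
      0≤1+m : 0ℚ ℚ.≤ 1ℚ ℚ.+ ℕtoℚ m
      0≤1+m = +-nonneg 0≤1 (ℕtoℚ-nonneg m)
      0≤X : 0ℚ ℚ.≤ ℕtoℚ (log s) ℚ.* (1ℚ ℚ.+ ℕtoℚ m)
      0≤X = *-nonneg (ℕtoℚ-nonneg (log s)) 0≤1+m

  module FinalError (ε : Cut) (P : Precision ε) (n : ℕ) where

    open Precision P

    ε′ : Cut
    ε′ = fromℕ 1 ℝ.* ε ℝ.* fromℕ (loglog n)

    private
      ll = loglog n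
      l = log n
      ll≤l : ll ≤ l
      ll≤l = s≤s (⌊log₂n⌋≤n ⌊log₂ n ⌋)
      instance
        6ll≢0 : NonZero (6 * ll)
        6ll≢0 = ℕ.m*n≢0 6 ll

    -- The factor loglog n is at least 1, so ε′ ≥ 1/m₀ and a stretch of 1 + 1/m₀ is good enough.
    ε′∈ : ε′ ∈[ 1 ÷ m₀ , 6 ÷ m₀ ℚ.* ℕtoℚ ll ]
    ε′∈ = ∈-widen (∈-* (*-nonneg 0≤1 0≤1/m₀) (ℕtoℚ-nonneg ll) (∈-* 0≤1 0≤1/m₀ (∈-fromℚ 1ℚ) ε∈)
        (∈-fromℚ (ℕtoℚ ll)))
      (≤-trans (≤-reflexive (sym (*-identityʳ (1 ÷ m₀))))
          (mul-≤ 0≤1/m₀ 0≤1 (≤-reflexive (sym (*-identityˡ (1 ÷ m₀)))) (ℕtoℚ-≤ {1} {ll} (s≤s z≤n))))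
      (≤-reflexive (cong (ℚ._* ℕtoℚ ll) (*-identityˡ (6 ÷ m₀))))
      where
        0≤1/m₀ = ÷-nonneg 1 m₀

    1/ε′∈ : ε′ ℝ.⁻¹ ∈[ m₀ ÷ (6 * ll) , ℕtoℚ m₀ ]
    1/ε′∈ = ∈-⁻¹ (÷-pos 1 m₀) (≤-reflexive product≡1) (≤-reflexive (sym (÷-cancel 1 m₀))) ε′∈
      where
        open ≡-Reasoning
        product≡1 : m₀ ÷ (6 * ll) ℚ.* (6 ÷ m₀ ℚ.* ℕtoℚ ll) ≡ 1ℚ
        product≡1 = begin
          m₀ ÷ (6 * ll) ℚ.* (6 ÷ m₀ ℚ.* ℕtoℚ ll)     ≡⟨ cong (m₀ ÷ (6 * ll) ℚ.*_) (trans (÷-* 6 ll m₀ 1)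
                                                               (÷-≡ {6 * ll} {6 * ll} {m₀ * 1} {m₀}
                                                                   {{ℕ.m*n≢0 m₀ 1}}
                                                                   (cong (6 * ll *_)
                                                                   (sym (ℕ.*-identityʳ m₀))))) ⟩
          m₀ ÷ (6 * ll) ℚ.* ((6 * ll) ÷ m₀)          ≡⟨ ÷-inverse m₀ (6 * ll) ⟩
          1ℚ ∎

    -- The target allows powers of 1/ε′ only, and 1/ε′ may be smaller than m₀ by a factor 6 loglog
    -- n. The factor log n that stands beside it makes up for loglog n; the 6 goes into the
    -- constant.
    sixth : (l + m₀) ÷ 6 ℚ.≤ ℕtoℚ l ℚ.* (1ℚ ℚ.+ m₀ ÷ (6 * ll))
    sixth = begin
      (l + m₀) ÷ 6                                  ≡⟨ ÷-+ l m₀ 6 ⟨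
      l ÷ 6 ℚ.+ m₀ ÷ 6                                ≤⟨ +-mono-≤
            (÷-≤ {l} {l} {6} {1} (ℕ.*-monoʳ-≤ l (s≤s z≤n)))
                                                           (÷-≤ {m₀} {l * m₀} {6} {6 * ll}
                                                               (ℕ.≤-trans (ℕ.≤-reflexive (id m₀ ll))
                                                               (ℕ.*-monoˡ-≤ 6 (ℕ.*-monoˡ-≤ m₀ ll≤l)))) ⟩
      ℕtoℚ l ℚ.+ (l * m₀) ÷ (6 * ll)             ≡⟨ cong (ℕtoℚ l ℚ.+_) (trans (÷-* l m₀ 1 (6 * ll))
                                                           (÷-≡ {l * m₀} {l * m₀} {1 * (6 * ll)} {6 * ll}
                                                               {{ℕ.m*n≢0 1 (6 * ll)}}
                                                               (cong (l * m₀ *_)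
                                                               (sym (ℕ.*-identityˡ (6 * ll)))))) ⟨
      ℕtoℚ l ℚ.+ ℕtoℚ l ℚ.* (m₀ ÷ (6 * ll))        ≡⟨ solve 2 (λ l x → l :+ l :* x := l :* (con 1ℚ :+ x)) refl
            (ℕtoℚ l) (m₀ ÷ (6 * ll)) ⟩
      ℕtoℚ l ℚ.* (1ℚ ℚ.+ m₀ ÷ (6 * ll)) ∎
      where
        open ≤-Reasoning
        open +-*-Solver
        id : ∀ m ll → m * (6 * ll) ≡ ll * m * 6
        id = solve-∀

    Hidden-lower : ∀ C e → ∃ λ q → Hidden (C * 6 ^ e) e n ε′ ∈[ ℕtoℚ (C * (l + m₀) ^ e) , q ]
    Hidden-lower C e = _ , ∈-widen
      (∈-* (ℕtoℚ-nonneg (C * 6 ^ e)) (^-nonneg e 0≤X) (∈-fromℚ (ℕtoℚ (C * 6 ^ e))) (∈-^ℕ e 0≤X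
        (∈-* (ℕtoℚ-nonneg l) (+-nonneg 0≤1 (÷-nonneg m₀ (6 * ll))) (∈-fromℚ (ℕtoℚ l))
            (∈-+ (∈-fromℚ 1ℚ) 1/ε′∈))))
      (begin
        ℕtoℚ (C * (l + m₀) ^ e)
          ≡⟨ trans (ℕtoℚ-* C ((l + m₀) ^ e)) (cong (ℕtoℚ C ℚ.*_) (ℕtoℚ-^ (l + m₀) e)) ⟩
        ℕtoℚ C ℚ.* ℕtoℚ (l + m₀) ^ℚ e
          ≡⟨ cong (λ z → ℕtoℚ C ℚ.* z ^ℚ e) (÷-cancel (l + m₀) 6) ⟨
        ℕtoℚ C ℚ.* (ℕtoℚ 6 ℚ.* ((l + m₀) ÷ 6)) ^ℚ e
          ≡⟨ cong (ℕtoℚ C ℚ.*_) (*-^ (ℕtoℚ 6) ((l + m₀) ÷ 6) e) ⟩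
        ℕtoℚ C ℚ.* (ℕtoℚ 6 ^ℚ e ℚ.* ((l + m₀) ÷ 6) ^ℚ e)
          ≡⟨ *-assoc (ℕtoℚ C) (ℕtoℚ 6 ^ℚ e) (((l + m₀) ÷ 6) ^ℚ e) ⟨
        ℕtoℚ C ℚ.* ℕtoℚ 6 ^ℚ e ℚ.* ((l + m₀) ÷ 6) ^ℚ e
          ≡⟨ cong (ℚ._* ((l + m₀) ÷ 6) ^ℚ e) (trans (ℕtoℚ-* C (6 ^ e)) (cong (ℕtoℚ C ℚ.*_) (ℕtoℚ-^ 6 e))) ⟨
        ℕtoℚ (C * 6 ^ e) ℚ.* ((l + m₀) ÷ 6) ^ℚ e
          ≤⟨ mulˡ-≤ (ℕtoℚ-nonneg (C * 6 ^ e)) (^-mono-≤ e (÷-nonneg (l + m₀) 6) sixth) ⟩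
        ℕtoℚ (C * 6 ^ e) ℚ.* (ℕtoℚ l ℚ.* (1ℚ ℚ.+ m₀ ÷ (6 * ll))) ^ℚ e ∎)
      ≤-refl
      where
        open ≤-Reasoning
        0≤X : 0ℚ ℚ.≤ ℕtoℚ l ℚ.* (1ℚ ℚ.+ m₀ ÷ (6 * ll))
        0≤X = *-nonneg (ℕtoℚ-nonneg l) (+-nonneg 0≤1 (÷-nonneg m₀ (6 * ll)))

-- From stored edges to a preserver

module Preservers where

  open import Data.Fin.Subset using (_∩_)
  open import Data.Fin.Subset.Properties using (p∩q⊆p; x∈p∩q⁺; ∣p∩q∣≤∣q∣)
  open import Data.Vec using (tabulate)
  open import Relation.Nullary.Construct.Add.Supremum using ([_]; ⊤⁺)
  import Relation.Binary.Construct.Add.Supremum.NonStrict as AddSup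
  open import Defs
  open Rationals using (mulʳ-≤; +-nonneg; 0≤1)
  open Enclosures
  open Walks
  open Pairs
  open ScaledGraphs using (Stretch)

  -- Intersecting with the edges of G gives a subgraph without a record of where the stored pairs
  -- come from. Walks in `arcsIn` use edges of G anyway, so none is lost.
  keep : ∀ {n} → Digraph n → List (Fin n × Fin n) → PairSet n
  keep G es u = edges G u ∩ fromPairs es u

  size-keep : ∀ {n} (G : Digraph n) es → size (keep G es) ℕ.≤ length es
  size-keep {n} G es = ℕ.≤-trans (sum-mono (λ u → ∣p∩q∣≤∣q∣ (edges G u) (fromPairs es u))) (size-fromPairs es)
    where
      sum-mono : ∀ {f g : Fin n → ℕ} → (∀ u → f u ℕ.≤ g u) →
          Data.Vec.sum (tabulate f) ℕ.≤ Data.Vec.sum (tabulate g)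
      sum-mono {f} {g} le = ℕ.≤-trans
        (sum-tabulate-≤-+ f g (λ _ → 0) (λ u → subst (f u ℕ.≤_) (sym (ℕ.+-identityʳ (g u))) (le u)))
        (ℕ.≤-trans (ℕ.+-monoʳ-≤ _ (sum-tabulate-≤ {n} (λ _ → 0) 0 (λ _ → z≤n)))
          (ℕ.≤-reflexive (trans (cong (Data.Vec.sum (tabulate g) ℕ.+_) (ℕ.*-zeroʳ n)) (ℕ.+-identityʳ _))))

  stretch⇒preserver : ∀ {n} (G : Digraph n) (G≥0 : NonNegArcs (arcs G)) {ε δ δ′ t es} (P : PairSet n) →
    0ℚ ℚ.≤ δ → ε ∈[ δ , δ′ ] → t ℚ.≤ 1ℚ ℚ.+ δ →
    (∀ {u v} → v Subset.∈ P u → Stretch G t es u v) → IsPreserver G ε P (keep G es)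
  stretch⇒preserver G G≥0 {ε} {δ} {δ′} {t} {es} P 0≤δ ε∈ t≤ stretch =
    (λ u → p∩q⊆p (edges G u) (fromPairs es u)) ,
    λ u v v∈ → let d , D = dist G G≥0 u v
                   d* , D* = dist (G ↾ keep G es) (λ (v∈ , eq) → G≥0 (p∩q⊆p _ _ v∈ , eq)) u v
               in d , d* , D , D* , compare d d* D D* (stretch v∈)
    where
      kept : ∀ {u v w} → arcsIn G es u v w → arcs (G ↾ keep G es) u v w
      kept ((v∈ , eq) , e∈) = x∈p∩q⁺ (v∈ , ∈-fromPairs e∈) , eq
      compare : ∀ {u v} d d* → Dist (arcs G) u v d → Dist (arcs (G ↾ keep G es)) u v d* → Stretch G t es u v →
                d* ≤[ fromℕ 1 + ε ]· d
      compare ⊤⁺    d*     _ _ _ = d* AddSup.≤⊤⁺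
      compare [ d ] ⊤⁺     ((k , W) , _) ¬W* st = let k′ , ℓ′ , W′ , _ = st k d W in
        contradiction (k′ , mapWalk kept W′) (¬W* ℓ′)
      compare [ d ] [ d* ] ((k , W) , _) (_ , min*) st = let k′ , ℓ′ , W′ , ℓ′≤ = st k d W in
        AddSup.[ fromℚ-≤ (∈-* (+-nonneg 0≤1 0≤δ) 0≤d (∈-+ (∈-fromℚ 1ℚ) ε∈) (∈-fromℚ d))
          (ℚ.≤-trans (min* ℓ′ (k′ , mapWalk kept W′)) (ℚ.≤-trans ℓ′≤ (mulʳ-≤ 0≤d t≤))) ]
        where
          0≤d = walk-nonneg G≥0 W

-- Running the recursion on a given graph

module Construction where

  open import Defs hiding (_≤_; _<_; _+_; _-_; _*_; _/_; _⊓_; _^_; _⁻¹)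
  import Defs as ℝ
  open import Data.Nat using (_+_; _*_; _^_; _≤_; _<_; _/_)

  open import Data.Nat.Logarithm using (⌊log₂_⌋; ⌊log₂[2^n]⌋≡n)
  open Rationals using
    ( mulʳ-≤; *-nonneg; +-nonneg; 0≤1; _÷_; ÷-≤; ÷-<; ÷-pos; ÷-nonneg; ÷-cancel; ℕtoℚ-≤; ℕtoℚ-≤⁻¹;
      ℕtoℚ-nonneg; ℕtoℚ-+; ℕtoℚ-* )
  open Enclosures
  open Powers using (∈-^)
  open Walks
  open Pairs
  open ScaledGraphs using (Stretch)
  open Scales
  open Recursion using (module Recurse)
  open Approximation
  open TargetExponents
  open Growth
  open Errors
  open Preservers

  module Setup {a b : Cut} (Ra : IsReal a) (Rb : IsReal b) (1<a : fromℕ 1 ℝ.< a) (0≤b : fromℕ 0 ℝ.≤ b)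
      (g : Gap a b) (n : ℕ) where

    open Gap g using (threshold)

    N t : ℕ
    N = ⌊log₂ n ⌋
    t = threshold + (2 * N + 2)

    2N+2≤t : 2 * N + 2 ≤ t
    2N+2≤t = ℕ.m≤n+m (2 * N + 2) threshold

    instance
      t≢0 : NonZero t
      t≢0 = >-nonZero (ℕ.≤-trans (s≤s z≤n) (ℕ.≤-trans (ℕ.m≤n+m 2 (2 * N)) 2N+2≤t))

    open Encloses g N t (approximants Ra Rb 1<a 0≤b g t) (ℕ.m≤m+n threshold (2 * N + 2)) 2N+2≤t public

  -- Without demands n may be 0, and then the power is 0 by convention and lies outside the scope of
  -- `∈-^`.
  power≥0 : ∀ m {y} i τ .{{_ : NonZero τ}} i′ → y ∈[ i ÷ τ , ℕtoℚ i′ ] → ∃ λ q → m ℝ.^ y ∈[ 0ℚ , q ]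
  power≥0 zero    _ _       _  _  = 0ℚ , ∈-fromℚ 0ℚ
  power≥0 (suc m) i (suc τ) i′ y∈ = _ , ∈-^ (suc m) i (suc τ) i′ 0 y∈ z≤n

  HopsetsFor : (C′ e′ : ℕ) → Cut → Cut → Set₁
  HopsetsFor C′ e′ a b =
    ∀ (n : ℕ) (G : Digraph n) → PolyBounded 2 G → ∀ (ε : Cut) → IsReal ε → fromℕ 0 ℝ.< ε → ε ℝ.< fromℕ 1 →
    ∀ (β : ℕ) → 1 ≤ β → fromℕ β ℝ.≤ n ℝ.^ b →
    ∃ λ (H : PairSet n) → IsHopset G β ε H × fromℕ (size H) ℝ.≤ Hidden C′ e′ n
        ε ℝ.* (fromℕ (n ^ 2) ℝ./ β ℝ.^ a)

  module _ {a b : Cut} (Ra : IsReal a) (Rb : IsReal b) (1<a : fromℕ 1 ℝ.< a) (0≤b : fromℕ 0 ℝ.≤ b)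
      (g : Gap a b) (n : ℕ) where

    open Setup Ra Rb 1<a 0≤b g n hiding (Γ)

    -- The size bound of the algorithm is read at its upper end, with 2^(Y x) in place of β^a. As
    -- log s = σ + 1 ≤ N + 1, one hidden factor serves every level.
    hopsets : ∀ {C′ e′} → HopsetsFor C′ e′ a b → ∀ m .{{_ : NonZero m}} → 2 ≤ m →
      ∀ σ x → σ ≤ N → x * t ≤ ω * σ → ∀ (Γ : Digraph (2 ^ σ)) → PolyBounded 2 Γ →
      ∃ λ H → IsHopset Γ (2 ^ x) (fromℚ (1 ÷ m)) H ×
        size H * 2 ^ Y x ≤ C′ * (suc N * suc m) ^ e′ * 2 ^ (2 * σ)
    hopsets {C′} {e′} algorithm m 2≤m σ x σ≤N x≤ Γ Γ-bounded =
      let H , isH , le = algorithm s Γ Γ-bounded (fromℚ η) (fromℚ-isReal η)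
            (let q , 0<q , q<η = ℚ.<-dense (÷-pos 1 m) in q , 0<q , q<η)
            (let q , η<q , q<1 = ℚ.<-dense η<1 in q , η<q , q<1)
            (2 ^ x) (ℕ.m^n>0 2 x) (2^x≤s^b {σ} {x} x≤)
      in H , isH , count (size H) (∈-≤⁻¹ (∈-fromℚ (ℕtoℚ (size H))) bound∈ le)
      where
        s = 2 ^ σ
        y = 2 ^ Y x
        η = 1 ÷ m
        instance
          y≢0 : NonZero y
          y≢0 = ℕ.m^n≢0 2 (Y x)
        η<1 : η ℚ.< 1ℚ
        η<1 = ÷-< {1} {1} {m} {1} (subst (1 <_) (sym (ℕ.*-identityˡ m)) 2≤m)
        hid = C′ * (log s * suc m) ^ e′
        bound∈ : Hidden C′ e′ s (fromℚ η) ℝ.* (fromℕ (s ^ 2) ℝ./ (2 ^ x) ℝ.^ a) ∈[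
            0ℚ ℚ.* (ℕtoℚ (s ^ 2) ℚ.* 0ℚ) , ℕtoℚ hid ℚ.* (ℕtoℚ (s ^ 2) ℚ.* (1 ÷ y)) ]
        bound∈ = ∈-* ℚ.≤-refl (*-nonneg (ℕtoℚ-nonneg (s ^ 2)) ℚ.≤-refl) (Hidden-upper C′ e′ s m)
          (∈-* (ℕtoℚ-nonneg (s ^ 2)) ℚ.≤-refl (∈-fromℚ (ℕtoℚ (s ^ 2)))
            (∈-⁻¹ (ℕtoℚ-pos′ y) (ℚ.≤-trans (ℚ.≤-reflexive (ℚ.*-zeroˡ (ℕtoℚ ((2 ^ x) ^ A)))) 0≤1)
              (ℚ.≤-reflexive (sym (trans (ℚ.*-comm (1 ÷ y) (ℕtoℚ y)) (÷-cancel 1 y)))) (β^a∈ x)))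
          where
            ℕtoℚ-pos′ : ∀ k .{{_ : NonZero k}} → 0ℚ ℚ.< ℕtoℚ k
            ℕtoℚ-pos′ k = ÷-pos k 1
        log-s : log s ≡ suc σ
        log-s = cong suc (⌊log₂[2^n]⌋≡n σ)
        count : ∀ h → ℕtoℚ h ℚ.≤ ℕtoℚ hid ℚ.* (ℕtoℚ (s ^ 2) ℚ.* (1 ÷ y)) →
                h * y ≤ C′ * (suc N * suc m) ^ e′ * 2 ^ (2 * σ)
        count h le = ℕ.≤-trans (ℕtoℚ-≤⁻¹ {h * y} {hid * s ^ 2} (begin
            ℕtoℚ (h * y)                                                  ≡⟨ ℕtoℚ-* h y ⟩
            ℕtoℚ h ℚ.* ℕtoℚ y                                               ≤⟨ mulʳ-≤ (ℕtoℚ-nonneg y) le ⟩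
            ℕtoℚ hid ℚ.* (ℕtoℚ (s ^ 2) ℚ.* (1 ÷ y)) ℚ.* ℕtoℚ y
              ≡⟨ solve 4 (λ h s i y → h :* (s :* i) :* y := h :* s :* (y :* i)) refl (ℕtoℚ hid) (ℕtoℚ (s ^ 2))
                  (1 ÷ y) (ℕtoℚ y) ⟩
            ℕtoℚ hid ℚ.* ℕtoℚ (s ^ 2) ℚ.* (ℕtoℚ y ℚ.* (1 ÷ y))
              ≡⟨ trans (cong (ℕtoℚ hid ℚ.* ℕtoℚ (s ^ 2) ℚ.*_) (÷-cancel 1 y))
                  (ℚ.*-identityʳ (ℕtoℚ hid ℚ.* ℕtoℚ (s ^ 2))) ⟩
            ℕtoℚ hid ℚ.* ℕtoℚ (s ^ 2)                                     ≡⟨ ℕtoℚ-* hid (s ^ 2) ⟨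
            ℕtoℚ (hid * s ^ 2) ∎))
          (ℕ.*-mono-≤ (ℕ.*-monoʳ-≤ C′ (ℕ.^-monoˡ-≤ e′ (ℕ.*-monoˡ-≤ (suc m)
              (subst (_≤ suc N) (sym log-s) (s≤s σ≤N)))))
            (ℕ.≤-reflexive (trans (ℕ.^-*-assoc 2 σ 2) (cong (2 ^_) (ℕ.*-comm σ 2)))))
          where
            open ℚ.≤-Reasoning
            open +-*-Solver

  module Construct {a b : Cut} (Ra : IsReal a) (Rb : IsReal b) (1<a : fromℕ 1 ℝ.< a) (0≤b : fromℕ 0 ℝ.≤ b)
      (g : Gap a b)
    (c C′ e′ C₀ e₀ : ℕ) (algorithm : HopsetsFor C′ e′ a b)
    (overheadBound : ∀ N m₀ π → π ≤ 2 * N + 2 →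
      Quantities.overhead c C′ e′ (Gap.q₄ g + 3) N m₀ π ≤ C₀ * (suc N + m₀) ^ e₀)
    (n : ℕ) (G : Digraph n) (bounded : PolyBounded c G) (ε : Cut) (prec : Precision ε) where
    open Setup Ra Rb 1<a 0≤b g n
    open Precision prec
    open FinalError ε prec n

    Conclusion : ℕ → PairSet n → Set
    Conclusion p P = ∃ λ E → IsPreserver G ε′ P E ×
      fromℕ (size E) ℝ.≤ Hidden (C₀ * 6 ^ e₀) e₀ n ε′ ℝ.*
        (fromℕ n ℝ.* p ℝ.^ (fromℕ 1 ℝ.- fromℕ 1 ℝ./ k) ℝ.+ n ℝ.^ (fromℕ 2 ℝ./ a) ℝ.* p ℝ.^
            (fromℕ 1 ℝ.- fromℕ 1 ℝ./ a))

    G≥0 : NonNegArcs (arcs G)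
    G≥0 (v∈ , refl) = ℚ.<⇒≤ (proj₁ (bounded _ _ v∈))

    -- For p = 0 both powers of p are 0, so the bound may be 0 and no edge at all can be kept.
    noDemands : ∀ P → size P ≡ 0 → Conclusion 0 P
    noDemands P size≡0 = keep G [] ,
      stretch⇒preserver G G≥0 P (÷-nonneg 1 m₀) ε′∈ (ℚ.≤-reflexive refl) none ,
      fromℚ-≤ (∈-* (ℕtoℚ-nonneg (C₀ * (log n + m₀) ^ e₀)) (+-nonneg n*0≥0 0*0≥0) (proj₂ (Hidden-lower C₀ e₀))
        (∈-+ (∈-* (ℕtoℚ-nonneg n) ℚ.≤-refl (∈-fromℚ (ℕtoℚ n)) (∈-fromℚ 0ℚ))
             (∈-* ℚ.≤-refl ℚ.≤-refl (proj₂ (power≥0 n (2 * t) α′ {{α′≢0}} 2 2/a∈)) (∈-fromℚ 0ℚ))))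
        (ℚ.≤-trans (ℕtoℚ-≤ (size-keep G [])) (*-nonneg (ℕtoℚ-nonneg (C₀ * (log n + m₀) ^ e₀))
            (+-nonneg n*0≥0 0*0≥0)))
      where
        n*0≥0 : 0ℚ ℚ.≤ ℕtoℚ n ℚ.* 0ℚ
        n*0≥0 = *-nonneg (ℕtoℚ-nonneg n) ℚ.≤-refl
        0*0≥0 : 0ℚ ℚ.≤ 0ℚ ℚ.* 0ℚ
        0*0≥0 = ℚ.≤-refl
        none : ∀ {u v} → v Subset.∈ P u → Stretch G (1ℚ ℚ.+ 1 ÷ m₀) [] u v
        none {u} {v} v∈ = absurd (toPairs P) (trans (length-pairsOver (λ u → u) P) size≡0)
            (∈-pairsOver (λ u → u) P v∈)
          where
            absurd : ∀ xs → length xs ≡ 0 → (u , v) ∈ xs → Stretch G (1ℚ ℚ.+ 1 ÷ m₀) [] u v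
            absurd [] _ ()

    someDemands : ∀ p .{{_ : NonZero p}} .{{_ : NonZero n}} P → size P ≡ p → Conclusion p P
    someDemands p P size≡p =
      let es , es≤ , stretch = preserve π π≤2N+2 10π≤m (toPairs P) |P|≤
      in keep G es ,
         stretch⇒preserver G G≥0 P (÷-nonneg 1 m₀) ε′∈ factor≤ (λ v∈ → stretch (∈-pairsOver (λ u → u) P v∈)) ,
         fromℚ-≤ bound∈ (ℚ.≤-trans (ℕtoℚ-≤ (edges≤ es es≤)) (ℚ.≤-reflexive lower≡))
      where
        open Quantities c C′ e′ A N m₀ renaming (precision to m)
        w = ⌊log₂ p ⌋
        -- As 2^w ≤ p < 2^(w+1), the recursion starts at w + 1, while its target is taken at w,
        -- where 2^w ≤ p bounds the powers of p from below.
        π = suc w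
        top = suc N * (2 * c + 1)
        scales = scalesUpTo G c bounded top

        instance
          2N+2≢0 : NonZero (2 * N + 2)
          2N+2≢0 = >-nonZero (ℕ.≤-trans (s≤s z≤n) (ℕ.m≤n+m 2 (2 * N)))
          m≢0 : NonZero m
          m≢0 = ℕ.m*n≢0 (10 * (2 * N + 2)) m₀ {{ℕ.m*n≢0 10 (2 * N + 2)}}

        2≤m : 2 ≤ m
        2≤m = ℕ.≤-trans (ℕ.≤-trans (ℕ.m≤n+m 2 (2 * N)) (ℕ.m≤n*m (2 * N + 2) 10))
            (ℕ.m≤m*n (10 * (2 * N + 2)) m₀)

        2^N≤n : 2 ^ N ≤ n
        2^N≤n = 2^⌊log₂n⌋≤n n

        nKK≤ : n * n ^ c * n ^ c ≤ 2 ^ top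
        nKK≤ = begin
          n * n ^ c * n ^ c              ≡⟨ ℕ.^-distribˡ-+-* n (suc c) c ⟨
          n ^ (suc c + c)                     ≡⟨ cong (n ^_) (id c) ⟩
          n ^ (2 * c + 1)                   ≤⟨ ℕ.^-monoˡ-≤ (2 * c + 1) (ℕ.<⇒≤ (n<2^[1+⌊log₂n⌋] n)) ⟩
          (2 ^ suc N) ^ (2 * c + 1)       ≡⟨ ℕ.^-*-assoc 2 (suc N) (2 * c + 1) ⟩
          2 ^ top ∎
          where
            open ℕ.≤-Reasoning
            id : ∀ c → suc c + c ≡ 2 * c + 1
            id = solve-∀

        open ℕ.≤-Reasoning

        m≤2^θ : m ≤ 2 ^ θ
        m≤2^θ = ℕ.≤-trans (ℕ.≤-trans (ℕ.m≤n+m m (scaleCount * hidden))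
            (ℕ.m≤m+n (scaleCount * hidden + m) sampleLog)) total≤2^θ
        Λ≤2^θ : sampleLog ≤ 2 ^ θ
        Λ≤2^θ = ℕ.≤-trans (ℕ.m≤n+m sampleLog (scaleCount * hidden + m)) total≤2^θ
        JH≤2^θ : length scales * hidden ≤ 2 ^ θ
        JH≤2^θ = ℕ.≤-trans (ℕ.≤-reflexive (cong (_* hidden) (length-scalesUpTo G c bounded top)))
          (ℕ.≤-trans (ℕ.≤-trans (ℕ.m≤m+n (scaleCount * hidden) m)
              (ℕ.m≤m+n (scaleCount * hidden + m) sampleLog)) total≤2^θ)

        preserve = Recurse.preserve G G≥0 scales (covers G c bounded top nKK≤) t ω τ α₁ A N t≡ω+τ 0<τ 2N+2≤t
            α′≤At α′ω′≤ 2^N≤n (n<2^[1+⌊log₂n⌋] n)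
          m θ hidden m≤2^θ Λ≤2^θ JH≤2^θ (hopsets Ra Rb 1<a 0≤b g n {C′} {e′} algorithm m 2≤m)

        |P|≡ : length (toPairs P) ≡ p
        |P|≡ = trans (length-pairsOver (λ u → u) P) size≡p
        |P|≤ : length (toPairs P) ≤ 2 ^ π
        |P|≤ = subst (_≤ 2 ^ π) (sym |P|≡) (ℕ.<⇒≤ (n<2^[1+⌊log₂n⌋] p))

        π≤2N+2 : π ≤ 2 * N + 2
        π≤2N+2 = 2^-cancel-< (begin-strict
          2 ^ w                              ≤⟨ 2^⌊log₂n⌋≤n p ⟩
          p                                    ≡⟨ size≡p ⟨
          size P                               ≤⟨ size≤n² P ⟩
          n * n                              <⟨ ℕ.*-mono-< (n<2^[1+⌊log₂n⌋] n) (n<2^[1+⌊log₂n⌋] n) ⟩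
          2 ^ suc N * 2 ^ suc N          ≡⟨ ℕ.^-distribˡ-+-* 2 (suc N) (suc N) ⟨
          2 ^ (suc N + suc N)              ≡⟨ cong (2 ^_) (id N) ⟩
          2 ^ (2 * N + 2) ∎)
          where
            id : ∀ N → suc N + suc N ≡ 2 * N + 2
            id = solve-∀

        10π≤m : 10 * π ≤ m
        10π≤m = ℕ.≤-trans (ℕ.*-monoʳ-≤ 10 π≤2N+2) (ℕ.m≤m*n (10 * (2 * N + 2)) m₀)

        factor≤ : 1ℚ ℚ.+ (10 * π) ÷ m ℚ.≤ 1ℚ ℚ.+ 1 ÷ m₀
        factor≤ = ℚ.+-monoʳ-≤ 1ℚ (÷-≤ {10 * π} {1} {m} {m₀}
            (ℕ.≤-trans (ℕ.*-monoˡ-≤ m₀ (ℕ.*-monoʳ-≤ 10 π≤2N+2)) (ℕ.≤-reflexive (sym (ℕ.*-identityˡ m)))))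

        target′ : ℕ
        target′ = n * 2 ^ u w + 2 ^ v w

        edges≤ : ∀ es → length es ≤ suc π * (2 ^ (3 * θ + (2 * A + 16)) * sampleLog * target′) →
                 size (keep G es) ≤ C₀ * (log n + m₀) ^ e₀ * target′
        edges≤ es es≤ = begin
          size (keep G es)                                    ≤⟨ size-keep G es ⟩
          length es                                           ≤⟨ es≤ ⟩
          suc π * (2 ^ (3 * θ + (2 * A + 16)) * sampleLog * target′)
            ≡⟨ ℕ.*-assoc (suc π) (2 ^ (3 * θ + (2 * A + 16)) * sampleLog) target′ ⟨
          overhead π * target′
            ≤⟨ ℕ.*-monoˡ-≤ target′ (overheadBound N m₀ π π≤2N+2) ⟩
          C₀ * (log n + m₀) ^ e₀ * target′ ∎

        v₂ = w * α₁ / α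

        bound∈ = ∈-* (ℕtoℚ-nonneg (C₀ * (log n + m₀) ^ e₀))
            (+-nonneg (*-nonneg (ℕtoℚ-nonneg n) (ℕtoℚ-nonneg (2 ^ u w)))
            (*-nonneg (ℕtoℚ-nonneg (2 ^ v₁)) (ℕtoℚ-nonneg (2 ^ v₂))))
          (proj₂ (Hidden-lower C₀ e₀))
          (∈-+ (∈-* (ℕtoℚ-nonneg n) (ℕtoℚ-nonneg (2 ^ u w)) (∈-fromℚ (ℕtoℚ n))
              (p^[1-1/k]∈ {p} {w} (2^⌊log₂n⌋≤n p)))
               (∈-* (ℕtoℚ-nonneg (2 ^ v₁)) (ℕtoℚ-nonneg (2 ^ v₂)) (n^[2/a]∈ 2^N≤n)
                   (p^[1-1/a]∈ {p} {w} (2^⌊log₂n⌋≤n p))))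

        lower≡ : ℕtoℚ (C₀ * (log n + m₀) ^ e₀ * target′) ≡
                 ℕtoℚ (C₀ * (log n + m₀) ^ e₀) ℚ.* (ℕtoℚ n ℚ.* ℕtoℚ (2 ^ u w) ℚ.+ ℕtoℚ (2 ^ v₁) ℚ.* ℕtoℚ
                     (2 ^ v₂))
        lower≡ = trans (ℕtoℚ-* (C₀ * (log n + m₀) ^ e₀) target′) (cong (ℕtoℚ (C₀ * (log n + m₀) ^ e₀) ℚ.*_)
          (trans (ℕtoℚ-+ (n * 2 ^ u w) (2 ^ v w)) (cong₂ ℚ._+_ (ℕtoℚ-* n (2 ^ u w))
            (trans (cong ℕtoℚ (ℕ.^-distribˡ-+-* 2 v₁ v₂)) (ℕtoℚ-* (2 ^ v₁) (2 ^ v₂))))))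

    construct : ∀ p P → size P ≡ p → Conclusion p P
    construct zero      P size≡p = noDemands P size≡p
    construct p@(suc _) P size≡p = someDemands p {{_}} {{≢-nonZero n≢0}} P size≡p
      where
        n≢0 : n ≢ 0
        n≢0 n≡0 = contradiction (subst₂ _≤_ size≡p (cong (λ k → k * k) n≡0) (size≤n² P)) λ ()

-- Assembling the constants

open import Defs
open import Data.Nat as ℕ using (ℕ)
open import Data.Product using (∃; ∃₂; _×_)
open import Relation.Binary.PropositionalEquality using (_≡_)
open Approximation using (Gap; gap)
open Growth using (overhead≤)
open Errors using (precision)
open Construction using (module Construct)

theorem1p1 :
    (a b : Cut) → IsReal a → IsReal b →
    fromℕ 1 < a → fromℕ 0 ≤ b → b < fromℕ 1 ⊓ (a - fromℕ 1) ⁻¹ →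
    HopsetAlgorithm a b →
    let k = (fromℕ 2 - a * b) / (fromℕ 1 - b) in
    ∀ (c : ℕ) → ∃ λ (D : ℕ) → 1 ℕ.≤ D × (∃₂ λ (C e : ℕ) →
      ∀ (n : ℕ) (G : Digraph n) → PolyBounded c G →
      ∀ (ε : Cut) → IsReal ε → fromℕ 0 < ε → ε < fromℕ 1 →
      ∀ (p : ℕ) (P : PairSet n) → size P ≡ p →
      let ε′ = fromℕ D * ε * fromℕ (loglog n) in
      ∃ λ (E : PairSet n) →
        IsPreserver G ε′ P E ×
        fromℕ (size E) ≤
          Hidden C e n ε′ *
            (fromℕ n * p ^ (fromℕ 1 - fromℕ 1 / k) +
             n ^ (fromℕ 2 / a) * p ^ (fromℕ 1 - fromℕ 1 / a)))
theorem1p1 a b Ra Rb 1<a 0≤b b< algorithm c =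
  let g = gap Ra Rb 1<a 0≤b b<
      -- The hopset algorithm only ever meets sample graphs, whose weights have exponent 2; the
      -- exponent c enters through the number of scales.
      C′ , e′ , algorithm′ = algorithm 2
      C₀ , e₀ , overheadBound = overhead≤ c C′ e′ (Gap.q₄ g ℕ.+ 3)
  -- D = 1 suffices: the stretch is at most 1 + 1/m₀ ≤ 1 + ε. The factor 6^e₀ compensates for
  -- knowing ε only up to a factor 6.
  in 1 , ℕ.s≤s ℕ.z≤n , C₀ ℕ.* 6 ℕ.^ e₀ , e₀ ,
     λ n G bounded ε Rε 0<ε ε<1 →
       Construct.construct Ra Rb 1<a 0≤b g c C′ e′ C₀ e₀ algorithm′ overheadBound n G bounded ε
           (precision Rε 0<ε ε<1)
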